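{- For every $\alpha > 0$ there are $\epsilon, n_0 > 0$ such that the following holds. Let $G$ be an $\alpha$-expander on $n > n_0$ vertices, let $k \ge 6$, and let $H$ be a graph with at most $\frac{\epsilon n}{k\log n}$ vertices and at most $\frac{\epsilon n}{k \log n}$ edges. If $G$ is $\big(1-\tfrac4k,\ \tfrac{550\,\Delta(H)}{\alpha^2}\big)$-max-degree-robust, then $G$ contains $H$ as a topological minor. Furthermore, if $G$ is also $\big(1-\tfrac2k,\ \beta,\ 1+\tfrac2\beta\big)$-odd-cycle-robust for $\beta = \frac{\alpha}{3(1+\alpha)}$, then one can choose the parities of the lengths of all the edge embeddings in the minor (i.e. for every prescription of a parity for each edge of $H$ there is such a topological minor in which the path embedding each edge has the prescribed parity).
   Context: Graphs are finite, simple and undirected; $\log$ is base $2$; $\Delta(\cdot)$ is the maximum degree; $G[U]$ is the subgraph induced by $U$. The number $k$ may depend on $G$. A graph $G$ on $n$ vertices is an $\alpha$-expander if for all $U\subseteq V(G)$ with $|U|\le n/2$ the number of vertices in $V(G)\setminus U$ having a neighbor in $U$ is at least $\alpha|U|$. A graph $G$ on $n$ vertices is $(\kappa,d)$-max-degree-robust if $\Delta(G[U])\ge d$ for all $U\subseteq V(G)$ with $|U|\ge\kappa n$. For $\alpha>0$ let $D_\alpha=\frac{2}{\log(1+\alpha)}+3$. A graph $G$ on $n$ vertices is $(\kappa,\alpha,\ell)$-odd-cycle-robust if for all $U\subseteq V(G)$ with $|U|\ge\kappa n$ such that $G[U]$ is an $\alpha$-expander, $G[U]$ contains an odd cycle $C$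 of length $\ell\le|C|\le 3D_{\alpha/2}\log n$. $G$ contains $H$ as a topological minor if there is an injective map $\sigma:V(H)\to V(G)$ and for every $\{u,v\}\in E(H)$ a path $p_{uv}$ in $G$ from $\sigma(u)$ to $\sigma(v)$ that is pairwise vertex-disjoint from all other such paths except in the endpoints. The paths $p_{uv}$ are the edge embeddings of the minor; the length of a path is its number of edges. -}

module Defs where

open import Algebra.Bundles using (CommutativeRing)
import Algebra.Properties.Semiring.Exp as Exp
open import Data.Bool.Base using (Bool; T; false)
open import Data.Bool.Properties using (T?)
open import Data.Fin.Base as Fin using (Fin; zero; suc; inject₁)
open import Data.Fin.Properties as Fin using (any?)
open import Data.Fin.Subset using (Subset; inside; outside; ∣_∣)
open import Data.Fin.Subset.Properties using (_∈?_)
open import Data.Integer.Base as ℤ using (ℤ; +_; -[1+_])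
import Data.Integer.Properties as ℤ
open import Data.List.Base using (List; map; filter; allFin; cartesianProduct)
open import Data.List.Extrema.Nat using (max)
open import Data.Nat.Base as ℕ using (ℕ; zero; suc; parity)
import Data.Nat.Properties as ℕ
open import Data.Parity.Base using (1ℙ)
open import Data.Product.Base using (∃; ∃-syntax; _×_; _,_)
open import Data.Rational.Base as ℚ using (ℚ; 0ℚ; 1ℚ; _/_; mkℚ)
import Data.Rational.Properties as ℚ
import Data.Rational.Unnormalised.Base as ℚᵘ
import Data.Rational.Unnormalised.Properties as ℚᵘ
open import Data.Sum.Base using (_⊎_; inj₁; inj₂)
open import Data.Vec.Base using (_∷_; tabulate)
open import Function.Definitions using (Injective)
open import Relation.Binary.PropositionalEquality
  using (_≡_; _≢_; refl; sym; trans; cong; subst; subst₂)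
open import Relation.Nullary.Decidable.Core
  using (does; yes; no; _×-dec_; ¬?; ¬¬-excluded-middle)
open import Relation.Nullary.Negation.Core using (¬_; ¬¬-map; contradiction)

private
  open module Powℚ = Exp (CommutativeRing.semiring ℚ.+-*-commutativeRing)
    using () renaming (_^_ to _^ℚ_)

2ℚ : ℚ
2ℚ = + 2 / 1

module ℚ-lemmas where
  0≤/ : ∀ p q → 0ℚ ℚ.≤ + p / suc q
  0≤/ p q = ℚ.nonNegative⁻¹ _ {{ℚ.normalize-nonNeg p (suc q)}}

  0≤* : ∀ {s t} → 0ℚ ℚ.≤ s → 0ℚ ℚ.≤ t → 0ℚ ℚ.≤ s ℚ.* t
  0≤* {s} {t} 0≤s 0≤t = ℚ.nonNegative⁻¹ _
    {{ℚ.nonNeg*nonNeg⇒nonNeg s {{ℚ.nonNegative 0≤s}} t {{ℚ.nonNegative 0≤t}}}}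

  *-mono-≤ : ∀ {s t b c} → 0ℚ ℚ.≤ t → 0ℚ ℚ.≤ b → s ℚ.≤ b → t ℚ.≤ c → s ℚ.* t ℚ.≤ b ℚ.* c
  *-mono-≤ {s} {t} {b} {c} 0≤t 0≤b s≤b t≤c = ℚ.≤-trans
    (ℚ.*-monoʳ-≤-nonNeg t {{ℚ.nonNegative 0≤t}} s≤b)
    (ℚ.*-monoˡ-≤-nonNeg b {{ℚ.nonNegative 0≤b}} t≤c)

  0≤1 : 0ℚ ℚ.≤ 1ℚ
  0≤1 = 0≤/ 1 0

  0≤2 : 0ℚ ℚ.≤ 2ℚ
  0≤2 = 0≤/ 2 0

  1≤2 : 1ℚ ℚ.≤ 2ℚ
  1≤2 = ℚ.*≤* (ℤ.+≤+ (ℕ.s≤s ℕ.z≤n))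

  0≤^ : ∀ {s} → 0ℚ ℚ.≤ s → ∀ n → 0ℚ ℚ.≤ s ^ℚ n
  0≤^ 0≤s zero    = 0≤1
  0≤^ 0≤s (suc n) = 0≤* 0≤s (0≤^ 0≤s n)

  ^-monoˡ-≤ : ∀ {s t} → 0ℚ ℚ.≤ s → s ℚ.≤ t → ∀ n → s ^ℚ n ℚ.≤ t ^ℚ n
  ^-monoˡ-≤ 0≤s s≤t zero    = ℚ.≤-refl
  ^-monoˡ-≤ 0≤s s≤t (suc n) =
    *-mono-≤ (0≤^ 0≤s n) (ℚ.≤-trans 0≤s s≤t) s≤t (^-monoˡ-≤ 0≤s s≤t n)

  1≤^ : ∀ {s} → 1ℚ ℚ.≤ s → ∀ n → 1ℚ ℚ.≤ s ^ℚ n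
  1≤^ 1≤s zero    = ℚ.≤-refl
  1≤^ 1≤s (suc n) = *-mono-≤ 0≤1 (ℚ.≤-trans 0≤1 1≤s) 1≤s (1≤^ 1≤s n)

  ^-cancel-≤ : ∀ m n → 2ℚ ^ℚ m ℚ.≤ 2ℚ ^ℚ n → m ℕ.≤ n
  ^-cancel-≤ zero    n       _ = ℕ.z≤n
  ^-cancel-≤ (suc m) (suc n) p = ℕ.s≤s (^-cancel-≤ m n (ℚ.*-cancelˡ-≤-pos 2ℚ p))
  ^-cancel-≤ (suc m) zero    p = contradiction
    (ℚ.≤-trans (*-mono-≤ 0≤1 0≤2 (ℚ.≤-refl {2ℚ}) (1≤^ 1≤2 m)) p)
    (λ { (ℚ.*≤* (ℤ.+≤+ (ℕ.s≤s ()))) })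

  /-mono-≤ : ∀ a b c d → a ℤ.* + suc d ℤ.≤ c ℤ.* + suc b → a / suc b ℚ.≤ c / suc d
  /-mono-≤ a b c d p = ℚ.toℚᵘ-cancel-≤
    (ℚᵘ.≤-respˡ-≃ (ℚᵘ.≃-sym (ℚ.toℚᵘ-fromℚᵘ (ℚᵘ.mkℚᵘ a b)))
    (ℚᵘ.≤-respʳ-≃ (ℚᵘ.≃-sym (ℚ.toℚᵘ-fromℚᵘ (ℚᵘ.mkℚᵘ c d))) (ℚᵘ.*≤* p)))

  /-≤-ℕ : ∀ p q c → p ℕ.≤ c ℕ.* suc q → + p / suc q ℚ.≤ + c / 1
  /-≤-ℕ p q c h = /-mono-≤ (+ p) q (+ c) 0
    (subst₂ ℤ._≤_ (sym (ℤ.*-identityʳ (+ p))) (ℤ.pos-* c (suc q)) (ℤ.+≤+ h))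

  suc/1 : ∀ c → + suc c / 1 ℚ.≤ 1ℚ ℚ.+ + c / 1
  suc/1 c = ℚ.toℚᵘ-cancel-≤
    (ℚᵘ.≤-respˡ-≃ (ℚᵘ.≃-sym (ℚ.toℚᵘ-fromℚᵘ (ℚᵘ.mkℚᵘ (+ suc c) 0)))
    (ℚᵘ.≤-respʳ-≃ (ℚᵘ.≃-sym (ℚᵘ.≃-trans (ℚ.toℚᵘ-homo-+ 1ℚ (+ c / 1))
        (ℚᵘ.+-congʳ ℚᵘ.1ℚᵘ (ℚ.toℚᵘ-fromℚᵘ (ℚᵘ.mkℚᵘ (+ c) 0)))))
      (ℚᵘ.≤-reflexive (ℚᵘ.*≡* (cong (ℤ._* + 1) (cong (ℤ._+_ (+ 1)) (sym (ℤ.*-identityʳ (+ c)))))))))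

  ℕ≤2^ : ∀ c → + c / 1 ℚ.≤ 2ℚ ^ℚ c
  ℕ≤2^ zero    = 0≤1
  ℕ≤2^ (suc c) = ℚ.≤-trans (suc/1 c)
    (ℚ.≤-trans (ℚ.+-mono-≤ (1≤^ 1≤2 c) (ℕ≤2^ c)) (ℚ.≤-reflexive (sym double)))
    where
    x = 2ℚ ^ℚ c
    double : 2ℚ ℚ.* x ≡ x ℚ.+ x
    double = trans (ℚ.*-distribʳ-+ x 1ℚ 1ℚ) (trans
      (cong (ℚ._+ 1ℚ ℚ.* x) (ℚ.*-identityˡ x)) (cong (x ℚ.+_) (ℚ.*-identityˡ x)))

  ≤∣↥∣ : ∀ b → b ℚ.≤ + ℤ.∣ ℚ.↥ b ∣ / 1
  ≤∣↥∣ b = subst (ℚ._≤ + ℤ.∣ ℚ.↥ b ∣ / 1) (ℚ.↥p/↧p≡p b)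
    (/-mono-≤ (ℚ.↥ b) (ℚ.ℚ.denominator-1 b) (+ ℤ.∣ ℚ.↥ b ∣) 0 (num≤ (ℚ.↥ b)))
    where
    d = ℚ.ℚ.denominator-1 b
    num≤ : ∀ i → i ℤ.* + 1 ℤ.≤ + ℤ.∣ i ∣ ℤ.* + suc d
    num≤ (+ m)     = subst₂ ℤ._≤_ (sym (ℤ.*-identityʳ (+ m))) (ℤ.pos-* m (suc d))
                       (ℤ.+≤+ (ℕ.m≤m*n m (suc d)))
    num≤ (-[1+ m ]) = ℤ.≤-trans (ℤ.≤-reflexive (ℤ.*-identityʳ -[1+ m ])) ℤ.-≤+

open ℚ-lemmas

-- A nonnegative real is given by a nonempty, bounded-above set of
-- nonnegative rationals and denotes the supremum of that set.  Sets need not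
-- be downward closed, so distinct sets may denote the same real; only _≤_ and
-- _<_ below are used to compare reals.  Boundedness is double-negated so that
-- _⁻¹ can be total; classically this gives all of [0, ∞).

record ℝ≥0 : Set₁ where
  field
    _∋_       : ℚ → Set
    nonneg    : ∀ {s} → _∋_ s → 0ℚ ℚ.≤ s
    inhabited : ∃[ s ] _∋_ s
    bounded   : ¬ ¬ (∃[ b ] (∀ {s} → _∋_ s → s ℚ.≤ b))

open ℝ≥0 public using (_∋_)

infix  4 _≤_ _<_
infixl 6 _+_ _∸_
infixl 7 _*_ _÷_
infix  8 _⁻¹ _²

_≤_ : ℝ≥0 → ℝ≥0 → Set
x ≤ y = ∀ b → (∀ {t} → y ∋ t → t ℚ.≤ b) → (∀ {s} → x ∋ s → s ℚ.≤ b)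

_<_ : ℝ≥0 → ℝ≥0 → Set
x < y = ∃[ t ] (y ∋ t × ∃[ b ] (b ℚ.< t × (∀ {s} → x ∋ s → s ℚ.≤ b)))

fromℕ : ℕ → ℝ≥0
fromℕ n = record
  { _∋_       = λ s → s ≡ + n / 1
  ; nonneg    = λ { refl → 0≤/ n 0 }
  ; inhabited = _ , refl
  ; bounded   = λ ¬b → ¬b (_ , ℚ.≤-reflexive)
  }

_+_ : ℝ≥0 → ℝ≥0 → ℝ≥0
x + y = record
  { _∋_       = λ r → ∃[ s ] ∃[ t ] (x ∋ s × y ∋ t × r ≡ s ℚ.+ t)
  ; nonneg    = λ { (s , t , s∈x , t∈y , refl) → ℚ.+-mono-≤ (X.nonneg s∈x) (Y.nonneg t∈y) }
  ; inhabited = let (s , s∈x) = X.inhabited ; (t , t∈y) = Y.inhabited in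
                s ℚ.+ t , s , t , s∈x , t∈y , refl
  ; bounded   = λ ¬b → X.bounded λ { (b , x≤b) → Y.bounded λ { (c , y≤c) → ¬b (b ℚ.+ c ,
                λ { (s , t , s∈x , t∈y , refl) → ℚ.+-mono-≤ (x≤b s∈x) (y≤c t∈y) }) } }
  }
  where
  module X = ℝ≥0 x
  module Y = ℝ≥0 y

-- Truncated subtraction, max(0 , x - y).
_∸_ : ℝ≥0 → ℝ≥0 → ℝ≥0
x ∸ y = record
  { _∋_       = λ r → r ≡ 0ℚ ⊎
                      (0ℚ ℚ.≤ r × ∃[ s ] (x ∋ s × (∀ {t} → y ∋ t → r ℚ.+ t ℚ.≤ s)))
  ; nonneg    = λ { (inj₁ refl) → ℚ.≤-refl ; (inj₂ (0≤r , _)) → 0≤r }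
  ; inhabited = 0ℚ , inj₁ refl
  ; bounded   = λ ¬b → X.bounded λ { (b , x≤b) → ¬b (b , λ
      { (inj₁ refl) → let (s , s∈x) = X.inhabited in ℚ.≤-trans (X.nonneg s∈x) (x≤b s∈x)
      ; {r} (inj₂ (0≤r , s , s∈x , h)) → let (t , t∈y) = Y.inhabited in
          ℚ.≤-trans (ℚ.≤-trans (ℚ.≤-reflexive (sym (ℚ.+-identityʳ r)))
                                (ℚ.+-monoʳ-≤ r (Y.nonneg t∈y)))
                    (ℚ.≤-trans (h t∈y) (x≤b s∈x)) }) }
  }
  where
  module X = ℝ≥0 x
  module Y = ℝ≥0 y

_*_ : ℝ≥0 → ℝ≥0 → ℝ≥0
x * y = record
  { _∋_       = λ r → ∃[ s ] ∃[ t ] (x ∋ s × y ∋ t × r ≡ s ℚ.* t)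
  ; nonneg    = λ { (s , t , s∈x , t∈y , refl) → 0≤* (X.nonneg s∈x) (Y.nonneg t∈y) }
  ; inhabited = let (s , s∈x) = X.inhabited ; (t , t∈y) = Y.inhabited in
                s ℚ.* t , s , t , s∈x , t∈y , refl
  ; bounded   = λ ¬b → X.bounded λ { (b , x≤b) → Y.bounded λ { (c , y≤c) → ¬b (b ℚ.* c ,
                λ { (s , t , s∈x , t∈y , refl) → *-mono-≤ (Y.nonneg t∈y)
                      (ℚ.≤-trans (X.nonneg s∈x) (x≤b s∈x)) (x≤b s∈x) (y≤c t∈y) }) } }
  }
  where
  module X = ℝ≥0 x
  module Y = ℝ≥0 y

-- Total inverse, with 0 ⁻¹ = 0.
_⁻¹ : ℝ≥0 → ℝ≥0
x ⁻¹ = record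
  { _∋_       = λ r → r ≡ 0ℚ ⊎ (0ℚ ℚ.≤ r × (∃[ s ] (x ∋ s × 0ℚ ℚ.< s)) ×
                                 (∀ {s} → x ∋ s → r ℚ.* s ℚ.≤ 1ℚ))
  ; nonneg    = λ { (inj₁ refl) → ℚ.≤-refl ; (inj₂ (0≤r , _)) → 0≤r }
  ; inhabited = 0ℚ , inj₁ refl
  ; bounded   = λ ¬b → ¬¬-excluded-middle {A = ∃[ s ] (x ∋ s × 0ℚ ℚ.< s)} λ
      { (yes (s , s∈x , 0<s)) → let instance _ = ℚ.positive 0<s
                                             _ = ℚ.pos⇒nonZero s in
          ¬b (ℚ.1/ s , λ
            { (inj₁ refl) → ℚ.nonNegative⁻¹ _ {{ℚ.pos⇒nonNeg (ℚ.1/ s) {{ℚ.1/pos⇒pos s}}}}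
            ; (inj₂ (_ , _ , h)) → ℚ.*-cancelʳ-≤-pos s
                (ℚ.≤-trans (h s∈x) (ℚ.≤-reflexive (sym (ℚ.*-inverseˡ s)))) })
      ; (no ∄s) → ¬b (0ℚ , λ
          { (inj₁ refl) → ℚ.≤-refl
          ; (inj₂ (_ , ∃s , _)) → contradiction ∃s ∄s }) }
  }

_÷_ : ℝ≥0 → ℝ≥0 → ℝ≥0
x ÷ y = x * y ⁻¹

_² : ℝ≥0 → ℝ≥0
x ² = x * x

-- The base-2 logarithm of max(1 , x): the supremum of all p / q such that
-- 2 ^ p ≤ max(1 , x) ^ q.
log : ℝ≥0 → ℝ≥0
log x = record
  { _∋_       = λ r → ∃[ p ] ∃[ q ] ∃[ s ]
                      (x ∋ s × 2ℚ ^ℚ p ℚ.≤ (1ℚ ℚ.⊔ s) ^ℚ suc q × r ≡ + p / suc q)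
  ; nonneg    = λ { (p , q , _ , _ , _ , refl) → 0≤/ p q }
  ; inhabited = let (s , s∈x) = X.inhabited in
                0ℚ , 0 , 0 , s , s∈x , 1≤^ (ℚ.p≤p⊔q 1ℚ s) 1 , refl
  ; bounded   = ¬¬-map (λ { (b , x≤b) → let c = ℤ.∣ ℚ.↥ b ∣ in + c / 1 , λ
      { (p , q , s , s∈x , h , refl) → /-≤-ℕ p q c (^-cancel-≤ p (c ℕ.* suc q)
          (ℚ.≤-trans h (ℚ.≤-trans
            (^-monoˡ-≤ (ℚ.≤-trans 0≤1 (ℚ.p≤p⊔q 1ℚ s))
              (ℚ.⊔-lub (1≤^ 1≤2 c) (ℚ.≤-trans (x≤b s∈x) (ℚ.≤-trans (≤∣↥∣ b) (ℕ≤2^ c))))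
              (suc q))
            (ℚ.≤-reflexive (Powℚ.^-assocʳ 2ℚ c (suc q)))))) } }) X.bounded
  }
  where
  module X = ℝ≥0 x

D : ℝ≥0 → ℝ≥0
D α = fromℕ 2 ÷ log (fromℕ 1 + α) + fromℕ 3

record Graph (n : ℕ) : Set where
  field
    adj       : Fin n → Fin n → Bool
    symmetric : ∀ u v → adj u v ≡ adj v u
    loopless  : ∀ v → adj v v ≡ false

  infix 4 _~_

  _~_ : Fin n → Fin n → Set
  u ~ v = T (adj u v)

  degree : Fin n → ℕ
  degree v = ∣ tabulate (adj v) ∣

  -- Zero for the graph without vertices.
  Δ : ℕ
  Δ = max 0 (map degree (allFin n))

  -- Each edge is listed once, as the pair of its endpoints in increasing order.
  edges : List (Fin n × Fin n)
  edges = filter (λ (u , v) → (u Fin.<? v) ×-dec T? (adj u v))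
                 (cartesianProduct (allFin n) (allFin n))

  -- The vertices outside U having a neighbour in U.
  boundary : Subset n → Subset n
  boundary U = tabulate λ v →
    does (¬? (v ∈? U) ×-dec any? (λ u → (u ∈? U) ×-dec T? (adj v u)))

open Graph public using (Δ; edges)

-- The increasing enumeration of the elements of U.
element : ∀ {n} (U : Subset n) → Fin ∣ U ∣ → Fin n
element (inside  ∷ U) zero    = zero
element (inside  ∷ U) (suc i) = suc (element U i)
element (outside ∷ U) i       = suc (element U i)

-- The vertices of U are relabelled by Fin ∣ U ∣.
_[_] : ∀ {n} → Graph n → (U : Subset n) → Graph ∣ U ∣
G [ U ] = record
  { adj       = λ i j → adj (element U i) (element U j)
  ; symmetric = λ i j → symmetric (element U i) (element U j)
  ; loopless  = λ i → loopless (element U i)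
  }
  where open Graph G

record Path {n} (G : Graph n) (u v : Fin n) : Set where
  open Graph G
  field
    length    : ℕ
    vertex    : Fin (suc length) → Fin n
    start     : vertex zero ≡ u
    end       : vertex (Fin.fromℕ length) ≡ v
    injective : Injective _≡_ _≡_ vertex
    adjacent  : ∀ i → vertex (inject₁ i) ~ vertex (suc i)

  Visits : Fin n → Set
  Visits w = ∃[ i ] vertex i ≡ w

-- A cycle is a path of length at least 2 together with an edge joining its ends.
record Cycle {n} (G : Graph n) : Set where
  open Graph G
  field
    {first last} : Fin n
    path         : Path G first last
    nontrivial   : 2 ℕ.≤ Path.length path
    closing      : last ~ first

  length : ℕ
  length = suc (Path.length path)

-- An unordered pair is represented by its increasing ordering.
record Edge {m} (H : Graph m) : Set where
  open Graph H
  field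
    source target : Fin m
    ordered       : source Fin.< target
    adjacent      : source ~ target

  IsEnd : Fin m → Set
  IsEnd w = w ≡ source ⊎ w ≡ target

-- Distinct edge embeddings may only meet in a vertex that is an end of both.
record TopologicalMinor {m n} (H : Graph m) (G : Graph n) : Set where
  open Edge using (source; target; IsEnd)
  field
    σ         : Fin m → Fin n
    injective : Injective _≡_ _≡_ σ
    path      : (e : Edge H) → Path G (σ (source e)) (σ (target e))
    disjoint  : ∀ {e f} → e ≢ f → ∀ {x} →
                Path.Visits (path e) x → Path.Visits (path f) x →
                ∃[ w ] (IsEnd e w × IsEnd f w × x ≡ σ w)

Expander : ∀ {n} → ℝ≥0 → Graph n → Set
Expander {n} α G = ∀ (U : Subset n) → 2 ℕ.* ∣ U ∣ ℕ.≤ n →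
  α * fromℕ ∣ U ∣ ≤ fromℕ ∣ Graph.boundary G U ∣

MaxDegreeRobust : ∀ {n} → ℝ≥0 → ℝ≥0 → Graph n → Set
MaxDegreeRobust {n} κ d G = ∀ (U : Subset n) → κ * fromℕ n ≤ fromℕ ∣ U ∣ →
  d ≤ fromℕ (Δ (G [ U ]))

OddCycleRobust : ∀ {n} → ℝ≥0 → ℝ≥0 → ℝ≥0 → Graph n → Set
OddCycleRobust {n} κ α ℓ G = ∀ (U : Subset n) → κ * fromℕ n ≤ fromℕ ∣ U ∣ →
  Expander α (G [ U ]) →
  ∃ λ (C : Cycle (G [ U ])) →
    parity (Cycle.length C) ≡ 1ℙ ×
    ℓ ≤ fromℕ (Cycle.length C) ×
    fromℕ (Cycle.length C) ≤ fromℕ 3 * D (α ÷ fromℕ 2) * log (fromℕ n)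

{-# OPTIONS --safe #-}

-- The vertices of G are free, dead, or taken by objects and links. The dead set expands little into
-- the free set; since only few vertices are taken and G is an expander, such a set stays small, so
-- the free set always contains a vertex of large degree (compare Krivelevich and Nenadov).
-- A vertex h of H becomes an object: a root x together with a body F of deg(h) log n vertices, up to
-- constants, such that every Y ⊆ F has at most l·#∂Y vertices outside of Y, where ∂Y is the boundary
-- of Y ∪ {x} in F. It is grown greedily around a vertex of large degree; if no vertex can be added,
-- then, by submodularity, the intersection of the tight sets expands little and dies.
-- An edge of H becomes a short path between free exits of two bodies. The exits of an object stay
-- independent in the sense of Menger’s theorem, so that in the end disjoint paths in F join them all
-- to the root. Only few vertices of F are spoilt as exits; if the search from the others gets stuck,
-- then these others die, and h is released with its links, which are fewer vertices than died.
-- The triple (dead vertices, objects, links) increases lexicographically, so this process ends.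
-- For prescribed parities, the link runs through an odd cycle, which two short disjoint paths join to
-- the bodies; the second path is found by augmenting the first, and the parity decides on which side
-- the cycle is traversed.
-- The reals matter only through elements of the lower cuts that define them. In place of α, the
-- combinatorial part uses the least natural number g with #U ≤ g·#∂U for all U of at most n/2 vertices.

module Submission where

open import Data.Nat.Base as ℕ using (ℕ; zero; suc; parity; s≤s; z≤n)
import Data.Nat.Properties as ℕ
open import Algebra.Properties.CommutativeMonoid.Sum ℕ.+-0-commutativeMonoid
  using (sum; sum-cong-≗; ∑-distrib-+; ∑-comm)
open import Algebra.Properties.Semiring.Sum ℕ.+-*-semiring using (*-distribˡ-sum)
open import Data.Bool.Base using (true; false; T)
open import Data.Bool.Properties using (T?; T-irrelevant)
open import Data.Empty using (⊥; ⊥-elim)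
open import Data.Fin.Base as Fin using (Fin; zero; suc)
open import Data.Fin.Properties as Fin using (any?; all?; _≟_)
open import Data.Fin.Subset using (Subset) renaming (∣_∣ to card; _∈_ to _∈ˢ_)
open import Data.Fin.Subset.Properties using (anySubset?; _∈?_)
open import Data.List.Base
  using (List; []; _∷_; _++_; length; reverse; map; filter; tabulate; allFin; cartesianProduct)
open import Data.List.Extrema ℕ.≤-totalOrder using (argmax-sel; xs≤max)
import Data.List.Membership.DecPropositional as DecL
import Data.List.Membership.Propositional as L
import Data.List.Membership.Propositional.Properties as L
open import Data.List.Properties
  using (unfold-reverse; length-++; length-reverse; length-tabulate; filter-++; map-tabulate)
open import Data.List.Relation.Unary.All as All using (All; []; _∷_)
open import Data.List.Relation.Unary.AllPairs using ([]; _∷_)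
open import Data.List.Relation.Unary.Any using (here; there)
open import Data.List.Relation.Unary.Any.Properties using (++⁺ˡ; ++⁺ʳ; ++⁻; reverse⁻)
open import Data.List.Relation.Unary.Unique.Propositional using (Unique)
open import Data.List.Relation.Unary.Unique.Propositional.Properties as Unique using (++⁺)
open import Data.Maybe.Base using (Maybe; just; nothing; is-just)
open import Data.Maybe.Properties using (just-injective)
open import Data.Parity.Base as ℙ using (Parity; 0ℙ; 1ℙ)
import Data.Parity.Properties as ℙ
open import Data.Product.Base using (Σ; ∃; _×_; _,_; proj₁; proj₂)
open import Data.Sum.Base using (_⊎_; inj₁; inj₂)
open import Data.Unit.Base using (tt)
open import Data.Vec.Base as Vec using (Vec; []; _∷_)
import Data.Vec.Properties as Vec
open import Defs using (Graph; Path; Cycle; Edge; TopologicalMinor; _[_]; element; edges; Δ)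
open import Function.Base using (_∘_; id; case_of_; _$_)
open import Relation.Binary.Definitions using (DecidableEquality; tri<; tri≈; tri>)
open import Relation.Binary.PropositionalEquality hiding ([_])
open import Relation.Nullary.Decidable using (Dec; does; yes; no; _×-dec_; _⊎-dec_; ¬?; map′; decidable-stable)
open import Relation.Nullary.Negation using (¬_; contradiction)

-- The parameter `g` is chosen after the graph, and its minimality matters. Degrees and cycle
-- lengths are granted in terms of `α`, so a `g` far above `1 / α` would demand more than the
-- hypotheses give, yet a lower cut offers no computable upper bound near `1 / α`. Searching the
-- finitely many vertex sets yields a `g` that is either `1` or comes with a set violating expansion
-- for `g - 1`; in both cases `α * g ≤ 1 + α`. Constants that must not depend on the graph use
-- `suc g₀ ≥ g` instead, read off one positive element of `α`. The obstacle in the process is that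
-- releasing an object returns vertices to the free set, possibly next to dead ones. Bodies are
-- therefore so large that the vertices dying with an object outweigh all the released ones by a
-- factor `4 * g`, and the bound on the dead boundary survives. A parity link keeps both parities
-- open on one fixed vertex set: the length of an edge embedding also depends on the paths inside
-- the two bodies, which are chosen after the process has ended.

module ℕ-Arithmetic where
  open import Data.Nat.Base public hiding (ℕ; zero; suc; parity; s≤s; z≤n)
  open import Data.Nat.Properties public hiding (_≟_)
  open import Data.Nat.Tactic.RingSolver public using (solve-∀)

-- Counting and searching finite sets.

module FiniteSets where
  open ℕ-Arithmetic

  -- Linear arithmetic certificate: from A ≤ B, conclude x ≤ y when y − x ≥ B − A identically.
  linear : ∀ {A B x y} s → A ≤ B → x + B + s ≡ y + A → x ≤ y
  linear {A} {B} {x} {y} s A≤B eq = +-cancelʳ-≤ B x y $ begin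
    x + B       ≤⟨ m≤m+n (x + B) s ⟩
    x + B + s   ≡⟨ eq ⟩
    y + A       ≤⟨ +-monoʳ-≤ y A≤B ⟩
    y + B       ∎
    where open ≤-Reasoning

  infixr 4 _⊕_
  _⊕_ : ∀ {a b c d} → a ≤ b → c ≤ d → a + c ≤ b + d
  _⊕_ = +-mono-≤

  infixr 5 _⊛_
  _⊛_ : ∀ k {a b} → a ≤ b → k * a ≤ k * b
  _⊛_ = *-monoʳ-≤

  private variable
    n : ℕ

  bit : ∀ {P : Set} → Dec P → ℕ
  bit (yes _) = 1
  bit (no _)  = 0

  bit-yes : ∀ {P : Set} (d : Dec P) → P → 1 ≤ bit d
  bit-yes (yes _) _ = ≤-refl
  bit-yes (no ¬p) p = contradiction p ¬p

  bit-no : ∀ {P : Set} (d : Dec P) → ¬ P → bit d ≡ 0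
  bit-no (yes p) ¬p = contradiction p ¬p
  bit-no (no _) _   = refl

  bit≤1 : ∀ {P : Set} (d : Dec P) → bit d ≤ 1
  bit≤1 (yes _) = ≤-refl
  bit≤1 (no _)  = z≤n

  bit-mono : ∀ {P Q : Set} (d : Dec P) (e : Dec Q) → (P → Q) → bit d ≤ bit e
  bit-mono (yes p) e f = bit-yes e (f p)
  bit-mono (no _)  e f = z≤n

  sum-mono : (f g : Fin n → ℕ) → (∀ i → f i ≤ g i) → sum f ≤ sum g
  sum-mono {zero}  f g h = z≤n
  sum-mono {suc n} f g h = h zero ⊕ sum-mono (f ∘ suc) (g ∘ suc) (h ∘ suc)

  sum-mono-< : (f g : Fin n → ℕ) → (∀ i → f i ≤ g i) → ∀ j → f j < g j → sum f < sum g
  sum-mono-< {suc n} f g h zero    p = +-mono-<-≤ p (sum-mono (f ∘ suc) (g ∘ suc) (h ∘ suc))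
  sum-mono-< {suc n} f g h (suc j) p = +-mono-≤-< (h zero) (sum-mono-< (f ∘ suc) (g ∘ suc) (h ∘ suc) j p)

  term≤sum : (f : Fin n → ℕ) → ∀ i → f i ≤ sum f
  term≤sum {suc n} f zero    = m≤m+n _ _
  term≤sum {suc n} f (suc i) = ≤-trans (term≤sum (f ∘ suc) i) (m≤n+m _ _)

  sum-const : ∀ n c → sum {n} (λ _ → c) ≡ n * c
  sum-const zero    c = refl
  sum-const (suc n) c = cong (c +_) (sum-const n c)

  -- Sets carry an arbitrary decidable predicate rather than a Boolean vector, so that a membership
  -- proof is a tuple of reasons that can be matched on. Equality of sets is replaced by mutual
  -- inclusion.
  record DecSet (n : ℕ) : Set₁ where
    constructor ⟪_⟫
    field
      {mem} : Fin n → Set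
      dec   : ∀ v → Dec (mem v)

  open DecSet public

  infix  4 _∈_ _∉_ _⊆_
  infixl 6 _∪_ _∖_
  infixl 7 _∩_

  _∈_ _∉_ : Fin n → DecSet n → Set
  v ∈ X = mem X v
  v ∉ X = ¬ v ∈ X

  _⊆_ : DecSet n → DecSet n → Set
  X ⊆ Y = ∀ {v} → v ∈ X → v ∈ Y

  _∪_ _∩_ _∖_ : DecSet n → DecSet n → DecSet n
  X ∪ Y = ⟪ (λ v → dec X v ⊎-dec dec Y v) ⟫
  X ∩ Y = ⟪ (λ v → dec X v ×-dec dec Y v) ⟫
  X ∖ Y = ⟪ (λ v → dec X v ×-dec ¬? (dec Y v)) ⟫

  ⁅_⁆ : Fin n → DecSet n
  ⁅ x ⁆ = ⟪ (λ v → v ≟ x) ⟫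

  ∅ : DecSet n
  ∅ = ⟪ (λ v → no id) ⟫

  # : DecSet n → ℕ
  # X = sum (λ v → bit (dec X v))

  #-submodular : ∀ (A B C D : DecSet n) → (A ⊆ C ∪ D) → (B ⊆ C ∪ D) → (A ∩ B ⊆ C ∩ D) →
                 # A + # B ≤ # C + # D
  #-submodular A B C D f g h =
    subst₂ _≤_ (∑-distrib-+ (λ v → bit (dec A v)) (λ v → bit (dec B v)))
               (∑-distrib-+ (λ v → bit (dec C v)) (λ v → bit (dec D v)))
      (sum-mono _ _ pointwise)
    where
    pointwise : ∀ v → bit (dec A v) + bit (dec B v) ≤ bit (dec C v) + bit (dec D v)
    pointwise v with dec A v | dec B v
    ... | yes a | yes b = bit-yes (dec C v) (proj₁ (h (a , b))) ⊕ bit-yes (dec D v) (proj₂ (h (a , b)))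
    ... | no _  | no _  = z≤n
    ... | yes a | no _ with f a
    ...   | inj₁ c = ≤-trans (bit-yes (dec C v) c) (m≤m+n _ _)
    ...   | inj₂ d = ≤-trans (bit-yes (dec D v) d) (m≤n+m _ _)
    pointwise v | no _  | yes b with g b
    ...   | inj₁ c = ≤-trans (bit-yes (dec C v) c) (m≤m+n _ _)
    ...   | inj₂ d = ≤-trans (bit-yes (dec D v) d) (m≤n+m _ _)

  #-mono : (A B : DecSet n) → A ⊆ B → # A ≤ # B
  #-mono A B f = sum-mono _ _ λ v → bit-mono (dec A v) (dec B v) f

  #-empty : (A : DecSet n) → (∀ {v} → v ∉ A) → # A ≡ 0
  #-empty {n} A ¬A = trans (sum-cong-≗ (λ v → bit-no (dec A v) ¬A)) (trans (sum-const n 0) (*-zeroʳ n))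

  #-union : (A B C : DecSet n) → A ⊆ B ∪ C → # A ≤ # B + # C
  #-union {n} A B C f = ≤-trans (m≤m+n (# A) (# (∅ {n})))
    (#-submodular A ∅ B C f (λ ()) (λ ()))

  #-disjoint : (A B C : DecSet n) → A ⊆ C → B ⊆ C → (∀ {v} → v ∈ A → v ∈ B → ⊥) → # A + # B ≤ # C
  #-disjoint {n} A B C f g h = ≤-trans
    (#-submodular A B C ∅ (inj₁ ∘ f) (inj₁ ∘ g) (λ (a , b) → ⊥-elim (h a b)))
    (≤-reflexive (trans (cong (# C +_) (#-empty {n} ∅ id)) (+-identityʳ _)))

  #≤n : (A : DecSet n) → # A ≤ n
  #≤n {n} A = ≤-trans (sum-mono _ _ (λ v → bit≤1 (dec A v))) (≤-reflexive (trans (sum-const n 1) (*-identityʳ n)))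

  #-inhabited : (A : DecSet n) → ∀ {x} → x ∈ A → 1 ≤ # A
  #-inhabited A {x} x∈A = ≤-trans (bit-yes (dec A x) x∈A) (term≤sum _ x)

  #-subsingleton : (A : DecSet n) → (∀ {u v} → u ∈ A → v ∈ A → u ≡ v) → # A ≤ 1
  #-subsingleton {zero}  A u = z≤n
  #-subsingleton {suc n} A u with dec A zero
  ... | yes z = s≤s (≤-reflexive (#-empty ⟪ dec A ∘ suc ⟫ (λ q → case u z q of λ ())))
  ... | no _  = #-subsingleton ⟪ dec A ∘ suc ⟫ (λ p q → case u p q of λ { refl → refl })

  #⁅⁆≤1 : (x : Fin n) → # ⁅ x ⁆ ≤ 1
  #⁅⁆≤1 x = #-subsingleton ⁅ x ⁆ (λ { refl refl → refl })

  #-two : (A : DecSet n) → ∀ {x y} → x ∈ A → y ∈ A → x ≢ y → 2 ≤ # A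
  #-two A {x} {y} x∈ y∈ x≢y = ≤-trans (#-inhabited ⁅ x ⁆ refl ⊕ #-inhabited ⁅ y ⁆ refl)
    (#-disjoint ⁅ x ⁆ ⁅ y ⁆ A (λ { refl → x∈ }) (λ { refl → y∈ }) (λ { refl refl → x≢y refl }))

  #-insert : ∀ (A : DecSet n) {x} → x ∉ A → # (A ∪ ⁅ x ⁆) ≡ suc (# A)
  #-insert A {x} x∉A = ≤-antisym
    (≤-trans (#-union (A ∪ ⁅ x ⁆) A ⁅ x ⁆ id) (≤-trans (≤-refl {# A} ⊕ #⁅⁆≤1 x) (≤-reflexive (+-comm _ 1))))
    (≤-trans (≤-reflexive (+-comm 1 _)) (≤-trans (≤-refl {# A} ⊕ #-inhabited ⁅ x ⁆ refl)
      (#-disjoint A ⁅ x ⁆ (A ∪ ⁅ x ⁆) inj₁ inj₂ (λ { a refl → x∉A a }))))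

  nonempty : (A : DecSet n) → 1 ≤ # A → ∃ λ x → x ∈ A
  nonempty A p with any? (dec A)
  ... | yes e = e
  ... | no ¬e = contradiction (subst (1 ≤_) (#-empty A (λ a → ¬e (_ , a))) p) λ ()

  #-⋃ : ∀ {m} (A : DecSet n) (B : Fin m → DecSet n) → (∀ {v} → v ∈ A → ∃ λ i → v ∈ B i) →
        # A ≤ sum (λ i → # (B i))
  #-⋃ A B f = ≤-trans
    (sum-mono _ _ pointwise) (≤-reflexive (∑-comm (λ v i → bit (dec (B i) v))))
    where
    pointwise : ∀ v → bit (dec A v) ≤ sum (λ i → bit (dec (B i) v))
    pointwise v with dec A v
    ... | no _  = z≤n
    ... | yes a = let i , b = f a in
      ≤-trans (bit-yes (dec (B i) v) b) (term≤sum (λ i → bit (dec (B i) v)) i)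

  full : ∀ m → DecSet m
  full m = ⟪ (λ _ → yes tt) ⟫

  #full : ∀ m → # (full m) ≡ m
  #full m = trans (sum-const m 1) (*-identityʳ m)

  #-cong : (A B : DecSet n) → A ⊆ B → B ⊆ A → # A ≡ # B
  #-cong A B f g = ≤-antisym (#-mono A B f) (#-mono B A g)

  infix 4 _⊆?_
  _⊆?_ : (A B : DecSet n) → Dec (A ⊆ B)
  A ⊆? B = map′ (λ f {v} a → case f v of λ { (inj₁ ¬a) → contradiction a ¬a ; (inj₂ b) → b })
                (λ f v → case dec A v of λ { (yes a) → inj₂ (f a) ; (no ¬a) → inj₁ ¬a })
                (all? (λ v → ¬? (dec A v) ⊎-dec dec B v))

  fromSubset : Subset n → DecSet n
  fromSubset V = ⟪ (λ v → T? (Vec.lookup V v)) ⟫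

  toSubset : DecSet n → Subset n
  toSubset X = Vec.tabulate (λ v → does (dec X v))

  to∈ : (X : DecSet n) → X ⊆ fromSubset (toSubset X)
  to∈ X {v} x rewrite Vec.lookup∘tabulate (λ v → does (dec X v)) v with dec X v
  ... | yes _ = tt
  ... | no ¬x = ¬x x

  ∈to : (X : DecSet n) → fromSubset (toSubset X) ⊆ X
  ∈to X {v} t rewrite Vec.lookup∘tabulate (λ v → does (dec X v)) v with dec X v
  ... | yes x = x

  -- Exhaustive search runs over Boolean vectors; invariance under mutual inclusion carries its
  -- verdict over to every `DecSet` with the same elements.
  Extensional : (DecSet n → Set) → Set₁
  Extensional P = ∀ X Y → X ⊆ Y → Y ⊆ X → P X → P Y

  search : {P : DecSet n → Set} → (∀ X → Dec (P X)) → Extensional P →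
           (Σ (DecSet n) λ X → P X) ⊎ (∀ X → ¬ P X)
  search P? ext with anySubset? (P? ∘ fromSubset)
  ... | yes (V , p) = inj₁ (fromSubset V , p)
  ... | no ¬e       = inj₂ λ X p → ¬e (toSubset X , ext X _ (to∈ X) (∈to X) p)

  smallest : {P : DecSet n → Set} → (∀ X → Dec (P X)) → Extensional P → ∀ X → P X →
             Σ (DecSet n) λ M → P M × (∀ Y → P Y → # M ≤ # Y)
  smallest {n} {P} P? ext X₀ p₀ = go (# X₀) X₀ p₀ ≤-refl
    where
    go : ∀ k X → P X → # X ≤ k → Σ (DecSet n) λ M → P M × (∀ Y → P Y → # M ≤ # Y)
    go k X p X≤k with anySubset? (λ V → P? (fromSubset V) ×-dec (suc (# (fromSubset V)) ≤? # X))
    ... | no ¬e = X , p , λ Y q → ≮⇒≥ λ Y<X → ¬e (toSubset Y , ext Y _ (to∈ Y) (∈to Y) q ,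
            ≤-trans (s≤s (#-mono _ Y (∈to Y))) Y<X)
    go zero    X p X≤k | yes (V , q , V<X) = contradiction (≤-trans V<X X≤k) λ ()
    go (suc k) X p X≤k | yes (V , q , V<X) = go k (fromSubset V) q (s≤s⁻¹ (≤-trans V<X X≤k))

  subsetOfSize : ∀ d (D : DecSet n) k → # D ≡ d + k → Σ (DecSet n) λ E → E ⊆ D × # E ≡ k
  subsetOfSize zero    D k eq = D , id , eq
  subsetOfSize (suc d) D k eq with nonempty D (≤-trans (s≤s z≤n) (≤-reflexive (sym eq)))
  ... | x , x∈D with subsetOfSize d (D ∖ ⁅ x ⁆) k (suc-injective removed)
    where
    open ≡-Reasoning
    removed : suc (# (D ∖ ⁅ x ⁆)) ≡ suc (d + k)
    removed = begin
      suc (# (D ∖ ⁅ x ⁆))          ≡⟨ #-insert (D ∖ ⁅ x ⁆) (λ (_ , ≢) → ≢ refl) ⟨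
      # ((D ∖ ⁅ x ⁆) ∪ ⁅ x ⁆)      ≡⟨ #-cong ((D ∖ ⁅ x ⁆) ∪ ⁅ x ⁆) D (λ { (inj₁ (d , _)) → d ; (inj₂ refl) → x∈D })
                                        (λ {v} v∈D → case v ≟ x of λ { (yes eq) → inj₂ eq ; (no ≢) → inj₁ (v∈D , ≢) }) ⟩
      # D                          ≡⟨ eq ⟩
      suc (d + k)                  ∎
  ...   | E , E⊆ , sz = E , proj₁ ∘ E⊆ , sz

  half : ∀ k → ∃ λ e → 2 * e ≤ k × k ≤ 2 * e + 1
  half zero          = 0 , z≤n , z≤n
  half (suc zero)    = 0 , z≤n , s≤s z≤n
  half (suc (suc k)) = let e , p , q = half k in suc e ,
    ≤-trans (≤-reflexive (*-suc 2 e)) (s≤s (s≤s p)) ,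
    ≤-trans (s≤s (s≤s q)) (≤-reflexive (cong (_+ 1) (sym (*-suc 2 e))))

open FiniteSets

+-involutive : ∀ p q → p ℙ.+ (p ℙ.+ q) ≡ q
+-involutive 0ℙ _  = refl
+-involutive 1ℙ 0ℙ = refl
+-involutive 1ℙ 1ℙ = refl

module Combinatorics {n} (G : Graph n) where
  open ℕ-Arithmetic

  open Graph G using (adj; symmetric; loopless; _~_)

  -- Separation and Menger’s theorem

  V : Set
  V = Fin n

  ~-sym : ∀ {u v} → u ~ v → v ~ u
  ~-sym {u} {v} = subst T (symmetric u v)

  -- The vertices of W ∖ Y that are adjacent to Y or to a virtual root whose neighbourhood is L.
  ∂ : DecSet n → DecSet n → DecSet n → DecSet n
  ∂ W L Y = ⟪ (λ v → dec W v ×-dec (¬? (dec Y v) ×-dec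
                  (dec L v ⊎-dec any? (λ u → dec Y u ×-dec T? (adj u v))))) ⟫

  -- A boundary vertex of `Y ∩ Z` lies outside `Y` or outside `Z` and bounds that set; one of
  -- `Y ∪ Z` lies outside both and bounds the set that it is reached from. A vertex counted twice on
  -- the left is attached to `Y ∩ Z` or to the root and lies outside both sets, so it is counted
  -- twice on the right.
  #∂-submodular : ∀ W L Y Z → # (∂ W L (Y ∩ Z)) + # (∂ W L (Y ∪ Z)) ≤ # (∂ W L Y) + # (∂ W L Z)
  #∂-submodular W L Y Z = #-submodular (∂ W L (Y ∩ Z)) (∂ W L (Y ∪ Z)) (∂ W L Y) (∂ W L Z)
    (λ {v} (w , ∉∩ , r) → case dec Y v of λ
      { (no ∉Y)  → inj₁ (w , ∉Y , (case r of λ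
          { (inj₁ l) → inj₁ l ; (inj₂ (u , (y , _) , a)) → inj₂ (u , y , a) }))
      ; (yes ∈Y) → inj₂ (w , (λ z → ∉∩ (∈Y , z)) , (case r of λ
          { (inj₁ l) → inj₁ l ; (inj₂ (u , (_ , z) , a)) → inj₂ (u , z , a) })) })
    (λ (w , ∉∪ , r) → case r of λ
      { (inj₁ l)                → inj₁ (w , ∉∪ ∘ inj₁ , inj₁ l)
      ; (inj₂ (u , inj₁ y , a)) → inj₁ (w , ∉∪ ∘ inj₁ , inj₂ (u , y , a))
      ; (inj₂ (u , inj₂ z , a)) → inj₂ (w , ∉∪ ∘ inj₂ , inj₂ (u , z , a)) })
    (λ ((w , _ , r) , (_ , ∉∪ , _)) → (case r of λ
      { (inj₁ l)                    → (w , ∉∪ ∘ inj₁ , inj₁ l) , (w , ∉∪ ∘ inj₂ , inj₁ l)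
      ; (inj₂ (u , (y , z) , a)) → (w , ∉∪ ∘ inj₁ , inj₂ (u , y , a)) , (w , ∉∪ ∘ inj₂ , inj₂ (u , z , a)) }))

  ∂-mono : ∀ W W′ L Y Y′ → W ⊆ W′ → Y ⊆ Y′ → (∀ {v} → v ∈ W → v ∉ Y → v ∉ Y′) → ∂ W L Y ⊆ ∂ W′ L Y′
  ∂-mono W W′ L Y Y′ f g h (w , ∉Y , inj₁ l)           = f w , h w ∉Y , inj₁ l
  ∂-mono W W′ L Y Y′ f g h (w , ∉Y , inj₂ (u , y , a)) = f w , h w ∉Y , inj₂ (u , g y , a)

  -- By Menger's theorem, for λ = 1 and E ⊆ W this says that E can be joined to the
  -- root by paths in W that are disjoint outside the root.
  Indep : ℕ → (E W L : DecSet n) → Set₁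
  Indep λ′ E W L = ∀ Y → Y ⊆ W → # (E ∖ Y) ≤ λ′ * # (∂ W L Y)

  -- Under `Indep` this means equality: the ends outside `Y` already saturate the boundary of `Y`.
  Tight : ℕ → (E W L Y : DecSet n) → Set
  Tight λ′ E W L Y = λ′ * # (∂ W L Y) ≤ # (E ∖ Y)

  Indep-⊆ : ∀ λ′ E E′ W L → E′ ⊆ E → Indep λ′ E W L → Indep λ′ E′ W L
  Indep-⊆ λ′ E E′ W L f ind Y Y⊆W =
    ≤-trans (#-mono (E′ ∖ Y) (E ∖ Y) (λ (e , ∉Y) → f e , ∉Y)) (ind Y Y⊆W)

  record MinTight (λ′ : ℕ) (E W L : DecSet n) : Set₁ where
    field
      core    : DecSet n
      core⊆W  : core ⊆ W
      tight   : Tight λ′ E W L core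
      minimal : ∀ Y → Y ⊆ W → Tight λ′ E W L Y → core ⊆ Y

  -- Boundary sizes are submodular, the sizes of `E ∖ Y` are modular, and `Indep` holds at the
  -- union, so two tight sets meet in a tight set. A tight set of least size is hence contained in
  -- all others. The search can start from `W`, which has no boundary in itself.
  minTight : ∀ λ′ E W L → Indep λ′ E W L → MinTight λ′ E W L
  minTight λ′ E W L ind = record
    { core = M ; core⊆W = M⊆W ; tight = tM ; minimal = minimal }
    where
    P : DecSet n → Set
    P Y = Y ⊆ W × Tight λ′ E W L Y
    ext : Extensional P
    ext X Y f g (X⊆W , t) = X⊆W ∘ g , (begin
      λ′ * # (∂ W L Y)  ≡⟨ cong (λ′ *_) (#-cong (∂ W L Y) (∂ W L X)
                             (∂-mono W W L Y X id g (λ _ q → q ∘ f)) (∂-mono W W L X Y id f (λ _ q → q ∘ g))) ⟩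
      λ′ * # (∂ W L X)  ≤⟨ t ⟩
      # (E ∖ X)         ≤⟨ #-mono (E ∖ X) (E ∖ Y) (λ (e , q) → e , q ∘ g) ⟩
      # (E ∖ Y)         ∎)
      where open ≤-Reasoning
    tightW : Tight λ′ E W L W
    tightW = ≤-trans (≤-reflexive (trans (cong (λ′ *_) (#-empty (∂ W L W) (λ (w , ∉W , _) → ∉W w))) (*-zeroʳ λ′))) z≤n
    found = smallest {P = P} (λ Y → (Y ⊆? W) ×-dec (λ′ * # (∂ W L Y) ≤? # (E ∖ Y))) ext W (id , tightW)
    M = proj₁ found
    M⊆W = proj₁ (proj₁ (proj₂ found))
    tM = proj₂ (proj₁ (proj₂ found))
    ∩-tight : ∀ Y → Y ⊆ W → Tight λ′ E W L Y → Tight λ′ E W L (M ∩ Y)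
    ∩-tight Y Y⊆W tY = linear 0
      (tM ⊕ tY ⊕ ind (M ∪ Y) (λ { (inj₁ m) → M⊆W m ; (inj₂ y) → Y⊆W y })
        ⊕ λ′ ⊛ #∂-submodular W L M Y
        ⊕ #-submodular (E ∖ M) (E ∖ Y) (E ∖ (M ∩ Y)) (E ∖ (M ∪ Y))
            (λ (e , q) → inj₁ (e , q ∘ proj₁)) (λ (e , q) → inj₁ (e , q ∘ proj₂))
            (λ ((e , q) , (_ , q′)) → (e , q ∘ proj₁) , (e , λ { (inj₁ m) → q m ; (inj₂ y) → q′ y })))
      (arith λ′ (# (∂ W L M)) (# (∂ W L Y)) (# (∂ W L (M ∩ Y))) (# (∂ W L (M ∪ Y)))
        (# (E ∖ M)) (# (E ∖ Y)) (# (E ∖ (M ∩ Y))) (# (E ∖ (M ∪ Y))))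
      where
      arith : ∀ l a b c d e f g h →
        l * c + (e + (f + (l * d + (l * (a + b) + (g + h))))) + 0
        ≡ g + (l * a + (l * b + (h + (l * (c + d) + (e + f)))))
      arith = solve-∀
    minimal : ∀ Y → Y ⊆ W → Tight λ′ E W L Y → M ⊆ Y
    minimal Y Y⊆W tY {v} m with dec Y v
    ... | yes y = y
    ... | no ∉Y = contradiction
      (proj₂ (proj₂ found) (M ∩ Y) (M⊆W ∘ proj₁ , ∩-tight Y Y⊆W tY))
      (<⇒≱ (≤-trans (≤-reflexive (+-comm 1 _)) (≤-trans (+-monoʳ-≤ _ (#-inhabited ⁅ v ⁆ refl))
        (#-disjoint (M ∩ Y) ⁅ v ⁆ M proj₁ (λ { refl → m }) (λ { (_ , y) refl → ∉Y y })))))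

  module _ {E W L : DecSet n} (ind : Indep 1 E W L) (M : MinTight 1 E W L) where
    open MinTight M

    private
      tight′ : # (∂ W L core) ≤ # (E ∖ core)
      tight′ = ≤-trans (≤-reflexive (sym (*-identityˡ _))) tight

    -- Removing `w` from the core enlarges the boundary by at most `w`. If `w` were an end, it would
    -- also add an end outside, and the smaller set would still be tight.
    core-∉ : ∀ {w} → w ∈ core → w ∉ E
    core-∉ {w} w∈core w∈E = proj₂ (minimal Y (core⊆W ∘ proj₁) tightY w∈core) refl
      where
      Y = core ∖ ⁅ w ⁆
      tightY : Tight 1 E W L Y
      tightY = begin
        1 * # (∂ W L Y)                 ≡⟨ *-identityˡ _ ⟩
        # (∂ W L Y)                     ≤⟨ #-union (∂ W L Y) (∂ W L core) ⁅ w ⁆ split ⟩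
        # (∂ W L core) + # ⁅ w ⁆        ≤⟨ tight′ ⊕ ≤-refl ⟩
        # (E ∖ core) + # ⁅ w ⁆          ≤⟨ #-disjoint (E ∖ core) ⁅ w ⁆ (E ∖ Y)
                                             (λ (e , q) → e , q ∘ proj₁) (λ { refl → w∈E , λ (_ , ≢) → ≢ refl })
                                             (λ { (_ , q) refl → q w∈core }) ⟩
        # (E ∖ Y)                       ∎
        where
        open ≤-Reasoning
        split : ∂ W L Y ⊆ ∂ W L core ∪ ⁅ w ⁆
        split {v} (v∈W , ∉Y , r) with v ≟ w
        ... | yes eq = inj₂ eq
        ... | no  ≢w = inj₁ (v∈W , (λ c → ∉Y (c , ≢w)) , (case r of λ
                { (inj₁ l) → inj₁ l ; (inj₂ (u , (c , _) , a)) → inj₂ (u , c , a) }))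

    -- A set `Y` without `w` does not contain the core and so is not tight; the strict inequality
    -- leaves room for one more end.
    core-extends : ∀ {w} → w ∈ core → Indep 1 (E ∪ ⁅ w ⁆) W L
    core-extends {w} w∈core Y Y⊆W with dec Y w
    ... | yes w∈Y = ≤-trans (#-mono ((E ∪ ⁅ w ⁆) ∖ Y) (E ∖ Y) (λ
            { (inj₁ e , q) → e , q ; (inj₂ refl , q) → contradiction w∈Y q })) (ind Y Y⊆W)
    ... | no ∉Y = begin
      # ((E ∪ ⁅ w ⁆) ∖ Y)     ≤⟨ #-union ((E ∪ ⁅ w ⁆) ∖ Y) (E ∖ Y) ⁅ w ⁆ (λ
                                  { (inj₁ e , q) → inj₁ (e , q) ; (inj₂ eq , _) → inj₂ eq }) ⟩
      # (E ∖ Y) + # ⁅ w ⁆     ≤⟨ ≤-refl {# (E ∖ Y)} ⊕ #⁅⁆≤1 w ⟩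
      # (E ∖ Y) + 1           ≡⟨ +-comm _ 1 ⟩
      suc (# (E ∖ Y))         ≤⟨ ≰⇒> (λ t → ∉Y (minimal Y Y⊆W t w∈core)) ⟩
      1 * # (∂ W L Y)         ∎
      where open ≤-Reasoning

  -- A path from its head back to L, given by its list of vertices; only the last one is in L.
  data Back (L : DecSet n) : V → List V → Set where
    stop : ∀ {v} → v ∈ L → Back L v (v ∷ [])
    step : ∀ {v w ws} → v ∉ L → v ~ w → Back L w ws → Back L v (v ∷ ws)

  record Linkage (E W L : DecSet n) : Set where
    field
      trail    : V → List V
      back     : ∀ {e} → e ∈ E → Back L e (trail e)
      unique   : ∀ {e} → e ∈ E → Unique (trail e)
      inside   : ∀ {e} → e ∈ E → ∀ {x} → x L.∈ trail e → x ∈ W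
      disjoint : ∀ {e f} → e ∈ E → f ∈ E → ∀ {x} → x L.∈ trail e → x L.∈ trail f → e ≡ f

  -- Menger's theorem, by peeling an end e off W: some neighbour w of e can replace it in E,
  -- since otherwise the core of E ∖ e in W ∖ e would violate independence in W.
  menger : ∀ k E W L → # W ≤ k → E ⊆ W → Indep 1 E W L → Linkage E W L
  menger k E W L W≤k E⊆W ind with any? (λ e → dec E e ×-dec ¬? (dec L e))
  ... | no ¬e = record
    { trail = _∷ []
    ; back = λ {e} e∈E → case dec L e of λ
        { (yes l) → stop l ; (no ¬l) → contradiction (e , e∈E , ¬l) ¬e }
    ; unique = λ _ → [] ∷ []
    ; inside = λ { e∈E (here refl) → E⊆W e∈E }
    ; disjoint = λ { _ _ (here refl) (here refl) → refl } }
  menger zero    E W L W≤k E⊆W ind | yes (e , e∈E , e∉L) =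
    contradiction (≤-trans (#-inhabited W (E⊆W e∈E)) W≤k) λ ()
  menger (suc k) E W L W≤k E⊆W ind | yes (e , e∈E , e∉L) = result
    where
    W′ = W ∖ ⁅ e ⁆
    E₁ = E ∖ ⁅ e ⁆
    -- The end `e` lies outside every such `Y`, so the inequality for `E` has one unit more than the
    -- one for `E₁`. This unit pays for the loss of `e` from the boundary.
    shift : ∀ Y → Y ⊆ W′ → # (E₁ ∖ Y) + 1 ≤ # (∂ W L Y)
    shift Y Y⊆W′ = begin
      # (E₁ ∖ Y) + 1        ≤⟨ ≤-refl {# (E₁ ∖ Y)} ⊕ #-inhabited ⁅ e ⁆ refl ⟩
      # (E₁ ∖ Y) + # ⁅ e ⁆  ≤⟨ #-disjoint (E₁ ∖ Y) ⁅ e ⁆ (E ∖ Y) (λ ((e , _) , q) → e , q)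
                                 (λ { refl → e∈E , λ y → proj₂ (Y⊆W′ y) refl })
                                 (λ { ((_ , ≢) , _) refl → ≢ refl }) ⟩
      # (E ∖ Y)             ≤⟨ ind Y (proj₁ ∘ Y⊆W′) ⟩
      1 * # (∂ W L Y)       ≡⟨ *-identityˡ _ ⟩
      # (∂ W L Y)           ∎
      where open ≤-Reasoning
    ind₁ : Indep 1 E₁ W′ L
    ind₁ Y Y⊆W′ = +-cancelʳ-≤ 1 _ _ (begin
      # (E₁ ∖ Y) + 1             ≤⟨ shift Y Y⊆W′ ⟩
      # (∂ W L Y)                ≤⟨ #-union (∂ W L Y) (∂ W′ L Y) ⁅ e ⁆ split ⟩
      # (∂ W′ L Y) + # ⁅ e ⁆     ≤⟨ ≤-reflexive (sym (*-identityˡ _)) ⊕ #⁅⁆≤1 e ⟩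
      1 * # (∂ W′ L Y) + 1       ∎)
      where
      open ≤-Reasoning
      split : ∂ W L Y ⊆ ∂ W′ L Y ∪ ⁅ e ⁆
      split {v} (w , q , r) with v ≟ e
      ... | yes eq = inj₂ eq
      ... | no  ≢e = inj₁ ((w , ≢e) , q , r)
    M = minTight 1 E₁ W′ L ind₁
    open MinTight M
    nbr : ∃ λ w → w ∈ core × w ~ e
    nbr = decidable-stable (any? (λ w → dec core w ×-dec T? (adj w e))) λ ¬p → contradiction (begin
      # (E₁ ∖ core) + 1    ≤⟨ shift core core⊆W ⟩
      # (∂ W L core)       ≤⟨ #-mono (∂ W L core) (∂ W′ L core) (λ (w , q , r) →
                                (w , λ { refl → case r of λ
                                  { (inj₁ l) → e∉L l ; (inj₂ (u , c , a)) → ¬p (u , c , a) } }) , q , r) ⟩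
      # (∂ W′ L core)      ≡⟨ *-identityˡ _ ⟨
      1 * # (∂ W′ L core)  ≤⟨ tight ⟩
      # (E₁ ∖ core)        ∎) (<⇒≱ (≤-reflexive (+-comm 1 _)))
      where open ≤-Reasoning
    w = proj₁ nbr
    w∈core = proj₁ (proj₂ nbr)
    w~e = proj₂ (proj₂ nbr)
    w∉E₁ = core-∉ ind₁ M w∈core
    sub = menger k (E₁ ∪ ⁅ w ⁆) W′ L
      (s≤s⁻¹ (≤-trans (≤-trans (≤-reflexive (+-comm 1 _)) (≤-trans (≤-refl {# W′} ⊕ #-inhabited ⁅ e ⁆ refl)
        (#-disjoint W′ ⁅ e ⁆ W proj₁ (λ { refl → E⊆W e∈E }) (λ { (_ , ≢) refl → ≢ refl })))) W≤k))
      (λ { (inj₁ (e′ , ≢)) → E⊆W e′ , ≢ ; (inj₂ refl) → core⊆W w∈core })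
      (core-extends ind₁ M w∈core)
    module S = Linkage sub
    w∈ : w ∈ E₁ ∪ ⁅ w ⁆
    w∈ = inj₂ refl
    old : ∀ {f} → f ∈ E → f ≢ e → f ∈ E₁ ∪ ⁅ w ⁆
    old f∈E f≢e = inj₁ (f∈E , f≢e)
    trail : V → List V
    trail f with f ≟ e
    ... | yes _ = e ∷ S.trail w
    ... | no  _ = S.trail f
    back : ∀ {f} → f ∈ E → Back L f (trail f)
    back {f} f∈E with f ≟ e
    ... | yes refl = step e∉L (~-sym w~e) (S.back w∈)
    ... | no f≢e   = S.back (old f∈E f≢e)
    unique : ∀ {f} → f ∈ E → Unique (trail f)
    unique {f} f∈E with f ≟ e
    ... | yes refl = All.tabulate (λ x∈ → λ { refl → proj₂ (S.inside w∈ x∈) refl }) ∷ S.unique w∈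
    ... | no f≢e   = S.unique (old f∈E f≢e)
    inside : ∀ {f} → f ∈ E → ∀ {x} → x L.∈ trail f → x ∈ W
    inside {f} f∈E x∈ with f ≟ e
    inside f∈E (here refl) | yes _  = E⊆W e∈E
    inside f∈E (there x∈)  | yes _  = proj₁ (S.inside w∈ x∈)
    inside f∈E x∈          | no f≢e = proj₁ (S.inside (old f∈E f≢e) x∈)
    disjoint : ∀ {f g} → f ∈ E → g ∈ E → ∀ {x} → x L.∈ trail f → x L.∈ trail g → f ≡ g
    disjoint {f} {g} f∈E g∈E x∈ y∈ with f ≟ e | g ≟ e
    ... | yes refl | yes refl = refl
    disjoint f∈E g∈E (here refl) y∈ | yes refl | no g≢e = contradiction refl (proj₂ (S.inside (old g∈E g≢e) y∈))
    disjoint f∈E g∈E (there x∈)  y∈ | yes refl | no g≢e =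
      contradiction (subst (_∈ E₁) (sym (S.disjoint w∈ (old g∈E g≢e) x∈ y∈)) (g∈E , g≢e)) w∉E₁
    disjoint f∈E g∈E x∈ (here refl) | no f≢e | yes refl = contradiction refl (proj₂ (S.inside (old f∈E f≢e) x∈))
    disjoint f∈E g∈E x∈ (there y∈)  | no f≢e | yes refl =
      contradiction (subst (_∈ E₁) (S.disjoint (old f∈E f≢e) w∈ x∈ y∈) (f∈E , f≢e)) w∉E₁
    ... | no f≢e | no g≢e = S.disjoint (old f∈E f≢e) (old g∈E g≢e) x∈ y∈
    result = record { trail = trail ; back = back ; unique = unique ; inside = inside ; disjoint = disjoint }

  -- The usable exits are the vertices of the core. Goodness bounds the rest of `F` by `λ′` times
  -- the boundary of the core, and tightness bounds that boundary by `# E`: each exit in use spoils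
  -- at most `λ′` vertices.
  available : ∀ λ′ {E F L} → Indep λ′ F F L → E ⊆ F → Indep 1 E F L →
    Σ (DecSet n) λ Q → Q ⊆ F × # F ≤ # Q + λ′ * # E ×
      (∀ {w} → w ∈ Q → w ∉ E × Indep 1 (E ∪ ⁅ w ⁆) F L)
  available λ′ {E} {F} {L} good E⊆F ind = core , core⊆W , (begin
      # F                                ≤⟨ #-union F core (F ∖ core) (λ {v} f → case dec core v of λ
                                              { (yes c) → inj₁ c ; (no ¬c) → inj₂ (f , ¬c) }) ⟩
      # core + # (F ∖ core)              ≤⟨ ≤-refl {# core} ⊕ good core core⊆W ⟩
      # core + λ′ * # (∂ F L core)       ≤⟨ ≤-refl {# core} ⊕ λ′ ⊛ (begin
        # (∂ F L core)       ≡⟨ *-identityˡ _ ⟨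
        1 * # (∂ F L core)   ≤⟨ tight ⟩
        # (E ∖ core)         ≤⟨ #-mono (E ∖ core) E proj₁ ⟩
        # E                  ∎) ⟩
      # core + λ′ * # E                  ∎)
    , λ w∈ → core-∉ ind M w∈ , core-extends ind M w∈
    where
    open ≤-Reasoning
    M = minTight 1 E F L ind
    open MinTight M

  -- Growing an object around a vertex of large degree, and breadth-first search

  Neighbours : V → DecSet n
  Neighbours x = ⟪ (λ v → T? (adj x v)) ⟫

  record Object (l K : ℕ) : Set₁ where
    field
      root   : V
      body   : DecSet n
      root∉  : root ∉ body
      good   : Indep l body body (Neighbours root)
      size   : # body ≡ l * K

  module _ (N l K : ℕ) (1≤l : 1 ≤ l) {R : DecSet n} {x : V} (x∈R : x ∈ R)
           (deg : K * (1 + N) ≤ # (∂ R ∅ ⁅ x ⁆)) where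

    private
      Rx = R ∖ ⁅ x ⁆
      Nx = Neighbours x

    NonExpanding : Set₁
    NonExpanding = Σ (DecSet n) λ Y → Y ⊆ R × # Y ≤ l * K × 1 ≤ # Y × N * # (∂ R ∅ Y) ≤ # Y

    -- A vertex `y` next to the root or to the core can be added: a set `Y` without `y` either is
    -- not tight and has slack, or contains the core, and then `y` is a new boundary vertex of `Y`,
    -- worth `l ≥ 1`. If no such `y` exists, every neighbour of the core in `R` is `x` or lies in
    -- `F`.
    growFrom : ∀ k F → k + # F ≡ l * K → F ⊆ Rx → Indep l F F Nx →
      (Σ (Object l K) λ O → Object.root O ≡ x × Object.body O ⊆ R) ⊎ NonExpanding
    growFrom zero F F≡ F⊆ good = inj₁ (record
      { root = x ; body = F ; root∉ = λ x∈F → proj₂ (F⊆ x∈F) refl ; good = good ; size = F≡ } , refl , proj₁ ∘ F⊆)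
    growFrom (suc k) F F≡ F⊆ good
      with minTight l F F Nx good
    ... | M with any? (λ y → dec Rx y ×-dec ¬? (dec F y) ×-dec
                       (dec Nx y ⊎-dec any? (λ u → dec (MinTight.core M) u ×-dec T? (adj u y))))
    ... | yes (y , y∈R , y∉F , r) = growFrom k F+ (trans (cong (k +_) (#-insert F y∉F)) (trans (+-suc k _) F≡))
          (λ { (inj₁ f) → F⊆ f ; (inj₂ refl) → y∈R }) good+
      where
      open MinTight M
      F+ = F ∪ ⁅ y ⁆
      good+ : Indep l F+ F+ Nx
      good+ Y Y⊆ with dec Y y
      ... | yes y∈Y = begin
        # (F+ ∖ Y)              ≤⟨ #-mono (F+ ∖ Y) (F ∖ (Y ∖ ⁅ y ⁆)) (λ
                                    { (inj₁ f , q) → f , q ∘ proj₁ ; (inj₂ refl , q) → contradiction y∈Y q }) ⟩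
        # (F ∖ (Y ∖ ⁅ y ⁆))     ≤⟨ good (Y ∖ ⁅ y ⁆) (λ (y′ , ≢) → case Y⊆ y′ of λ
                                    { (inj₁ f) → f ; (inj₂ eq) → contradiction eq ≢ }) ⟩
        l * # (∂ F Nx (Y ∖ ⁅ y ⁆)) ≤⟨ l ⊛ #-mono (∂ F Nx (Y ∖ ⁅ y ⁆)) (∂ F+ Nx Y)
                                    (∂-mono F F+ Nx (Y ∖ ⁅ y ⁆) Y inj₁ proj₁
                                      (λ f q y′ → q (y′ , λ { refl → y∉F f }))) ⟩
        l * # (∂ F+ Nx Y)       ∎
        where open ≤-Reasoning
      ... | no y∉Y = ≤-trans (#-union (F+ ∖ Y) (F ∖ Y) ⁅ y ⁆ (λ
                       { (inj₁ f , q) → inj₁ (f , q) ; (inj₂ eq , _) → inj₂ eq }))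
                     (≤-trans (≤-refl {# (F ∖ Y)} ⊕ #⁅⁆≤1 y) main)
        where
        Y⊆F : Y ⊆ F
        Y⊆F y′ = case Y⊆ y′ of λ { (inj₁ f) → f ; (inj₂ refl) → contradiction y′ y∉Y }
        main : # (F ∖ Y) + 1 ≤ l * # (∂ F+ Nx Y)
        main with l * # (∂ F Nx Y) ≤? # (F ∖ Y)
        ... | no ¬t = ≤-trans (≤-reflexive (+-comm _ 1)) (≤-trans (≰⇒> ¬t)
                (l ⊛ #-mono (∂ F Nx Y) (∂ F+ Nx Y) (∂-mono F F+ Nx Y Y inj₁ id (λ _ → id))))
        ... | yes t = begin
          # (F ∖ Y) + 1           ≤⟨ good Y Y⊆F ⊕ 1≤l ⟩
          l * # (∂ F Nx Y) + l    ≡⟨ trans (+-comm _ l) (sym (*-suc l _)) ⟩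
          l * suc (# (∂ F Nx Y))  ≡⟨ cong (l *_) (sym (#-insert (∂ F Nx Y) (y∉F ∘ proj₁))) ⟩
          l * # (∂ F Nx Y ∪ ⁅ y ⁆) ≤⟨ l ⊛ #-mono (∂ F Nx Y ∪ ⁅ y ⁆) (∂ F+ Nx Y) (λ
              { (inj₁ b) → ∂-mono F F+ Nx Y Y inj₁ id (λ _ → id) b
              ; (inj₂ refl) → inj₂ refl , y∉Y , (case r of λ
                  { (inj₁ a) → inj₁ a ; (inj₂ (u , c , a)) → inj₂ (u , minimal Y Y⊆F t c , a) }) }) ⟩
          l * # (∂ F+ Nx Y)       ∎
          where open ≤-Reasoning
    ... | no ¬y = inj₂ (core , proj₁ ∘ F⊆ ∘ core⊆W , ≤-trans (#-mono core F core⊆W) (<⇒≤ F<) , nonempty-core , small)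
      where
      open MinTight M
      F< : # F < l * K
      F< = ≤-trans (s≤s (m≤n+m _ k)) (≤-reflexive F≡)
      z = # (∂ F Nx core)
      closed : ∀ {v} → v ∈ R → v ≢ x → v ∉ core → (v ∈ Nx ⊎ ∃ λ u → u ∈ core × u ~ v) → v ∈ ∂ F Nx core
      closed {v} v∈R v≢x v∉c r with dec F v
      ... | yes v∈F = v∈F , v∉c , r
      ... | no  v∉F = contradiction (v , (v∈R , v≢x) , v∉F , r) ¬y
      z<K : suc z ≤ K
      z<K = *-cancelˡ-< l z K (≤-<-trans tight (≤-<-trans (#-mono (F ∖ core) F proj₁) F<))
      deg≤ : # (∂ R ∅ ⁅ x ⁆) ≤ # core + z
      deg≤ = #-union (∂ R ∅ ⁅ x ⁆) core (∂ F Nx core) λ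
        { {v} (v∈R , v≢x , inj₂ (_ , refl , a)) → case dec core v of λ
            { (yes c) → inj₁ c ; (no ¬c) → inj₂ (closed v∈R v≢x ¬c (inj₁ a)) } }
      ∂≤ : # (∂ R ∅ core) ≤ K
      ∂≤ = ≤-trans (#-union (∂ R ∅ core) (∂ F Nx core) ⁅ x ⁆ split)
             (≤-trans (≤-refl {z} ⊕ #⁅⁆≤1 x) (≤-trans (≤-reflexive (+-comm z 1)) z<K))
        where
        split : ∂ R ∅ core ⊆ ∂ F Nx core ∪ ⁅ x ⁆
        split {v} (v∈R , v∉c , inj₂ r) with v ≟ x
        ... | yes eq = inj₂ eq
        ... | no ≢x  = inj₁ (closed v∈R ≢x v∉c (inj₂ r))
      -- Of the at least `K * (1 + N)` neighbours of `x` in `R`, all but `z < K` lie in the core.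
      -- Its own boundary in `R` has at most `z + 1 ≤ K` vertices, so the core is more than `N`
      -- times as large.
      big : K * N + 1 ≤ # core
      big = linear 0 (deg ⊕ deg≤ ⊕ z<K) (arith K N (# core) z (# (∂ R ∅ ⁅ x ⁆)))
        where
        arith : ∀ K N c z d → K * N + 1 + (d + (c + z + K)) + 0 ≡ c + (K * (1 + N) + (d + suc z))
        arith = solve-∀
      nonempty-core : 1 ≤ # core
      nonempty-core = ≤-trans (m≤n+m 1 _) big
      small : N * # (∂ R ∅ core) ≤ # core
      small = ≤-trans (N ⊛ ∂≤) (≤-trans (≤-reflexive (*-comm N K)) (≤-trans (m≤m+n _ 1) big))

    grow : (Σ (Object l K) λ O → Object.root O ≡ x × Object.body O ⊆ R) ⊎ NonExpanding
    grow = growFrom (l * K) ∅ (trans (cong (l * K +_) (#-empty {n} ∅ id)) (+-identityʳ _)) (λ ())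
      (λ Y _ → ≤-trans (≤-reflexive (#-empty (∅ ∖ Y) proj₁)) z≤n)

  -- The list consists of the inner vertices of a walk between the two ends.
  data Chain : V → List V → V → Set where
    edge : ∀ {u v} → u ~ v → Chain u [] v
    _∷_  : ∀ {u w vs v} → u ~ w → Chain w vs v → Chain u (w ∷ vs) v

  Chain-++ : ∀ {u v w xs ys} → Chain u xs w → Chain w ys v → Chain u (xs ++ w ∷ ys) v
  Chain-++ (edge a) d = a ∷ d
  Chain-++ (a ∷ c)  d = a ∷ Chain-++ c d

  Chain-split : ∀ xs {u v w ys} → Chain u (xs ++ w ∷ ys) v → Chain u xs w × Chain w ys v
  Chain-split []       (a ∷ c) = edge a , c
  Chain-split (x ∷ xs) (a ∷ c) = let l , r = Chain-split xs c in a ∷ l , r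

  Chain-sym : ∀ {u v xs} → Chain u xs v → Chain v (reverse xs) u
  Chain-sym (edge a) = edge (~-sym a)
  Chain-sym {xs = x ∷ xs} (a ∷ c) =
    subst (λ ys → Chain _ ys _) (sym (unfold-reverse x xs)) (Chain-++ (Chain-sym c) (edge (~-sym a)))

  ^-distribʳ-* : ∀ k a b → (a * b) ^ k ≡ a ^ k * b ^ k
  ^-distribʳ-* zero    a b = refl
  ^-distribʳ-* (suc k) a b = trans (cong (a * b *_) (^-distribʳ-* k a b)) (arith a b (a ^ k) (b ^ k))
    where
    arith : ∀ a b c d → a * b * (c * d) ≡ a * c * (b * d)
    arith = solve-∀

  -- Growth by a factor `1 + 1 / N` per round doubles a set in `N` rounds, because
  -- `(1 + 1 / N) ^ N ≥ 2` by Bernoulli's inequality; after `N * Λ` rounds the size would reach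
  -- `2 ^ Λ`. All denominators are cleared.
  expansion-overflow : ∀ N Λ s → 1 ≤ N → s < 2 ^ Λ → (1 + N) ^ (N * Λ) ≤ N ^ (N * Λ) * s → ⊥
  expansion-overflow N@(suc _) Λ s _ s<2^Λ p = <⇒≱ s<2^Λ
    (*-cancelˡ-≤ (N ^ (N * Λ)) {{m^n≢0 N (N * Λ)}} (begin
      N ^ (N * Λ) * 2 ^ Λ    ≡⟨ cong (_* 2 ^ Λ) (^-*-assoc N N Λ) ⟨
      (N ^ N) ^ Λ * 2 ^ Λ    ≡⟨ ^-distribʳ-* Λ (N ^ N) 2 ⟨
      (N ^ N * 2) ^ Λ        ≤⟨ ^-monoˡ-≤ Λ double ⟩
      ((1 + N) ^ N) ^ Λ      ≡⟨ ^-*-assoc (1 + N) N Λ ⟩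
      (1 + N) ^ (N * Λ)      ≤⟨ p ⟩
      N ^ (N * Λ) * s        ∎))
    where
    open ≤-Reasoning
    bernoulli : ∀ k → N ^ k * (N + k) ≤ N * (1 + N) ^ k
    bernoulli zero    = ≤-reflexive (arith N)
      where
      arith : ∀ N → 1 * (N + 0) ≡ N * 1
      arith = solve-∀
    bernoulli (suc k) = linear (N ^ k * k) ((1 + N) ⊛ bernoulli k) (arith N k (N ^ k) ((1 + N) ^ k))
      where
      arith : ∀ N k a b → N * a * (N + suc k) + (1 + N) * (N * b) + a * k ≡ N * ((1 + N) * b) + (1 + N) * (a * (N + k))
      arith = solve-∀
    double : N ^ N * 2 ≤ (1 + N) ^ N
    double = *-cancelˡ-≤ N (≤-trans (≤-reflexive (arith N (N ^ N))) (bernoulli N))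
      where
      arith : ∀ N a → N * (a * 2) ≡ a * (N + N)
      arith = solve-∀

  -- The vertex `end` is not counted in `short` and need not lie in `X`, since searches start from
  -- bodies or from a cycle.
  record Reach (X Q : DecSet n) (k : ℕ) (v : V) : Set where
    constructor reach
    field
      {tail}  : List V
      {end}   : V
      end∈    : end ∈ Q
      chain   : Chain v tail end
      inside  : ∀ {x} → x L.∈ v ∷ tail → x ∈ X
      unique  : Unique (v ∷ tail)
      short   : length (v ∷ tail) ≤ k

  extendReach : ∀ X X′ {Q k v w} → X ⊆ X′ → w ∉ X → w ∈ X′ → w ~ v → Reach X Q k v → Reach X′ Q (suc k) w
  extendReach X X′ f w∉ w∈ a (reach e c i u s) = reach e (a ∷ c)
    (λ { (here refl) → w∈ ; (there x) → f (i x) }) (All.tabulate (λ x∈ → λ { refl → w∉ (i x∈) }) ∷ u) (s≤s s)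

  singleReach : ∀ X′ {Q k w q} → w ∈ X′ → w ~ q → q ∈ Q → Reach X′ Q (suc k) w
  singleReach X′ w∈ a q∈ = reach q∈ (edge a) (λ { (here refl) → w∈ }) ([] ∷ []) (s≤s z≤n)

  weakenReach : ∀ X X′ {Q k k′ v} → X ⊆ X′ → k ≤ k′ → Reach X Q k v → Reach X′ Q k′ v
  weakenReach X X′ f k≤ (reach e c i u s) = reach e c (f ∘ i) u (≤-trans s k≤)

  module BFS (N Λ : ℕ) (1≤N : 1 ≤ N) (n<2^Λ : n < 2 ^ Λ) (R Q T : DecSet n) (h : ℕ) (1≤Q : 1 ≤ # Q) where

    -- A path that hits `T` meets it in its first vertex alone, so it can be glued to paths inside
    -- `T`. When `h` is the size of the whole region, two balls cannot be disjoint, while a stuck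
    -- set is small enough to be buried.
    data Outcome : Set₁ where
      hit   : ∀ v → v ∈ R → v ∈ T → Reach ((R ∖ T) ∪ ⁅ v ⁆) Q (N * Λ) v → Outcome
      ball  : (X : DecSet n) → X ⊆ R ∖ T → h < 2 * # X → (∀ {v} → v ∈ X → Reach X Q (N * Λ) v) → Outcome
      stuck : (X : DecSet n) → X ⊆ R ∖ T → 2 * # X ≤ h → N * # (∂ R ∅ (Q ∪ X)) ≤ # (Q ∪ X) → Outcome

    go : ∀ k i → i + k ≡ N * Λ → (X : DecSet n) → X ⊆ R ∖ T → 2 * # X ≤ h →
         (∀ {v} → v ∈ X → Reach X Q i v) → (1 + N) ^ i ≤ N ^ i * # (Q ∪ X) → Outcome
    -- Each round that neither hits nor is stuck multiplies `# (Q ∪ X)` by at least `1 + 1 / N`, so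
    -- the fuel `N * Λ` cannot run out.
    go zero i i≡ X X⊆ X≤h pay big = ⊥-elim (expansion-overflow N Λ (# (Q ∪ X)) 1≤N
      (≤-<-trans (#≤n (Q ∪ X)) n<2^Λ)
      (subst (λ i → (1 + N) ^ i ≤ N ^ i * # (Q ∪ X)) (trans (sym (+-identityʳ i)) i≡) big))
    go (suc k) i i≡ X X⊆ X≤h pay big with any? (λ v → dec (∂ R ∅ (Q ∪ X)) v ×-dec dec T v)
    ... | yes (v , (v∈R , v∉ , inj₂ (u , u∈ , u~v)) , v∈T) = hit v v∈R v∈T
          (weakenReach X′ X′ id i≤ (case u∈ of λ
            { (inj₁ q) → singleReach X′ (inj₂ refl) (~-sym u~v) q
            ; (inj₂ x) → extendReach X X′ (inj₁ ∘ X⊆) (v∉ ∘ inj₂) (inj₂ refl) (~-sym u~v) (pay x) }))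
      where
      X′ = (R ∖ T) ∪ ⁅ v ⁆
      i≤ : suc i ≤ N * Λ
      i≤ = ≤-trans (s≤s (m≤m+n i k)) (≤-reflexive (trans (sym (+-suc i k)) i≡))
    ... | no ¬hit with N * # (∂ R ∅ (Q ∪ X)) ≤? # (Q ∪ X)
    ... | yes st = stuck X X⊆ X≤h st
    ... | no ¬st with 2 * # (X ∪ ∂ R ∅ (Q ∪ X)) ≤? h
    ... | no ¬h = ball X′ X′⊆ (≰⇒> ¬h) (weakenReach X′ X′ id i≤ ∘ pay′)
      where
      X′ = X ∪ ∂ R ∅ (Q ∪ X)
      X′⊆ : X′ ⊆ R ∖ T
      X′⊆ (inj₁ x) = X⊆ x
      X′⊆ (inj₂ b) = proj₁ b , λ t → ¬hit (_ , b , t)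
      i≤ : suc i ≤ N * Λ
      i≤ = ≤-trans (s≤s (m≤m+n i k)) (≤-reflexive (trans (sym (+-suc i k)) i≡))
      pay′ : ∀ {v} → v ∈ X′ → Reach X′ Q (suc i) v
      pay′ (inj₁ x) = weakenReach X X′ inj₁ (n≤1+n i) (pay x)
      pay′ b@(inj₂ (_ , ∉ , inj₂ (u , inj₁ q , a))) = singleReach X′ b (~-sym a) q
      pay′ b@(inj₂ (_ , ∉ , inj₂ (u , inj₂ x , a))) = extendReach X X′ inj₁ (∉ ∘ inj₂) b (~-sym a) (pay x)
    ... | yes h≥ = go k (suc i) (trans (sym (+-suc i k)) i≡) X′ X′⊆ h≥ pay′ grown
      where
      X′ = X ∪ ∂ R ∅ (Q ∪ X)
      X′⊆ : X′ ⊆ R ∖ T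
      X′⊆ (inj₁ x) = X⊆ x
      X′⊆ (inj₂ b) = proj₁ b , λ t → ¬hit (_ , b , t)
      pay′ : ∀ {v} → v ∈ X′ → Reach X′ Q (suc i) v
      pay′ (inj₁ x) = weakenReach X X′ inj₁ (n≤1+n i) (pay x)
      pay′ b@(inj₂ (_ , ∉ , inj₂ (u , inj₁ q , a))) = singleReach X′ b (~-sym a) q
      pay′ b@(inj₂ (_ , ∉ , inj₂ (u , inj₂ x , a))) = extendReach X X′ inj₁ (∉ ∘ inj₂) b (~-sym a) (pay x)
      grown : (1 + N) ^ suc i ≤ N ^ suc i * # (Q ∪ X′)
      grown = begin
        (1 + N) * (1 + N) ^ i               ≤⟨ (1 + N) ⊛ big ⟩
        (1 + N) * (N ^ i * # (Q ∪ X))       ≡⟨ arith₁ N (N ^ i) (# (Q ∪ X)) ⟩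
        N ^ i * (# (Q ∪ X) + N * # (Q ∪ X)) ≤⟨ N ^ i ⊛ (<⇒≤ (≰⇒> ¬st) ⊕ ≤-refl {N * # (Q ∪ X)}) ⟩
        N ^ i * (N * # (∂ R ∅ (Q ∪ X)) + N * # (Q ∪ X)) ≡⟨ arith₂ N (N ^ i) (# (∂ R ∅ (Q ∪ X))) (# (Q ∪ X)) ⟩
        N ^ suc i * (# (Q ∪ X) + # (∂ R ∅ (Q ∪ X))) ≤⟨ N ^ suc i ⊛ #-disjoint (Q ∪ X) (∂ R ∅ (Q ∪ X)) (Q ∪ X′)
                                     (λ { (inj₁ q) → inj₁ q ; (inj₂ x) → inj₂ (inj₁ x) }) (inj₂ ∘ inj₂)
                                     (λ qx (_ , ∉ , _) → ∉ qx) ⟩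
        N ^ suc i * # (Q ∪ X′)              ∎
        where
        open ≤-Reasoning
        arith₁ : ∀ N a b → (1 + N) * (a * b) ≡ a * (b + N * b)
        arith₁ = solve-∀
        arith₂ : ∀ N a c b → a * (N * c + N * b) ≡ N * a * (b + c)
        arith₂ = solve-∀

    bfs : Outcome
    bfs = go (N * Λ) 0 refl ∅ (λ ()) (≤-trans (≤-reflexive (cong (2 *_) (#-empty {n} ∅ id))) z≤n) (λ ())
      (≤-trans (≤-trans 1≤Q (#-mono Q (Q ∪ ∅) inj₁)) (≤-reflexive (sym (*-identityˡ _))))

  -- Links

  module _ {A : Set} where
    Unique-++⁻ : ∀ (xs : List A) {ys} → Unique (xs ++ ys) →
                 Unique xs × Unique ys × (∀ {x} → x L.∈ xs → x L.∈ ys → ⊥)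
    Unique-++⁻ []       u       = [] , u , λ ()
    Unique-++⁻ (x ∷ xs) (p ∷ u) = let u₁ , u₂ , d = Unique-++⁻ xs u in
      All.tabulate (λ m → All.lookup p (++⁺ˡ m)) ∷ u₁ , u₂ ,
      λ { (here refl) m′ → All.lookup p (++⁺ʳ xs m′) refl ; (there m) m′ → d m m′ }

    Unique-reverse : ∀ {xs : List A} → Unique xs → Unique (reverse xs)
    Unique-reverse []                  = []
    Unique-reverse {x ∷ xs} (p ∷ u) = subst Unique (sym (unfold-reverse x xs))
      (++⁺ (Unique-reverse u) ([] ∷ []) λ { (m , here refl) → All.lookup p (reverse⁻ m) refl })

    Unique-∉ : ∀ {x} {xs : List A} → Unique (x ∷ xs) → ¬ x L.∈ xs
    Unique-∉ (p ∷ _) m = All.lookup p m refl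

    Unique-tail : ∀ {x} {xs : List A} → Unique (x ∷ xs) → Unique xs
    Unique-tail (_ ∷ u) = u

    Unique-∷ : ∀ {x} {xs : List A} → ¬ x L.∈ xs → Unique xs → Unique (x ∷ xs)
    Unique-∷ ∉ u = All.tabulate (λ m → λ { refl → ∉ m }) ∷ u

  members : List V → DecSet n
  members xs = ⟪ (λ v → DecL._∈?_ _≟_ v xs) ⟫

  #members : ∀ xs → # (members xs) ≤ length xs
  #members []       = ≤-reflexive (#-empty (members []) λ ())
  #members (x ∷ xs) = ≤-trans (#-union (members (x ∷ xs)) ⁅ x ⁆ (members xs)
    (λ { (here eq) → inj₁ eq ; (there m) → inj₂ m })) (#⁅⁆≤1 x ⊕ #members xs)

  #members-unique : ∀ xs → Unique xs → length xs ≤ # (members xs)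
  #members-unique []       _       = z≤n
  #members-unique (x ∷ xs) u = ≤-trans (#-inhabited ⁅ x ⁆ refl ⊕ #members-unique xs (Unique-tail u))
    (#-disjoint ⁅ x ⁆ (members xs) (members (x ∷ xs)) here there (λ { refl m → Unique-∉ u m }))

  record InnerPath (P : V → Set) (u v : V) : Set where
    field
      inner  : List V
      chain  : Chain u inner v
      within : ∀ {x} → x L.∈ inner → P x
      unique : Unique inner

  joinReach : ∀ X Y {Q Q′ a b v} → (∀ {x} → x ∈ X → x ∈ Y → x ≡ v) →
    (p : Reach X Q a v) (q : Reach Y Q′ b v) →
    Σ (InnerPath (λ x → x ∈ X ⊎ x ∈ Y) (Reach.end p) (Reach.end q)) λ r → length (InnerPath.inner r) ≤ a + b
  joinReach X Y {v = v} meet p q = record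
    { inner  = inner
    ; chain  = Chain-++ (Chain-sym P.chain) Q.chain
    ; within = λ m → case ++⁻ (reverse P.tail) m of λ
        { (inj₁ m₁) → inj₁ (P.inside (there (reverse⁻ m₁))) ; (inj₂ m₂) → inj₂ (Q.inside m₂) }
    ; unique = ++⁺ (Unique-reverse (Unique-tail P.unique)) Q.unique λ (m₁ , m₂) →
        case meet (P.inside (there (reverse⁻ m₁))) (Q.inside m₂) of λ
          { refl → Unique-∉ P.unique (reverse⁻ m₁) }
    } , (begin
      length inner                                  ≡⟨ length-++ (reverse P.tail) ⟩
      length (reverse P.tail) + suc (length Q.tail) ≡⟨ cong (_+ suc (length Q.tail)) (length-reverse P.tail) ⟩
      length P.tail + suc (length Q.tail)           ≤⟨ <⇒≤ P.short ⊕ Q.short ⟩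
      _                                             ∎)
    where
    open ≤-Reasoning
    module P = Reach p
    module Q = Reach q
    inner = reverse P.tail ++ v ∷ Q.tail

  -- bury₁ and bury₂ give up the object around Q₁ or Q₂.
  data Connection (g l : ℕ) (Link : (V → Set) → V → V → Set) (R Q₁ Q₂ : DecSet n) : Set₁ where
    linked : ∀ {q₁ q₂} → q₁ ∈ Q₁ → q₂ ∈ Q₂ → (W : DecSet n) → W ⊆ R → # W ≤ l →
             Link (_∈ W) q₁ q₂ → Connection g l Link R Q₁ Q₂
    bury   : (X : DecSet n) → X ⊆ R → 1 ≤ # X → 2 * # X ≤ # R + 2 * l →
             2 * g * # (∂ R ∅ X) ≤ # X → Connection g l Link R Q₁ Q₂
    bury₁  : (X : DecSet n) → X ⊆ R → 2 * # X ≤ # R →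
             4 * g * # (∂ R ∅ (Q₁ ∪ X)) ≤ # (Q₁ ∪ X) + 4 * g * l → Connection g l Link R Q₁ Q₂
    bury₂  : (X : DecSet n) → X ⊆ R → 2 * # X ≤ # R →
             4 * g * # (∂ R ∅ (Q₂ ∪ X)) ≤ # (Q₂ ∪ X) + 4 * g * l → Connection g l Link R Q₁ Q₂

  halves-meet : ∀ (R X Y : DecSet n) → X ⊆ R → Y ⊆ R → # R < 2 * # X → # R < 2 * # Y →
                (∀ {v} → v ∈ X → v ∈ Y → ⊥) → ⊥
  halves-meet R X Y X⊆ Y⊆ hX hY d =
    <-irrefl refl (linear 1 (hX ⊕ hY ⊕ 2 ⊛ #-disjoint X Y R X⊆ Y⊆ d) (arith (# R) (# X) (# Y)))
    where
    arith : ∀ r x y → suc r + (2 * x + (2 * y + 2 * r)) + 1 ≡ r + (suc r + (suc r + 2 * (x + y)))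
    arith = solve-∀

  module _ (g l Λ : ℕ) (1≤g : 1 ≤ g) (n<2^Λ : n < 2 ^ Λ)
           (room : 2 * (4 * g * Λ) ≤ l) (R Q₁ Q₂ : DecSet n) (1≤Q₁ : 1 ≤ # Q₁) (1≤Q₂ : 1 ≤ # Q₂) where
    private
      N = 4 * g
      1≤N : 1 ≤ N
      1≤N = ≤-trans 1≤g (m≤m+n g _)

    -- The ball around `Q₁` fills more than half of `R` and becomes the target of the search from
    -- `Q₂`. That search cannot fill another half disjoint from the target, so it hits the ball or
    -- is stuck.
    connect : Connection g l InnerPath R Q₁ Q₂
    connect with BFS.bfs N Λ 1≤N n<2^Λ R Q₁ ∅ (# R) 1≤Q₁
    ... | BFS.hit v _ () _
    ... | BFS.stuck X X⊆ X≤ st = bury₁ X (proj₁ ∘ X⊆) X≤ (≤-trans st (m≤m+n _ _))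
    ... | BFS.ball B B⊆ B> pay with BFS.bfs N Λ 1≤N n<2^Λ R Q₂ B (# R) 1≤Q₂
    ...   | BFS.stuck X X⊆ X≤ st = bury₂ X (proj₁ ∘ X⊆) X≤ (≤-trans st (m≤m+n _ _))
    ...   | BFS.ball X X⊆ X> _ = ⊥-elim (halves-meet R B X (proj₁ ∘ B⊆) (proj₁ ∘ X⊆) B> X> (λ b x → proj₂ (X⊆ x) b))
    ...   | BFS.hit v v∈R v∈B r =
      linked (Reach.end∈ p) (Reach.end∈ r) (members I.inner)
        (λ m → case I.within m of λ
          { (inj₁ b) → proj₁ (B⊆ b) ; (inj₂ (inj₁ (x∈R , _))) → x∈R ; (inj₂ (inj₂ refl)) → v∈R })
        (≤-trans (#members I.inner) (≤-trans (proj₂ joined) (≤-trans (≤-reflexive (cong (4 * g * Λ +_) (sym (+-identityʳ _)))) room)))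
        (record { inner = I.inner ; chain = I.chain ; within = id ; unique = I.unique })
      where
      p = pay v∈B
      joined = joinReach B ((R ∖ B) ∪ ⁅ v ⁆) (λ
        { b (inj₁ (_ , ∉b)) → contradiction b ∉b ; b (inj₂ eq) → eq }) p r
      module I = InnerPath (proj₁ joined)

  -- Links of either parity

  record OddCycle (P : V → Set) : Set where
    field
      head   : V
      rest   : List V
      chain  : Chain head rest head
      inside : ∀ {x} → x L.∈ head ∷ rest → P x
      unique : Unique (head ∷ rest)
      odd    : parity (length (head ∷ rest)) ≡ 1ℙ

    vertices : List V
    vertices = head ∷ rest

  -- The vertex set `P` is fixed before `π`, so a link can be reserved while its parity is still
  -- undecided.
  ParityLink : (V → Set) → V → V → Set
  ParityLink P u v = ∀ π → Σ (InnerPath P u v) λ p → parity (length (InnerPath.inner p)) ≡ π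

  -- Here `x` and `y` count the inner vertices of the two arcs of a cycle with `2 + x + y` vertices.
  -- This number is odd, so the arcs differ in parity, whatever the length `c` added to both.
  opposite : ∀ x y → parity (suc (x + suc y)) ≡ 1ℙ → ∀ c π → parity (c + x) ≡ π ⊎ parity (c + y) ≡ π
  opposite x y odd c π
    rewrite +-suc x y | ℙ.+-homo-+ x y | ℙ.+-homo-+ c x | ℙ.+-homo-+ c y
    with parity x | parity y | parity c | π
  opposite x y () c π | 0ℙ | 0ℙ | _ | _
  opposite x y () c π | 1ℙ | 1ℙ | _ | _
  ... | 0ℙ | 1ℙ | 0ℙ | 0ℙ = inj₁ refl
  ... | 0ℙ | 1ℙ | 0ℙ | 1ℙ = inj₂ refl
  ... | 0ℙ | 1ℙ | 1ℙ | 0ℙ = inj₂ refl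
  ... | 0ℙ | 1ℙ | 1ℙ | 1ℙ = inj₁ refl
  ... | 1ℙ | 0ℙ | 0ℙ | 0ℙ = inj₂ refl
  ... | 1ℙ | 0ℙ | 0ℙ | 1ℙ = inj₁ refl
  ... | 1ℙ | 0ℙ | 1ℙ | 0ℙ = inj₁ refl
  ... | 1ℙ | 0ℙ | 1ℙ | 1ℙ = inj₂ refl

  module _ {P : V → Set} where
    rotate : (C : OddCycle P) → ∀ {a} → a L.∈ OddCycle.vertices C →
      Σ (OddCycle P) λ D → OddCycle.head D ≡ a × (∀ {x} → x L.∈ OddCycle.vertices C → x L.∈ OddCycle.vertices D)
                           × (∀ {x} → x L.∈ OddCycle.vertices D → x L.∈ OddCycle.vertices C)
    rotate C (here refl) = C , refl , id , id
    rotate C {a} (there m) with L.∈-∃++ m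
    ... | xs , ys , eq = record
      { head = a ; rest = ys ++ head ∷ xs
      ; chain = let c₁ , c₂ = Chain-split xs (subst (λ zs → Chain head zs head) eq chain) in Chain-++ c₂ c₁
      ; inside = inside ∘ back
      ; unique = let u = subst (λ zs → Unique (head ∷ zs)) eq unique
                     u₁ , u₂ , d = Unique-++⁻ (head ∷ xs) u
                 in ++⁺ u₂ u₁ (λ (m₁ , m₂) → d m₂ m₁)
      ; odd = trans (cong parity (trans lengths (sym (cong (suc ∘ length) eq)))) odd
      } , refl , forth , back
      where
      open OddCycle C
      lengths : length (a ∷ ys ++ head ∷ xs) ≡ suc (length (xs ++ a ∷ ys))
      lengths = trans (length-++ (a ∷ ys)) (trans (arith (length xs) (length ys)) (cong suc (sym (length-++ xs))))
        where
        arith : ∀ x y → suc y + suc x ≡ suc (x + suc y)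
        arith = solve-∀
      forth : ∀ {x} → x L.∈ head ∷ rest → x L.∈ a ∷ ys ++ head ∷ xs
      forth (here refl) = ++⁺ʳ (a ∷ ys) (here refl)
      forth (there m)   = case ++⁻ xs (subst (_ L.∈_) eq m) of λ
        { (inj₁ m₁) → ++⁺ʳ (a ∷ ys) (there m₁) ; (inj₂ m₂) → ++⁺ˡ m₂ }
      back : ∀ {x} → x L.∈ a ∷ ys ++ head ∷ xs → x L.∈ head ∷ rest
      back m = case ++⁻ (a ∷ ys) m of λ
        { (inj₁ m₁)          → there (subst (_ L.∈_) (sym eq) (++⁺ʳ xs m₁))
        ; (inj₂ (here refl)) → here refl
        ; (inj₂ (there m₂))  → there (subst (_ L.∈_) (sym eq) (++⁺ˡ m₂)) }

    record Arc (C : OddCycle P) (a b : V) (s : List V) : Set where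
      field
        chain  : Chain a s b
        unique : Unique s
        onto   : ∀ {x} → x L.∈ s → x L.∈ OddCycle.vertices C × x ≢ a × x ≢ b

    -- The two arcs between a and b have opposite parities since the cycle is odd.
    arcs : (C : OddCycle P) → ∀ {a b} → a L.∈ OddCycle.vertices C → b L.∈ OddCycle.vertices C → a ≢ b →
      ∀ c π → ∃ λ s → Arc C a b s × parity (c + length s) ≡ π
    arcs C a∈ b∈ a≢b c π with rotate C a∈
    ... | D , refl , forth , back with forth b∈
    ...   | here eq = contradiction (sym eq) a≢b
    ...   | there m with L.∈-∃++ m
    ...     | xs , ys , eq = case opposite (length xs) (length ys)
                (trans (cong (parity ∘ suc) (sym (trans (cong length eq) (length-++ xs)))) D.odd) c π of λ
              { (inj₁ e) → xs , record { chain = proj₁ split ; unique = proj₁ (proj₂ uniq)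
                  ; onto = λ {x} m → back (there (subst (_ L.∈_) (sym eq) (++⁺ˡ m))) ,
                      (λ { refl → proj₁ uniq (++⁺ˡ m) }) , (λ { refl → proj₂ (proj₂ (proj₂ uniq)) m (here refl) }) } , e
              ; (inj₂ e) → reverse ys , record { chain = Chain-sym (proj₂ split)
                  ; unique = Unique-reverse (Unique-tail (proj₁ (proj₂ (proj₂ uniq))))
                  ; onto = λ {x} m → back (there (subst (_ L.∈_) (sym eq) (++⁺ʳ xs (there (reverse⁻ m))))) ,
                      (λ { refl → proj₁ uniq (++⁺ʳ xs (there (reverse⁻ m))) }) ,
                      (λ { refl → Unique-∉ (proj₁ (proj₂ (proj₂ uniq))) (reverse⁻ m) }) } ,
                  trans (cong (λ k → parity (c + k)) (length-reverse ys)) e }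
      where
      module D = OddCycle D
      split = Chain-split xs (subst (λ zs → Chain D.head zs D.head) eq D.chain)
      uniq : ¬ D.head L.∈ (xs ++ _ ∷ ys) × _ × _ × _
      uniq = let u = subst (λ zs → Unique (D.head ∷ zs)) eq D.unique in Unique-∉ u , Unique-++⁻ xs (Unique-tail u)

  -- The first vertex of the walk outside `Y` follows a vertex of `Y`, so it is a boundary vertex.
  -- Here it comes no later than `x`; in `leave` it may be the final vertex `z`.
  leave-within : ∀ W L Y {u ws z x} → Chain u ws z → u ∈ Y → x L.∈ ws → x ∉ Y →
    (∀ {y} → y L.∈ ws → y ∈ W) → ∃ λ b → b ∈ ∂ W L Y × b L.∈ ws
  leave-within W L Y {ws = w ∷ ws} (a ∷ c) u∈ m x∉ ⊆W with dec Y w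
  ... | no w∉  = w , (⊆W (here refl) , w∉ , inj₂ (_ , u∈ , a)) , here refl
  leave-within W L Y (a ∷ c) u∈ (here refl) x∉ ⊆W | yes w∈ = contradiction w∈ x∉
  leave-within W L Y (a ∷ c) u∈ (there m)   x∉ ⊆W | yes w∈ =
    let b , b∈ , m′ = leave-within W L Y c w∈ m x∉ (⊆W ∘ there) in b , b∈ , there m′

  leave : ∀ W L Y {u ws z} → Chain u ws z → u ∈ Y → z ∉ Y → (∀ {y} → y L.∈ ws → y ∈ W) → z ∈ W →
    ∃ λ b → b ∈ ∂ W L Y × (b L.∈ ws ⊎ b ≡ z)
  leave W L Y (edge a) u∈ z∉ ⊆W z∈ = _ , (z∈ , z∉ , inj₂ (_ , u∈ , a)) , inj₂ refl
  leave W L Y {ws = w ∷ ws} (a ∷ c) u∈ z∉ ⊆W z∈ with dec Y w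
  ... | no w∉  = w , (⊆W (here refl) , w∉ , inj₂ (_ , u∈ , a)) , inj₁ (here refl)
  ... | yes w∈ = case leave W L Y c w∈ z∉ (⊆W ∘ there) z∈ of λ
      { (b , b∈ , inj₁ m) → b , b∈ , inj₁ (there m) ; (b , b∈ , inj₂ eq) → b , b∈ , inj₂ eq }

  lastSplit : ∀ {P : V → Set} (P? : ∀ x → Dec (P x)) xs → (∀ {x} → x L.∈ xs → ¬ P x) ⊎
    ∃ λ ds → ∃ λ p → ∃ λ es → xs ≡ ds ++ p ∷ es × P p × (∀ {x} → x L.∈ es → ¬ P x)
  lastSplit P? [] = inj₁ λ ()
  lastSplit P? (x ∷ xs) with lastSplit P? xs
  ... | inj₂ (ds , p , es , eq , r) = inj₂ (x ∷ ds , p , es , cong (x ∷_) eq , r)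
  ... | inj₁ none with P? x
  ...   | yes px = inj₂ ([] , x , xs , refl , px , none)
  ...   | no ¬px = inj₁ λ { (here refl) → ¬px ; (there m) → none m }

  record Trunk (C : DecSet n) (v : V) (tr : List V) : Set where
    field
      inner  : List V
      foot   : V
      foot∈  : foot ∈ C
      chain  : Chain v inner foot
      inner∉ : ∀ {x} → x L.∈ inner → x ∉ C
      eq     : tr ≡ v ∷ inner ++ foot ∷ []

  -- Only the last vertex of a `Back` path lies in `C`, so cutting off both ends leaves inner
  -- vertices that avoid the cycle.
  trunk : ∀ {C v tr} → v ∉ C → Back C v tr → Trunk C v tr
  trunk v∉ (stop v∈) = contradiction v∈ v∉
  trunk {C} v∉ (step {v} {w} _ a b) with dec C w
  trunk v∉ (step _ a (stop w∈)) | yes _ = record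
    { inner = [] ; foot = _ ; foot∈ = w∈ ; chain = edge a ; inner∉ = λ () ; eq = refl }
  trunk v∉ (step _ a (step w∉ _ _)) | yes w∈ = contradiction w∈ w∉
  trunk v∉ (step {v} {w} _ a b) | no w∉ = record
    { inner = w ∷ T.inner ; foot = T.foot ; foot∈ = T.foot∈ ; chain = a ∷ T.chain
    ; inner∉ = λ { (here refl) → w∉ ; (there m) → T.inner∉ m } ; eq = cong (v ∷_) T.eq }
    where module T = Trunk (trunk w∉ b)

  -- Augmenting a path from C to t by a second, disjoint path from C.
  module Residual (R : DecSet n) (cyc : OddCycle (_∈ R)) {p₀ t : V} {ps : List V}
    (p₀∈C : p₀ ∈ members (OddCycle.vertices cyc)) (chain₁ : Chain p₀ ps t)
    (ps⊆ : ∀ {x} → x L.∈ ps → x ∈ R ∖ members (OddCycle.vertices cyc)) (t∉R : t ∉ R) (unique₁ : Unique (p₀ ∷ ps)) where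

    private
      C : DecSet n
      C = members (OddCycle.vertices cyc)

      C⊆R : C ⊆ R
      C⊆R = OddCycle.inside cyc

    P₁ : DecSet n
    P₁ = members (p₀ ∷ ps)

    P₁⊆R : P₁ ⊆ R
    P₁⊆R (here refl) = C⊆R p₀∈C
    P₁⊆R (there m)   = proj₁ (ps⊆ m)

    -- No single vertex of W separates v and t from C.
    record TwoLinked (Z : V → Set) (k : ℕ) (v : V) : Set₁ where
      field
        W    : DecSet n
        C⊆   : C ⊆ W
        ps⊆W : ∀ {x} → x L.∈ ps → x ∈ W
        t∈   : t ∈ W
        v∈   : v ∈ W
        W⊆   : ∀ {x} → x ∈ W → Z x
        size : # W ≤ k
        one  : ∀ Y → Y ⊆ W → v ∉ Y → 1 ≤ # (∂ W C Y)
        two  : ∀ Y → Y ⊆ W → v ∉ Y → t ∉ Y → 2 ≤ # (∂ W C Y)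

      oneₜ : ∀ Y → t ∉ Y → ∃ λ b → b ∈ ∂ W C Y
      oneₜ Y t∉ with dec Y p₀
      ... | no p∉  = p₀ , C⊆ p₀∈C , p∉ , inj₁ p₀∈C
      ... | yes p∈ = let b , b∈ , _ = leave W C Y chain₁ p∈ t∉ ps⊆W t∈ in b , b∈

    weaken : ∀ {Z Z′ k k′ v} → (∀ {x} → Z x → Z′ x) → k ≤ k′ → TwoLinked Z k v → TwoLinked Z′ k′ v
    weaken f k≤ T = record { W = W ; C⊆ = C⊆ ; ps⊆W = ps⊆W ; t∈ = t∈ ; v∈ = v∈ ; W⊆ = λ w → f (W⊆ w)
      ; size = ≤-trans size k≤ ; one = one ; two = two }
      where open TwoLinked T

    -- The two disjoint paths behind this are the given one from `t` and the trivial one at `v`,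
    -- which is a cycle vertex other than `p₀`.
    start : ∀ {v} → v ∈ C → v ≢ p₀ → TwoLinked (λ x → x ∈ C ⊎ x ∈ P₁ ⊎ x ≡ t) (# C + length ps + 1) v
    start {v} v∈C v≢ = record
      { W = W ; C⊆ = inj₁ ∘ inj₁ ; ps⊆W = inj₁ ∘ inj₂ ; t∈ = inj₂ refl ; v∈ = inj₁ (inj₁ v∈C)
      ; W⊆ = λ { (inj₁ (inj₁ c)) → inj₁ c ; (inj₁ (inj₂ m)) → inj₂ (inj₁ (there m)) ; (inj₂ eq) → inj₂ (inj₂ eq) }
      ; size = ≤-trans (#-union W (C ∪ members ps) ⁅ t ⁆ id)
          (≤-trans (#-union (C ∪ members ps) C (members ps) id) (≤-refl {# C} ⊕ #members ps) ⊕ #⁅⁆≤1 t)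
      ; one = λ Y _ v∉ → #-inhabited (∂ W C Y) (v∂ Y v∉)
      ; two = two }
      where
      W = C ∪ members ps ∪ ⁅ t ⁆
      v∂ : ∀ Y → v ∉ Y → v ∈ ∂ W C Y
      v∂ Y v∉ = inj₁ (inj₁ v∈C) , v∉ , inj₁ v∈C
      two : ∀ Y → Y ⊆ W → v ∉ Y → t ∉ Y → 2 ≤ # (∂ W C Y)
      two Y Y⊆ v∉ t∉ with dec Y p₀
      ... | no p∉ = #-two (∂ W C Y) (v∂ Y v∉) (inj₁ (inj₁ p₀∈C) , p∉ , inj₁ p₀∈C) v≢
      ... | yes p∈ with leave W C Y chain₁ p∈ t∉ (inj₁ ∘ inj₂) (inj₂ refl)
      ...   | b , b∈ , inj₁ m    = #-two (∂ W C Y) (v∂ Y v∉) b∈ λ { refl → proj₂ (ps⊆ m) v∈C }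
      ...   | b , b∈ , inj₂ refl = #-two (∂ W C Y) (v∂ Y v∉) b∈ λ { refl → t∉R (C⊆R v∈C) }

    -- If `v` lies outside `Y`, the boundary vertices for `v` still serve. If `v ∈ Y`, then `w` is
    -- itself a boundary vertex, and the path from `t` supplies a second one in the old `W`, which
    -- does not contain `w`.
    extend : ∀ {Z k v w} → TwoLinked Z k v → v ~ w → ¬ Z w → TwoLinked (λ x → Z x ⊎ x ≡ w) (k + 1) w
    extend {Z} {k} {v} {w} T v~w ¬Zw = record
      { W = W′ ; C⊆ = inj₁ ∘ C⊆ ; ps⊆W = λ m → inj₁ (ps⊆W m) ; t∈ = inj₁ t∈ ; v∈ = inj₂ refl
      ; W⊆ = λ { (inj₁ x) → inj₁ (W⊆ x) ; (inj₂ eq) → inj₂ eq }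
      ; size = ≤-trans (#-union W′ W ⁅ w ⁆ id) (size ⊕ #⁅⁆≤1 w)
      ; one = one′ ; two = two′ }
      where
      open TwoLinked T
      W′ = W ∪ ⁅ w ⁆
      w∂ : ∀ Y → v ∈ Y → w ∉ Y → w ∈ ∂ W′ C Y
      w∂ Y v∈Y w∉Y = inj₂ refl , w∉Y , inj₂ (v , v∈Y , v~w)
      restrict : ∀ Y → Y ⊆ W′ → w ∉ Y → Y ⊆ W
      restrict Y Y⊆ w∉ y = case Y⊆ y of λ { (inj₁ x) → x ; (inj₂ refl) → contradiction y w∉ }
      ∂≤ : ∀ Y → # (∂ W C Y) ≤ # (∂ W′ C Y)
      ∂≤ Y = #-mono (∂ W C Y) (∂ W′ C Y) (∂-mono W W′ C Y Y inj₁ id (λ _ → id))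
      one′ : ∀ Y → Y ⊆ W′ → w ∉ Y → 1 ≤ # (∂ W′ C Y)
      one′ Y Y⊆ w∉ with dec Y v
      ... | yes v∈Y = #-inhabited (∂ W′ C Y) (w∂ Y v∈Y w∉)
      ... | no v∉Y  = ≤-trans (one Y (restrict Y Y⊆ w∉) v∉Y) (∂≤ Y)
      two′ : ∀ Y → Y ⊆ W′ → w ∉ Y → t ∉ Y → 2 ≤ # (∂ W′ C Y)
      two′ Y Y⊆ w∉ t∉ with dec Y v
      ... | no v∉Y  = ≤-trans (two Y (restrict Y Y⊆ w∉) v∉Y t∉) (∂≤ Y)
      ... | yes v∈Y with oneₜ Y t∉
      ...   | b , b∈ = #-two (∂ W′ C Y) (w∂ Y v∈Y w∉)
        (∂-mono W W′ C Y Y inj₁ id (λ _ → id) b∈) λ { refl → ¬Zw (W⊆ (proj₁ b∈)) }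

    extendAlong : ∀ ws {Z k v q} → TwoLinked Z k v → Chain v ws q → (∀ {x} → x L.∈ ws → ¬ Z x) → Unique ws →
      ¬ Z q → ¬ q L.∈ ws → TwoLinked (λ x → Z x ⊎ x L.∈ ws ⊎ x ≡ q) (k + (length ws + 1)) q
    extendAlong [] T (edge a) _ _ ¬Zq _ =
      weaken (λ { (inj₁ z) → inj₁ z ; (inj₂ eq) → inj₂ (inj₂ eq) }) ≤-refl (extend T a ¬Zq)
    extendAlong (w ∷ ws) {k = k} T (a ∷ c) ¬Z u ¬Zq q∉ = weaken
      (λ { (inj₁ (inj₁ z)) → inj₁ z ; (inj₁ (inj₂ eq)) → inj₂ (inj₁ (here eq))
         ; (inj₂ (inj₁ m)) → inj₂ (inj₁ (there m)) ; (inj₂ (inj₂ eq)) → inj₂ (inj₂ eq) })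
      (≤-reflexive (+-assoc k 1 (length ws + 1)))
      (extendAlong ws (extend T a (¬Z (here refl))) c
        (λ m → λ { (inj₁ z) → ¬Z (there m) z ; (inj₂ refl) → Unique-∉ u m }) (Unique-tail u)
        (λ { (inj₁ z) → ¬Zq z ; (inj₂ refl) → q∉ (here refl) }) (q∉ ∘ there))

    -- A neighbour pⱼ of v on the path lets us reroute: v takes over the tail of the path
    -- from pⱼ on, which frees its initial segment up to any vertex before pⱼ.
    pushback : ∀ {Z k v pⱼ ds es} → TwoLinked Z k v → v ~ pⱼ → ps ≡ ds ++ pⱼ ∷ es →
      ∀ {w} → w L.∈ p₀ ∷ ds → TwoLinked Z k w
    pushback {Z} {k} {v} {pⱼ} {ds} {es} T v~pⱼ eq {w} w∈ = record
      { W = W ; C⊆ = C⊆ ; ps⊆W = ps⊆W ; t∈ = t∈ ; v∈ = initial w∈ ; W⊆ = W⊆ ; size = size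
      ; one = λ Y _ w∉ → #-inhabited (∂ W C Y) (proj₁ (proj₂ (enter Y w∉)))
      ; two = two′ }
      where
      open TwoLinked T
      chains = Chain-split ds (subst (λ zs → Chain p₀ zs t) eq chain₁)
      uniq = Unique-++⁻ (p₀ ∷ ds) (subst (λ zs → Unique (p₀ ∷ zs)) eq unique₁)
      in-ps : ∀ {x} → x L.∈ ds ++ pⱼ ∷ es → x L.∈ ps
      in-ps = subst (_ L.∈_) (sym eq)
      initial : ∀ {x} → x L.∈ p₀ ∷ ds → x ∈ W
      initial (here refl) = C⊆ p₀∈C
      initial (there m)   = ps⊆W (in-ps (++⁺ˡ m))
      enter : ∀ Y → w ∉ Y → ∃ λ b → b ∈ ∂ W C Y × b L.∈ p₀ ∷ ds
      enter Y w∉ with dec Y p₀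
      ... | no p∉ = p₀ , (C⊆ p₀∈C , p∉ , inj₁ p₀∈C) , here refl
      ... | yes p∈ = case w∈ of λ
        { (here refl) → contradiction p∈ w∉
        ; (there m)   → let b , b∈ , m′ = leave-within W C Y (proj₁ chains) p∈ m w∉ (λ m → initial (there m)) in
                        b , b∈ , there m′ }
      exit : ∀ Y → v ∈ Y → t ∉ Y → ∃ λ b → b ∈ ∂ W C Y × (b L.∈ pⱼ ∷ es ⊎ b ≡ t)
      exit Y v∈Y t∉ with dec Y pⱼ
      ... | no p∉ = pⱼ , (ps⊆W (in-ps (++⁺ʳ ds (here refl))) , p∉ , inj₂ (v , v∈Y , v~pⱼ)) , inj₁ (here refl)
      ... | yes p∈ = case leave W C Y (proj₂ chains) p∈ t∉ (λ m → ps⊆W (in-ps (++⁺ʳ ds (there m)))) t∈ of λ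
          { (b , b∈ , inj₁ m) → b , b∈ , inj₁ (there m) ; (b , b∈ , inj₂ r) → b , b∈ , inj₂ r }
      two′ : ∀ Y → Y ⊆ W → w ∉ Y → t ∉ Y → 2 ≤ # (∂ W C Y)
      two′ Y Y⊆ w∉ t∉ with dec Y v
      ... | no v∉Y  = two Y Y⊆ v∉Y t∉
      ... | yes v∈Y with enter Y w∉ | exit Y v∈Y t∉
      ...   | b , b∈ , m | b′ , b′∈ , inj₁ m′   = #-two (∂ W C Y) b∈ b′∈ λ { refl → proj₂ (proj₂ uniq) m m′ }
      ...   | b , b∈ , m | b′ , b′∈ , inj₂ refl = #-two (∂ W C Y) b∈ b′∈ λ { refl → t∉R (P₁⊆R (case m of λ
              { (here eq) → here eq ; (there m) → there (in-ps (++⁺ˡ m)) })) }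

    Z : DecSet n → V → Set
    Z X x = x ∈ X ⊎ x ∈ P₁ ⊎ x ≡ t

    -- On the path only the last boundary vertex stays out of reach.
    Absorbed : DecSet n → ℕ → Set₁
    Absorbed X k = Σ (DecSet n) λ X′ → X ⊆ X′ × X′ ⊆ R × # X + # (∂ R ∅ X) ≤ # X′ + 1 ×
        (∀ {v} → v ∈ X′ → TwoLinked (Z X′) (k + 1) v)

    -- Boundary vertices off the path are gained by `extend`. If `p` is the last vertex of `ps` next
    -- to the enlarged set, `pushback` gains all path vertices before `p`, and no boundary vertex
    -- comes after it, so at most `p` is lost. If there is no such `p`, only `p₀`, which is not in
    -- `ps`, can be lost.
    absorb : ∀ X k → X ⊆ R → (∀ {v} → v ∈ X → TwoLinked (Z X) k v) → Absorbed X k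
    absorb X k X⊆R pay = result (lastSplit (λ p → any? (λ u → dec X⁺ u ×-dec T? (adj u p))) ps)
      where
      X⁺ = X ∪ (∂ R ∅ X ∖ P₁)
      pay⁺ : ∀ {v} → v ∈ X⁺ → TwoLinked (Z X⁺) (k + 1) v
      pay⁺ (inj₁ x) = weaken (λ { (inj₁ x) → inj₁ (inj₁ x) ; (inj₂ r) → inj₂ r }) (m≤m+n k 1) (pay x)
      pay⁺ v∈@(inj₂ ((v∈R , v∉X , inj₂ (u , u∈ , u~v)) , v∉P)) = weaken
        (λ { (inj₁ (inj₁ x)) → inj₁ (inj₁ x) ; (inj₁ (inj₂ r)) → inj₂ r ; (inj₂ refl) → inj₁ v∈ }) ≤-refl
        (extend (pay u∈) u~v λ { (inj₁ x) → v∉X x ; (inj₂ (inj₁ p)) → v∉P p ; (inj₂ (inj₂ refl)) → t∉R v∈R })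
      X⁺⊆R : X⁺ ⊆ R
      X⁺⊆R (inj₁ x) = X⊆R x
      X⁺⊆R (inj₂ ((v∈R , _) , _)) = v∈R
      count : ∀ X′ e → X⁺ ⊆ X′ → (∀ {v} → v L.∈ p₀ ∷ ps → v ∈ ∂ R ∅ X → v ∈ X′ ∪ ⁅ e ⁆) →
              # X + # (∂ R ∅ X) ≤ # X′ + 1
      count X′ e f g = ≤-trans
        (#-submodular X (∂ R ∅ X) X′ ⁅ e ⁆ (inj₁ ∘ f ∘ inj₁) (λ {v} b → case dec P₁ v of λ
          { (yes p) → g p b ; (no ¬p) → inj₁ (f (inj₂ (b , ¬p))) }) (λ (x , (_ , x∉ , _)) → contradiction x x∉))
        (≤-refl {# X′} ⊕ #⁅⁆≤1 e)
      reached : ∀ {v} → v ∈ ∂ R ∅ X → ∃ λ u → u ∈ X⁺ × u ~ v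
      reached (_ , _ , inj₂ (u , u∈ , a)) = u , inj₁ u∈ , a
      result : (∀ {p} → p L.∈ ps → ¬ ∃ λ u → u ∈ X⁺ × u ~ p) ⊎
               (∃ λ ds → ∃ λ p → ∃ λ es → ps ≡ ds ++ p ∷ es × (∃ λ u → u ∈ X⁺ × u ~ p) ×
                  (∀ {p} → p L.∈ es → ¬ ∃ λ u → u ∈ X⁺ × u ~ p)) → Absorbed X k
      result (inj₁ none) = X⁺ , inj₁ , X⁺⊆R , count X⁺ p₀ id (λ
        { (here eq) _ → inj₂ eq ; (there m) b → contradiction (reached b) (none m) }) , pay⁺
      result (inj₂ (ds , p , es , eq , (u , u∈ , u~p) , none)) =
        X′ , inj₁ ∘ inj₁ , (λ { (inj₁ x) → X⁺⊆R x ; (inj₂ m) → P₁⊆R (ds⊆P₁ m) }) ,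
        count X′ p inj₁ (λ
          { (here eq) _ → inj₁ (inj₂ (here eq))
          ; (there m) b → case ++⁻ ds (subst (_ L.∈_) eq m) of λ
              { (inj₁ m₁) → inj₁ (inj₂ (there m₁)) ; (inj₂ (here e)) → inj₂ e
              ; (inj₂ (there m₂)) → contradiction (reached b) (none m₂) } }) ,
        λ { (inj₁ x) → weaken Z⊆ ≤-refl (pay⁺ x) ; (inj₂ m) → weaken Z⊆ ≤-refl (pushback (pay⁺ u∈) u~p eq m) }
        where
        X′ = X⁺ ∪ members (p₀ ∷ ds)
        ds⊆P₁ : ∀ {x} → x L.∈ p₀ ∷ ds → x ∈ P₁
        ds⊆P₁ (here e)  = here e
        ds⊆P₁ (there m) = there (subst (_ L.∈_) (sym eq) (++⁺ˡ m))
        Z⊆ : ∀ {x} → Z X⁺ x → Z X′ x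
        Z⊆ (inj₁ x) = inj₁ (inj₁ x)
        Z⊆ (inj₂ r) = inj₂ r

    -- Menger's theorem for the ends `t` and `q`, with the cycle in the role of the root's
    -- neighbourhood, gives two disjoint trails into the cycle; the one from `t` need not follow the
    -- given path. Their feet are distinct, so the arc between them can be chosen by parity. The set
    -- `W` is the same for both parities.
    close : ∀ {Z k q} → (T : TwoLinked Z k q) → q ≢ t → q ∉ R →
      ParityLink (λ x → x ∈ TwoLinked.W T × x ≢ t × x ≢ q) t q
    close {Z} {k} {q} T q≢t q∉R π = record
      { inner = inner
      ; chain = Chain-++ T₁.chain (Chain-++ (Arc.chain arc) (Chain-sym T₂.chain))
      ; within = λ m → case ++⁻ T₁.inner m of λ
          { (inj₁ m₁) → within₁ m₁
          ; (inj₂ (here refl)) → within₀ T₁.foot∈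
          ; (inj₂ (there m₂)) → case ++⁻ s m₂ of λ
              { (inj₁ m₃) → within₀ (proj₁ (Arc.onto arc m₃))
              ; (inj₂ (here refl)) → within₀ T₂.foot∈
              ; (inj₂ (there m₄)) → within₂ (reverse⁻ m₄) } }
      ; unique = ++⁺ (proj₁ u₁) (Unique-∷ a∉
          (++⁺ (Arc.unique arc) (Unique-∷ (λ m → T₂.inner∉b (reverse⁻ {xs = T₂.inner} m)) (Unique-reverse (proj₁ u₂)))
            (λ { (m , here refl) → proj₂ (proj₂ (Arc.onto arc m)) refl
               ; (m , there m′) → T₂.inner∉ (reverse⁻ m′) (proj₁ (Arc.onto arc m)) })))
          (λ { (m , here refl) → T₁.inner∉ m T₁.foot∈
             ; (m , there m′) → case ++⁻ s m′ of λ
                 { (inj₁ m₃) → T₁.inner∉ m (proj₁ (Arc.onto arc m₃))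
                 ; (inj₂ (here refl)) → T₁.inner∉ m T₂.foot∈
                 ; (inj₂ (there m₄)) → apart (in₁ (++⁺ˡ m)) (in₂ (++⁺ˡ {xs = T₂.inner} (reverse⁻ m₄))) } })
      } , trans (cong parity lengths) (proj₂ (proj₂ chosen))
      where
      open TwoLinked T
      E = ⁅ t ⁆ ∪ ⁅ q ⁆
      indep : Indep 1 E W C
      indep Y Y⊆ = ≤-trans bound (≤-reflexive (sym (*-identityˡ _)))
        where
        bound : # (E ∖ Y) ≤ # (∂ W C Y)
        bound with dec Y t | dec Y q
        ... | yes t∈Y | yes q∈Y = ≤-trans (≤-reflexive (#-empty (E ∖ Y) λ
                { (inj₁ refl , ∉) → ∉ t∈Y ; (inj₂ refl , ∉) → ∉ q∈Y })) z≤n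
        ... | yes t∈Y | no q∉Y = ≤-trans (≤-trans (#-mono (E ∖ Y) ⁅ q ⁆ λ
                { (inj₁ refl , ∉) → contradiction t∈Y ∉ ; (inj₂ eq , _) → eq }) (#⁅⁆≤1 q)) (one Y Y⊆ q∉Y)
        ... | no t∉Y | yes q∈Y = ≤-trans (≤-trans (#-mono (E ∖ Y) ⁅ t ⁆ λ
                { (inj₁ eq , _) → eq ; (inj₂ refl , ∉) → contradiction q∈Y ∉ }) (#⁅⁆≤1 t))
                (#-inhabited (∂ W C Y) (proj₂ (oneₜ Y t∉Y)))
        ... | no t∉Y | no q∉Y = ≤-trans (≤-trans (#-union (E ∖ Y) ⁅ t ⁆ ⁅ q ⁆ proj₁) (#⁅⁆≤1 t ⊕ #⁅⁆≤1 q)) (two Y Y⊆ q∉Y t∉Y)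
      linkage = menger (# W) E W C ≤-refl (λ { (inj₁ refl) → t∈ ; (inj₂ refl) → v∈ }) indep
      module S = Linkage linkage
      t∈E : t ∈ E
      t∈E = inj₁ refl
      q∈E : q ∈ E
      q∈E = inj₂ refl
      module T₁ = Trunk (trunk (t∉R ∘ C⊆R) (S.back t∈E))
      tr₂ = trunk (q∉R ∘ C⊆R) (S.back q∈E)
      module T₂ where
        open Trunk tr₂ public
        inner∉b : ¬ foot L.∈ inner
        inner∉b m = inner∉ m foot∈
      in₁ : ∀ {x} → x L.∈ T₁.inner ++ T₁.foot ∷ [] → x L.∈ S.trail t
      in₁ m = subst (_ L.∈_) (sym T₁.eq) (there m)
      in₂ : ∀ {x} → x L.∈ T₂.inner ++ T₂.foot ∷ [] → x L.∈ S.trail q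
      in₂ m = subst (_ L.∈_) (sym T₂.eq) (there m)
      apart : ∀ {x} → x L.∈ S.trail t → x L.∈ S.trail q → ⊥
      apart m m′ = q≢t (sym (S.disjoint t∈E q∈E m m′))
      uniq₁ = subst Unique T₁.eq (S.unique t∈E)
      uniq₂ = subst Unique T₂.eq (S.unique q∈E)
      u₁ = Unique-++⁻ T₁.inner (Unique-tail uniq₁)
      u₂ = Unique-++⁻ T₂.inner (Unique-tail uniq₂)
      feet : T₁.foot ≢ T₂.foot
      feet eq = apart (in₁ (++⁺ʳ T₁.inner (here refl))) (in₂ (++⁺ʳ T₂.inner (here eq)))
      chosen = arcs cyc T₁.foot∈ T₂.foot∈ feet (length T₁.inner + (2 + length T₂.inner)) π
      s = proj₁ chosen
      arc = proj₁ (proj₂ chosen)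
      inner = T₁.inner ++ T₁.foot ∷ s ++ T₂.foot ∷ reverse T₂.inner
      lengths : length inner ≡ length T₁.inner + (2 + length T₂.inner) + length s
      lengths = trans (length-++ T₁.inner) (trans (cong (λ k → length T₁.inner + suc k)
        (trans (length-++ s) (cong (λ k → length s + suc k) (length-reverse T₂.inner))))
        (arith (length T₁.inner) (length s) (length T₂.inner)))
        where
        arith : ∀ a s b → a + suc (s + suc b) ≡ a + (2 + b) + s
        arith = solve-∀
      a∉ : ¬ T₁.foot L.∈ s ++ T₂.foot ∷ reverse T₂.inner
      a∉ m = case ++⁻ s m of λ
        { (inj₁ m₃) → proj₁ (proj₂ (Arc.onto arc m₃)) refl
        ; (inj₂ (here eq)) → feet eq
        ; (inj₂ (there m₄)) → T₂.inner∉ (reverse⁻ m₄) T₁.foot∈ }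
      within₀ : ∀ {x} → x ∈ C → x ∈ W × x ≢ t × x ≢ q
      within₀ c = C⊆ c , (λ { refl → t∉R (C⊆R c) }) , (λ { refl → q∉R (C⊆R c) })
      within₁ : ∀ {x} → x L.∈ T₁.inner → x ∈ W × x ≢ t × x ≢ q
      within₁ m = S.inside t∈E (in₁ (++⁺ˡ m)) , (λ { refl → Unique-∉ uniq₁ (++⁺ˡ m) }) ,
        (λ { refl → apart (in₁ (++⁺ˡ m)) (subst (_ L.∈_) (sym T₂.eq) (here refl)) })
      within₂ : ∀ {x} → x L.∈ T₂.inner → x ∈ W × x ≢ t × x ≢ q
      within₂ m = S.inside q∈E (in₂ (++⁺ˡ m)) ,
        (λ { refl → apart (subst (_ L.∈_) (sym T₁.eq) (here refl)) (in₂ (++⁺ˡ m)) }) ,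
        (λ { refl → Unique-∉ uniq₂ (++⁺ˡ m) })

    module _ (g Λ : ℕ) (1≤g : 1 ≤ g) (n<2^Λ : n < 2 ^ Λ) (k₀ : ℕ) where
      private
        N = 4 * g
        1≤N : 1 ≤ N
        1≤N = ≤-trans 1≤g (m≤m+n g _)

      -- The half is measured outside of `P₁` because the second search runs in `R ∖ P₁`. Expansion
      -- is tested with `2 * g` instead of `N = 4 * g`: the difference pays for the vertex that a
      -- round of `absorb` may lose.
      data Augmented : Set₁ where
        grown : (X : DecSet n) → X ⊆ R → C ⊆ X ∪ ⁅ p₀ ⁆ → # R < 2 * # (X ∖ P₁) →
                (∀ {v} → v ∈ X → TwoLinked (Z X) (k₀ + N * Λ) v) → Augmented
        small : (X : DecSet n) → X ⊆ R → 1 ≤ # X → 2 * # (X ∖ P₁) ≤ # R → 2 * g * # (∂ R ∅ X) ≤ # X → Augmented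

      augment : ∀ k i → i + k ≡ N * Λ → (X : DecSet n) → X ⊆ R → C ⊆ X ∪ ⁅ p₀ ⁆ → N ≤ # X →
        (∀ {v} → v ∈ X → TwoLinked (Z X) (k₀ + i) v) → (1 + N) ^ i ≤ N ^ i * # X → Augmented
      augment k i i≡ X X⊆ C⊆X N≤X pay big with # R <? 2 * # (X ∖ P₁)
      ... | yes h = grown X X⊆ C⊆X h (λ x → weaken id (+-monoʳ-≤ k₀ (≤-trans (m≤m+n i k) (≤-reflexive i≡))) (pay x))
      ... | no ¬h with 2 * g * # (∂ R ∅ X) ≤? # X
      ... | yes st = small X X⊆ (≤-trans 1≤N N≤X) (≮⇒≥ ¬h) st
      augment zero i i≡ X X⊆ C⊆X N≤X pay big | no ¬h | no ¬st =
        ⊥-elim (expansion-overflow N Λ (# X) 1≤N (≤-<-trans (#≤n X) n<2^Λ)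
          (subst (λ i → (1 + N) ^ i ≤ N ^ i * # X) (trans (sym (+-identityʳ i)) i≡) big))
      augment (suc k) i i≡ X X⊆ C⊆X N≤X pay big | no ¬h | no ¬st with absorb X (k₀ + i) X⊆ pay
      ... | X′ , X⊆X′ , X′⊆ , count , pay′ =
        augment k (suc i) (trans (sym (+-suc i k)) i≡) X′ X′⊆
          (λ c → case C⊆X c of λ { (inj₁ x) → inj₁ (X⊆X′ x) ; (inj₂ eq) → inj₂ eq })
          (≤-trans N≤X (#-mono X X′ X⊆X′))
          (λ x → weaken id (≤-reflexive (trans (+-comm (k₀ + i) 1) (sym (+-suc k₀ i)))) (pay′ x))
          (≤-trans (linear 0 ((1 + N) ⊛ big) (arith₁ N ((1 + N) ^ i) (N ^ i) (# X))) (≤-trans (N ^ i ⊛ step′)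
            (≤-reflexive (arith₂ N (N ^ i) (# X′)))))
        where
        d = # (∂ R ∅ X)
        -- Not stuck means #X < 2g·d; together with 4g ≤ #X this beats the lost vertex.
        step′ : (1 + N) * # X ≤ N * # X′
        step′ = linear 2 (N ⊛ count ⊕ 2 ⊛ ≰⇒> ¬st ⊕ N≤X) (arith₃ g (# X) d (# X′))
          where
          arith₃ : ∀ g x d y → (1 + 4 * g) * x + (4 * g * (y + 1) + (2 * (2 * g * d) + x)) + 2
                             ≡ 4 * g * y + (4 * g * (x + d) + (2 * suc x + 4 * g))
          arith₃ = solve-∀
        arith₁ : ∀ N a b x → (1 + N) * a + (1 + N) * (b * x) + 0 ≡ b * ((1 + N) * x) + (1 + N) * a
        arith₁ = solve-∀
        arith₂ : ∀ N a y → a * (N * y) ≡ N * a * y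
        arith₂ = solve-∀

    module _ (g l Λ c : ℕ) (1≤g : 1 ≤ g) (n<2^Λ : n < 2 ^ Λ) (room : c + 4 * (4 * g * Λ) + 2 ≤ l)
      (long : 1 + 6 * g ≤ length (OddCycle.vertices cyc)) (short : length (OddCycle.vertices cyc) ≤ c)
      {Q₁ Q₂ : DecSet n} (1≤Q₂ : 1 ≤ # Q₂) (Q₂∉R : ∀ {v} → v ∈ Q₂ → v ∉ R) (Q₁∉Q₂ : ∀ {v} → v ∈ Q₁ → v ∉ Q₂)
      (q₁∈ : t ∈ Q₁) (ps≤ : length ps ≤ 2 * (4 * g * Λ)) where

      private
        N = 4 * g
        1≤N : 1 ≤ N
        1≤N = ≤-trans 1≤g (m≤m+n g _)
        Goal = Connection g l ParityLink R Q₁ Q₂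
        #C≤ : # C ≤ c
        #C≤ = ≤-trans (#members (OddCycle.vertices cyc)) short
        #C≥ : 1 + 6 * g ≤ # C
        #C≥ = ≤-trans long (#members-unique (OddCycle.vertices cyc) (OddCycle.unique cyc))
        k₀ = # C + length ps + 1
        #P₁≤l : # P₁ ≤ l
        #P₁≤l = ≤-trans (#members (p₀ ∷ ps)) (≤-trans (s≤s ps≤)
          (linear (c + 2 * (N * Λ) + 1) room (arith c (N * Λ) l)))
          where
          arith : ∀ c m l → suc (2 * m) + l + (c + 2 * m + 1) ≡ l + (c + 4 * m + 2)
          arith = solve-∀

      second : (X : DecSet n) → X ⊆ R → C ⊆ X ∪ ⁅ p₀ ⁆ → # R < 2 * # (X ∖ P₁) →
               (∀ {v} → v ∈ X → TwoLinked (Z X) (k₀ + N * Λ) v) → Goal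
      second X X⊆R _ X> pay with BFS.bfs N Λ 1≤N n<2^Λ (R ∖ P₁) Q₂ (X ∖ P₁) (# R) 1≤Q₂
      -- The search avoided `P₁`, which may contain up to `l` further boundary vertices; hence the
      -- term `4 * g * l` in `bury₂`.
      ... | BFS.stuck Y Y⊆ Y≤ st = bury₂ Y (proj₁ ∘ proj₁ ∘ Y⊆) Y≤ (linear 0
              (N ⊛ #-union (∂ R ∅ (Q₂ ∪ Y)) (∂ (R ∖ P₁) ∅ (Q₂ ∪ Y)) P₁ split ⊕ st ⊕ N ⊛ #P₁≤l)
              (arith N (# (∂ R ∅ (Q₂ ∪ Y))) (# (∂ (R ∖ P₁) ∅ (Q₂ ∪ Y))) (# P₁) (# (Q₂ ∪ Y)) l))
        where
        split : ∂ R ∅ (Q₂ ∪ Y) ⊆ ∂ (R ∖ P₁) ∅ (Q₂ ∪ Y) ∪ P₁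
        split {v} (v∈R , r) = case dec P₁ v of λ { (yes p) → inj₂ p ; (no ¬p) → inj₁ ((v∈R , ¬p) , r) }
        arith : ∀ N a b p q l → N * a + (N * (b + p) + (q + N * l)) + 0 ≡ q + N * l + (N * a + (N * b + N * p))
        arith = solve-∀
      ... | BFS.ball Y Y⊆ Y> _ = ⊥-elim (halves-meet R (X ∖ P₁) Y (X⊆R ∘ proj₁) (proj₁ ∘ proj₁ ∘ Y⊆) X> Y>
              (λ x y → proj₂ (Y⊆ y) x))
      ... | BFS.hit v (v∈R , v∉P) (v∈X , _) r =
        -- The size consists of at most `c` for the cycle, `2 * (N * Λ)` for the first path, `N * Λ`
        -- each for the augmentation and the second search, and a few units for the ends.
        linked q₁∈ r.end∈ W₀ W₀⊆R
          (≤-trans (#-mono W₀ W (proj₁ ∘ proj₁)) (≤-trans size (linear 1 (#C≤ ⊕ ps≤ ⊕ r.short ⊕ room)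
            (arith (# C) c (length ps) (N * Λ) (length r.tail) l))))
          (λ π → let p , e = close TL q₂≢q₁ (Q₂∉R r.end∈) π in record
            { inner = InnerPath.inner p ; chain = InnerPath.chain p ; unique = InnerPath.unique p
            ; within = λ m → let w , ≢₁ , ≢₂ = InnerPath.within p m in (w , ≢₁) , ≢₂ } , e)
        where
        module r = Reach r
        q₂≢q₁ : r.end ≢ t
        q₂≢q₁ refl = Q₁∉Q₂ q₁∈ r.end∈
        tail⊆R : ∀ {x} → x L.∈ r.tail → x ∈ R
        tail⊆R m = case r.inside (there m) of λ { (inj₁ ((x∈R , _) , _)) → x∈R ; (inj₂ refl) → v∈R }
        tail∉Z : ∀ {x} → x L.∈ r.tail → ¬ Z X x
        tail∉Z m z with r.inside (there m)
        ... | inj₂ refl = Unique-∉ r.unique m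
        ... | inj₁ ((x∈R , x∉P) , x∉T) = case z of λ
              { (inj₁ x) → x∉T (x , x∉P) ; (inj₂ (inj₁ p)) → x∉P p ; (inj₂ (inj₂ refl)) → t∉R x∈R }
        TL = extendAlong r.tail (pay v∈X) r.chain tail∉Z (Unique-tail r.unique)
              (λ { (inj₁ x) → Q₂∉R r.end∈ (X⊆R x) ; (inj₂ (inj₁ p)) → Q₂∉R r.end∈ (P₁⊆R p)
                 ; (inj₂ (inj₂ eq)) → q₂≢q₁ eq })
              (λ m → Q₂∉R r.end∈ (tail⊆R m))
        open TwoLinked TL using (W; W⊆; size)
        W₀ = W ∖ ⁅ t ⁆ ∖ ⁅ r.end ⁆
        W₀⊆R : W₀ ⊆ R
        W₀⊆R ((w , ≢₁) , ≢₂) = case W⊆ w of λ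
          { (inj₁ (inj₁ x)) → X⊆R x ; (inj₁ (inj₂ (inj₁ p))) → P₁⊆R p
          ; (inj₁ (inj₂ (inj₂ eq))) → contradiction eq ≢₁
          ; (inj₂ (inj₁ m)) → tail⊆R m ; (inj₂ (inj₂ eq)) → contradiction eq ≢₂ }
        arith : ∀ C c p m t l → C + p + 1 + m + (t + 1) + (c + (2 * m + (m + l))) + 1
                              ≡ l + (C + (p + (suc t + (c + 4 * m + 2))))
        arith = solve-∀

      first : Goal
      first with augment g Λ 1≤g n<2^Λ k₀ (N * Λ) 0 refl (C ∖ ⁅ p₀ ⁆) (C⊆R ∘ proj₁)
                   (λ {v} v∈C → case v ≟ p₀ of λ { (yes eq) → inj₂ eq ; (no ≢) → inj₁ (v∈C , ≢) }) N≤
                   (λ (v∈C , v≢) → weaken Z⊆ (m≤m+n k₀ 0) (start v∈C v≢))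
                   (≤-trans (≤-trans 1≤N N≤) (≤-reflexive (sym (*-identityˡ _))))
        where
        N≤ : N ≤ # (C ∖ ⁅ p₀ ⁆)
        N≤ = linear (2 * g) (#C≥ ⊕ #-union C (C ∖ ⁅ p₀ ⁆) ⁅ p₀ ⁆ (λ {v} v∈C → case v ≟ p₀ of λ
               { (yes eq) → inj₂ eq ; (no ≢) → inj₁ (v∈C , ≢) }) ⊕ #⁅⁆≤1 p₀)
               (arith g (# C) (# (C ∖ ⁅ p₀ ⁆)) (# ⁅ p₀ ⁆))
          where
          arith : ∀ g C D s → 4 * g + (C + (D + s + 1)) + 2 * g ≡ D + (1 + 6 * g + (C + s))
          arith = solve-∀
        Z⊆ : ∀ {x} → x ∈ C ⊎ x ∈ P₁ ⊎ x ≡ t → Z (C ∖ ⁅ p₀ ⁆) x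
        Z⊆ {x} (inj₁ c) = case x ≟ p₀ of λ { (yes eq) → inj₂ (inj₁ (here eq)) ; (no ≢) → inj₁ (c , ≢) }
        Z⊆ (inj₂ r) = inj₂ r
      ... | grown X X⊆ C⊆X X> pay = second X X⊆ C⊆X X> pay
      -- The upper bound on `X` left out its vertices on `P₁`, at most `l` in number; hence the term
      -- `2 * l` in `bury`.
      ... | small X X⊆ 1≤X X≤ st = bury X X⊆ 1≤X (linear 0
              (2 ⊛ #-union X (X ∖ P₁) P₁ (λ {v} x → case dec P₁ v of λ { (yes p) → inj₂ p ; (no ¬p) → inj₁ (x , ¬p) })
                ⊕ X≤ ⊕ 2 ⊛ #P₁≤l) (arith (# X) (# (X ∖ P₁)) (# P₁) (# R) l)) st
        where
        arith : ∀ x y p r l → 2 * x + (2 * (y + p) + (r + 2 * l)) + 0 ≡ r + 2 * l + (2 * x + (2 * y + 2 * p))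
        arith = solve-∀

  module _ (g l Λ c : ℕ) (1≤g : 1 ≤ g) (n<2^Λ : n < 2 ^ Λ) (room : c + 4 * (4 * g * Λ) + 2 ≤ l)
           (R Q₁ Q₂ : DecSet n) (1≤Q₁ : 1 ≤ # Q₁) (1≤Q₂ : 1 ≤ # Q₂)
           (Q₁∉R : ∀ {v} → v ∈ Q₁ → v ∉ R) (Q₂∉R : ∀ {v} → v ∈ Q₂ → v ∉ R)
           (Q₁∉Q₂ : ∀ {v} → v ∈ Q₁ → v ∉ Q₂) where
    private
      N = 4 * g
      1≤N : 1 ≤ N
      1≤N = ≤-trans 1≤g (m≤m+n g _)
      Goal = Connection g l ParityLink R Q₁ Q₂

    module _ (cyc : OddCycle (_∈ R)) (long : 1 + 6 * g ≤ length (OddCycle.vertices cyc))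
             (short : length (OddCycle.vertices cyc) ≤ c) where
      private
        C = members (OddCycle.vertices cyc)
        C⊆R : C ⊆ R
        C⊆R = OddCycle.inside cyc
        #C≤ : # C ≤ c
        #C≤ = ≤-trans (#members (OddCycle.vertices cyc)) short
        #C≥ : 1 + 6 * g ≤ # C
        #C≥ = ≤-trans long (#members-unique (OddCycle.vertices cyc) (OddCycle.unique cyc))

      viaFirstPath : ∀ {p₀ q₁ ps} → p₀ ∈ C → q₁ ∈ Q₁ → Chain p₀ ps q₁ → (∀ {x} → x L.∈ ps → x ∈ R ∖ C) →
        Unique (p₀ ∷ ps) → length ps ≤ 2 * (N * Λ) → Goal
      viaFirstPath p₀∈C q₁∈ chain ps⊆ unique ps≤ = Residual.first R cyc p₀∈C chain ps⊆ (Q₁∉R q₁∈) unique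
        g l Λ c 1≤g n<2^Λ room long short 1≤Q₂ Q₂∉R Q₁∉Q₂ q₁∈ ps≤

      -- A ball around the cycle is grown first, so that the search from `Q₁` must run into the ball
      -- or the cycle and yields a path from the cycle to `Q₁`. If the ball gets stuck, it is buried
      -- together with the cycle, at the cost of no object.
      throughCycle : Goal
      throughCycle with BFS.bfs N Λ 1≤N n<2^Λ (R ∖ C) C ∅ (# R) (≤-trans (m≤m+n 1 _) #C≥)
      ... | BFS.hit v _ () _
      ... | BFS.stuck X X⊆ X≤ st = bury (C ∪ X) (λ { (inj₁ c) → C⊆R c ; (inj₂ x) → proj₁ (proj₁ (X⊆ x)) })
              (≤-trans (≤-trans (m≤m+n 1 _) #C≥) (#-mono C (C ∪ X) inj₁))
              (linear (2 * (4 * (N * Λ) + 2)) (2 ⊛ #-union (C ∪ X) C X id ⊕ X≤ ⊕ 2 ⊛ (#C≤ ⊕ room)) (arith₁ (# (C ∪ X)) (# C) c (# X) (# R) l (N * Λ)))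
              (linear (2 * g * # (∂ R ∅ (C ∪ X))) (st ⊕ N ⊛ #-mono (∂ R ∅ (C ∪ X)) (∂ (R ∖ C) ∅ (C ∪ X))
                (λ (v∈R , v∉ , r) → (v∈R , v∉ ∘ inj₁) , v∉ , r)) (arith₂ g (# (∂ R ∅ (C ∪ X))) (# (∂ (R ∖ C) ∅ (C ∪ X))) (# (C ∪ X))))
        where
        arith₁ : ∀ u C c x r l m → 2 * u + (2 * (C + x) + (r + 2 * (c + l))) + 2 * (4 * m + 2)
                                 ≡ r + 2 * l + (2 * u + (2 * x + 2 * (C + (c + 4 * m + 2))))
        arith₁ = solve-∀
        arith₂ : ∀ g a b u → 2 * g * a + (u + 4 * g * b) + 2 * g * a ≡ u + (4 * g * b + 4 * g * a)
        arith₂ = solve-∀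
      ... | BFS.ball B B⊆ B> pay with BFS.bfs N Λ 1≤N n<2^Λ R Q₁ (B ∪ C) (# R) 1≤Q₁
      ...   | BFS.stuck X X⊆ X≤ st = bury₁ X (proj₁ ∘ X⊆) X≤ (≤-trans st (m≤m+n _ _))
      ...   | BFS.ball X X⊆ X> _ = ⊥-elim (halves-meet R B X (proj₁ ∘ proj₁ ∘ B⊆) (proj₁ ∘ X⊆) B> X>
                (λ b x → proj₂ (X⊆ x) (inj₁ b)))
      ...   | BFS.hit v v∈R (inj₂ v∈C) r = viaFirstPath v∈C r.end∈ r.chain
                (λ m → case r.inside (there m) of λ
                  { (inj₁ (x∈R , x∉)) → x∈R , x∉ ∘ inj₂ ; (inj₂ refl) → contradiction m (Unique-∉ r.unique) })
                r.unique (≤-trans (<⇒≤ r.short) (m≤m+n _ _))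
        where module r = Reach r
      ...   | BFS.hit v v∈R (inj₁ v∈B) r = viaFirstPath p.end∈ r.end∈ I.chain ps⊆
                (Unique-∷ (λ m → proj₂ (ps⊆ m) p.end∈) I.unique)
                (≤-trans (proj₂ joined) (≤-reflexive (cong (N * Λ +_) (sym (+-identityʳ _)))))
        where
        module r = Reach r
        p = pay v∈B
        module p = Reach p
        joined = joinReach B ((R ∖ (B ∪ C)) ∪ ⁅ v ⁆) (λ
          { b (inj₁ (_ , ∉)) → contradiction (inj₁ b) ∉ ; b (inj₂ eq) → eq }) p r
        module I = InnerPath (proj₁ joined)
        ps⊆ : ∀ {x} → x L.∈ I.inner → x ∈ R ∖ C
        ps⊆ m = case I.within m of λ
          { (inj₁ b) → proj₁ (B⊆ b) ; (inj₂ (inj₁ (x∈R , x∉))) → x∈R , x∉ ∘ inj₂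
          ; (inj₂ (inj₂ refl)) → proj₁ (B⊆ v∈B) }

    -- A set of at most half of `R` that violates expansion by `1 / (3 * g)` expands little enough
    -- to be buried at once. If the search finds none, the graph induced on `R` satisfies the
    -- expansion under which an odd cycle is granted.
    connectOdd : ((∀ W → W ⊆ R → 2 * # W ≤ # R → # W ≤ 3 * g * # (∂ R ∅ W)) →
                  Σ (OddCycle (_∈ R)) λ cyc → 1 + 6 * g ≤ length (OddCycle.vertices cyc) ×
                                              length (OddCycle.vertices cyc) ≤ c) → Goal
    connectOdd oddCycle with search {P = λ W → W ⊆ R × 2 * # W ≤ # R × 3 * g * # (∂ R ∅ W) < # W}
        (λ W → (W ⊆? R) ×-dec (2 * # W ≤? # R) ×-dec (3 * g * # (∂ R ∅ W) <? # W)) ext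
      where
      ext : Extensional (λ W → W ⊆ R × 2 * # W ≤ # R × 3 * g * # (∂ R ∅ W) < # W)
      ext X Y f h (X⊆R , X≤ , e) = X⊆R ∘ h , subst (λ k → 2 * k ≤ # R) (#-cong X Y f h) X≤ ,
        subst₂ (λ a b → 3 * g * a < b) (#-cong (∂ R ∅ X) (∂ R ∅ Y)
          (∂-mono R R ∅ X Y id f (λ _ q → q ∘ h)) (∂-mono R R ∅ Y X id h (λ _ q → q ∘ f))) (#-cong X Y f h) e
    ... | inj₁ (W , W⊆R , W≤ , e) = bury W W⊆R (≤-trans (s≤s z≤n) e) (≤-trans W≤ (m≤m+n _ _))
            (≤-trans (*-monoˡ-≤ _ (*-monoˡ-≤ g (n≤1+n 2))) (<⇒≤ e))
    ... | inj₂ none with oddCycle (λ W W⊆R W≤ → ≮⇒≥ (λ e → none W (W⊆R , W≤ , e)))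
    ...   | cyc , long , short = throughCycle cyc long short

  -- Dead sets

  Expands : ℕ → Set₁
  Expands g = ∀ U → 2 * # U ≤ n → # U ≤ g * # (∂ (full n) ∅ U)

  ∂-unused : ∀ s (D F : DecSet n) → (∀ {v} → v ∈ D → v ∉ F) → n ≤ # F + # D + s →
             # (∂ (full n) ∅ D) ≤ # (∂ F ∅ D) + s
  ∂-unused s D F disj n≤ = ≤-trans (#-union (∂ (full n) ∅ D) (∂ F ∅ D) Used (λ {v} (_ , v∉ , r) → case dec F v of λ
      { (yes f) → inj₁ (f , v∉ , r) ; (no ¬f) → inj₂ ((tt , ¬f) , v∉) })) (≤-refl {# (∂ F ∅ D)} ⊕ used)
    where
    Used = full n ∖ F ∖ D
    used : # Used ≤ s
    used = linear 0 (n≤ ⊕ #-disjoint F D (F ∪ D) inj₁ inj₂ (λ f d → disj d f)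
                      ⊕ #-disjoint (F ∪ D) Used (full n) (λ _ → tt) (λ _ → tt)
                          (λ { (inj₁ f) ((_ , ¬f) , _) → ¬f f ; (inj₂ d) (_ , ¬d) → ¬d d })
                      ⊕ ≤-reflexive (#full n))
                    (arith (# Used) (# F) (# D) s (# (F ∪ D)) (# (full n)) n)
      where
      arith : ∀ u f d s x k n → u + (f + d + s + (x + (k + n))) + 0 ≡ s + (n + (f + d + (x + u + k)))
      arith = solve-∀

  -- If D were more than half, an n/2-subset of it would expand too little.
  small-or-half : ∀ g s r → Expands g → (D F : DecSet n) → (∀ {v} → v ∈ D → v ∉ F) → n ≤ # F + # D + s →
    2 * g * # (∂ F ∅ D) ≤ # D → 2 * # D ≤ n + r → 3 + 2 * r + 2 * g * r + 2 * g + 4 * g * s ≤ n →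
    # D ≤ 2 * g * s
  small-or-half g s r expands D F disj n≤ ∂≤ D≤ large with 2 * # D ≤? n
  -- Twice `# D` is at most `2 * g` times the free boundary, hence at most `# D`, plus `2 * g * s`
  -- for the used vertices.
  ... | yes D≤n = linear 0 (2 ⊛ expands D D≤n ⊕ 2 * g ⊛ ∂-unused s D F disj n≤ ⊕ ∂≤)
                    (arith g (# D) (# (∂ (full n) ∅ D)) (# (∂ F ∅ D)) s)
    where
    arith : ∀ g d b f s → d + (2 * (g * b) + (2 * g * (f + s) + d)) + 0 ≡ 2 * g * s + (2 * d + (2 * g * b + 2 * g * f))
    arith = solve-∀
  ... | no D≰n with half n
  ...   | e , 2e≤n , n≤2e+1 with subsetOfSize (# D ∸ e) D e (sym (m∸n+n≡m {n = e} (*-cancelˡ-≤ {e} {# D} 2 (≤-trans 2e≤n (<⇒≤ (≰⇒> D≰n))))))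
  ...     | E , E⊆D , #E≡e = contradiction (linear {x = suc n} r
              (4 ⊛ expE ⊕ 4 * g ⊛ #-union (∂ (full n) ∅ E) (∂ (full n) ∅ D) (D ∖ E) split
                ⊕ 4 * g ⊛ rest ⊕ 4 * g ⊛ ∂-unused s D F disj n≤ ⊕ 2 ⊛ ∂≤ ⊕ (1 + 2 * g) ⊛ D≤ ⊕ (2 + 2 * g) ⊛ n≤2e+1 ⊕ large)
              (arith g e (# (∂ (full n) ∅ E)) (# (∂ (full n) ∅ D)) (# (D ∖ E)) (# D) (# (∂ F ∅ D)) s n r))
              (<⇒≱ ≤-refl)
    where
    expE : e ≤ g * # (∂ (full n) ∅ E)
    expE = subst (_≤ g * # (∂ (full n) ∅ E)) #E≡e (expands E (subst (λ k → 2 * k ≤ n) (sym #E≡e) 2e≤n))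
    split : ∂ (full n) ∅ E ⊆ ∂ (full n) ∅ D ∪ (D ∖ E)
    split {v} (_ , v∉E , inj₂ (u , u∈E , a)) = case dec D v of λ
      { (yes d) → inj₂ (d , v∉E) ; (no ¬d) → inj₁ (tt , ¬d , inj₂ (u , E⊆D u∈E , a)) }
    rest : # (D ∖ E) + e ≤ # D
    rest = subst (λ k → # (D ∖ E) + k ≤ # D) #E≡e (#-disjoint (D ∖ E) E D proj₁ E⊆D (λ (_ , ∉) e → ∉ e))
    arith : ∀ g e b₀ b y d f s n r →
      suc n + (4 * (g * b₀) + (4 * g * (b + y) + (4 * g * d + (4 * g * (f + s) + (2 * d
        + ((1 + 2 * g) * (n + r) + ((2 + 2 * g) * (2 * e + 1) + n))))))) + r
      ≡ n + (4 * e + (4 * g * b₀ + (4 * g * (y + e) + (4 * g * b + (2 * (2 * g * f)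
        + ((1 + 2 * g) * (2 * d) + ((2 + 2 * g) * n + (3 + 2 * r + 2 * g * r + 2 * g + 4 * g * s))))))))
    arith = solve-∀

  -- Paths from walks

  vertexOf : ∀ {u v ys} → Chain u ys v → Fin (suc (suc (length ys))) → V
  vertexOf {u}     c        zero    = u
  vertexOf {v = v} (edge _) (suc _) = v
  vertexOf         (_ ∷ c)  (suc i) = vertexOf c i

  vertexOf-visits : ∀ {u v ys} (c : Chain u ys v) i → vertexOf c i ≡ u ⊎ vertexOf c i L.∈ ys ⊎ vertexOf c i ≡ v
  vertexOf-visits c        zero    = inj₁ refl
  vertexOf-visits (edge _) (suc _) = inj₂ (inj₂ refl)
  vertexOf-visits (_ ∷ c)  (suc i) = case vertexOf-visits c i of λ
    { (inj₁ e) → inj₂ (inj₁ (here e)) ; (inj₂ (inj₁ m)) → inj₂ (inj₁ (there m)) ; (inj₂ (inj₂ e)) → inj₂ (inj₂ e) }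

  toPath : ∀ {u v ys} → Chain u ys v → Unique ys → ¬ u L.∈ ys → ¬ v L.∈ ys → u ≢ v → Path G u v
  toPath {u} {v} {ys} c uniq u∉ v∉ u≢v = record
    { length = suc (length ys) ; vertex = vertexOf c ; start = refl ; end = end c
    ; injective = injective c uniq u∉ v∉ u≢v ; adjacent = adjacent c }
    where
    end : ∀ {u v ys} (c : Chain u ys v) → vertexOf c (Fin.fromℕ (suc (length ys))) ≡ v
    end (edge _) = refl
    end (_ ∷ c)  = end c
    adjacent : ∀ {u v ys} (c : Chain u ys v) i → vertexOf c (Fin.inject₁ i) ~ vertexOf c (suc i)
    adjacent (edge a)         zero    = a
    adjacent (a ∷ edge _)     zero    = a
    adjacent (a ∷ (_ ∷ _))    zero    = a
    adjacent (_ ∷ c)          (suc i) = adjacent c i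
    injective : ∀ {u v ys} (c : Chain u ys v) → Unique ys → ¬ u L.∈ ys → ¬ v L.∈ ys → u ≢ v →
                ∀ {i j} → vertexOf c i ≡ vertexOf c j → i ≡ j
    injective c _ _ _ _ {zero} {zero} _ = refl
    injective (edge _) _ _ _ u≢v {zero} {suc zero} e = contradiction e u≢v
    injective (edge _) _ _ _ u≢v {suc zero} {zero} e = contradiction (sym e) u≢v
    injective (edge _) _ _ _ _ {suc zero} {suc zero} _ = refl
    injective (_ ∷ c) uniq u∉ v∉ u≢v {zero} {suc j} e = case vertexOf-visits c j of λ
      { (inj₁ e′) → contradiction (here (trans e e′)) u∉
      ; (inj₂ (inj₁ m)) → contradiction (there (subst (L._∈ _) (sym e) m)) u∉
      ; (inj₂ (inj₂ e′)) → contradiction (trans e e′) u≢v }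
    injective (_ ∷ c) uniq u∉ v∉ u≢v {suc i} {zero} e = case vertexOf-visits c i of λ
      { (inj₁ e′) → contradiction (here (trans (sym e) e′)) u∉
      ; (inj₂ (inj₁ m)) → contradiction (there (subst (L._∈ _) e m)) u∉
      ; (inj₂ (inj₂ e′)) → contradiction (trans (sym e) e′) u≢v }
    injective (_ ∷ c) uniq u∉ v∉ u≢v {suc i} {suc j} e =
      cong suc (injective c (Unique-tail uniq) (Unique-∉ uniq) (v∉ ∘ there) (λ { refl → v∉ (here refl) }) e)

  ray : ∀ {x v tr} → Back (Neighbours x) v tr → ∃ λ ws → tr ≡ v ∷ ws × Chain v ws x
  ray (stop a)     = [] , refl , edge (~-sym a)
  ray (step {v = v} _ a b) = let ws , eq , c = ray b in _ ∷ ws , cong (v ∷_) eq , a ∷ c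

  InnerPath-mono : ∀ {P Q : V → Set} {u v} → (∀ {x} → P x → Q x) → InnerPath P u v → InnerPath Q u v
  InnerPath-mono f p = record { inner = inner ; chain = chain ; within = λ m → f (within m) ; unique = unique }
    where open InnerPath p

  ParityLink-mono : ∀ {P Q : V → Set} {u v} → (∀ {x} → P x → Q x) → ParityLink P u v → ParityLink Q u v
  ParityLink-mono f p π = InnerPath-mono f (proj₁ (p π)) , proj₂ (p π)

  module Pattern {m} (H : Graph m) where

    open Graph H using () renaming (adj to adjᴴ; _~_ to _~ᴴ_)

    -- Embedding H

    Edge-≡ : ∀ {e f : Edge H} → Edge.source e ≡ Edge.source f → Edge.target e ≡ Edge.target f → e ≡ f
    Edge-≡ {e} {f} refl refl with ≤-irrelevant (Edge.ordered e) (Edge.ordered f) | T-irrelevant (Edge.adjacent e) (Edge.adjacent f)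
    ... | refl | refl = refl

    -- A colouring encodes the partition of the vertices, so the disjointness of all bodies and
    -- links is built in.
    data Colour : Set where
      free dead : Colour
      obj       : Fin m → Colour
      link      : Fin m → Fin m → Colour

    _≟ᶜ_ : DecidableEquality Colour
    free     ≟ᶜ free     = yes refl
    free     ≟ᶜ dead     = no λ ()
    free     ≟ᶜ obj _    = no λ ()
    free     ≟ᶜ link _ _ = no λ ()
    dead     ≟ᶜ free     = no λ ()
    dead     ≟ᶜ dead     = yes refl
    dead     ≟ᶜ obj _    = no λ ()
    dead     ≟ᶜ link _ _ = no λ ()
    obj _    ≟ᶜ free     = no λ ()
    obj _    ≟ᶜ dead     = no λ ()
    obj h    ≟ᶜ obj k    with h ≟ k
    ... | yes refl = yes refl
    ... | no  h≢k  = no λ { refl → h≢k refl }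
    obj _    ≟ᶜ link _ _ = no λ ()
    link _ _ ≟ᶜ free     = no λ ()
    link _ _ ≟ᶜ dead     = no λ ()
    link _ _ ≟ᶜ obj _    = no λ ()
    link a b ≟ᶜ link c d with a ≟ c | b ≟ d
    ... | yes refl | yes refl = yes refl
    ... | no a≢c   | _        = no λ { refl → a≢c refl }
    ... | yes _    | no b≢d   = no λ { refl → b≢d refl }

    is-just⇒ : ∀ {a} {A : Set a} (x : Maybe A) → T (is-just x) → ∃ λ y → x ≡ just y
    is-just⇒ (just y) _ = y , refl

    ⇒is-just : ∀ {a} {A : Set a} {x : Maybe A} {y} → x ≡ just y → T (is-just x)
    ⇒is-just refl = tt

    just≢nothing : ∀ {a} {A : Set a} {x : Maybe A} {y} → x ≡ just y → x ≡ nothing → ⊥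
    just≢nothing refl ()

    maybe-case : ∀ {a} {A : Set a} (x : Maybe A) → (x ≡ nothing) ⊎ (∃ λ y → x ≡ just y)
    maybe-case nothing  = inj₁ refl
    maybe-case (just y) = inj₂ (y , refl)

    deg : Fin m → ℕ
    deg h = # ⟪ (λ k → T? (adjᴴ h k)) ⟫

    module Weights (g l : ℕ) where

      -- A body has `l * weight h` vertices. The exits of `h` spoil at most `l * deg h` of them; the
      -- other `8 * g * l * deg h` are `4 * g` times the bound `2 * l * deg h` on what is released
      -- when `h` is given up.
      weight : Fin m → ℕ
      weight h = (1 + 8 * g) * deg h

      budget : ℕ
      budget = sum (λ h → 1 + l * weight h) + sum (λ h → sum (λ k → l * bit ((h Fin.<? k) ×-dec T? (adjᴴ h k))))

    -- States of the embedding process, for either kind of link.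

    module Engine (g l s : ℕ) (1≤g : 1 ≤ g) (1≤l : 1 ≤ l)
      (Link : (V → Set) → V → V → Set)
      (Link-mono : ∀ {P Q : V → Set} {u v} → (∀ {x} → P x → Q x) → Link P u v → Link Q u v) where

      open Weights g l

      module _ (colour : V → Colour) where
        Class : Colour → DecSet n
        Class c = ⟪ (λ v → colour v ≟ᶜ c) ⟫

      Exits : (Fin m → Fin m → Maybe V) → Fin m → DecSet n
      Exits exit h = ⟪ (λ v → any? (λ k → ≡just? (exit h k) v)) ⟫
        where
        ≡just? : ∀ (x : Maybe V) v → Dec (x ≡ just v)
        ≡just? nothing  v = no λ ()
        ≡just? (just u) v with u ≟ v
        ... | yes refl = yes refl
        ... | no u≢v   = no λ { refl → u≢v refl }

      record State : Set₁ where
        field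
          colour : V → Colour
          object : ∀ h → Maybe (Object l (weight h))
          exit   : Fin m → Fin m → Maybe V

          body-colour  : ∀ {h o v} → object h ≡ just o → v ∈ Object.body o → colour v ≡ obj h
          root-colour  : ∀ {h o} → object h ≡ just o → colour (Object.root o) ≡ obj h
          no-object    : ∀ {h v} → object h ≡ nothing → colour v ≢ obj h
          exits⊆       : ∀ {h k v o} → object h ≡ just o → exit h k ≡ just v → v ∈ Object.body o
          exits-indep  : ∀ {h o} → object h ≡ just o →
                         Indep 1 (Exits exit h) (Object.body o) (Neighbours (Object.root o))
          exit-object  : ∀ {h k v} → exit h k ≡ just v → ∃ λ o → object h ≡ just o
          exit-adj     : ∀ {h k v} → exit h k ≡ just v → h ~ᴴ k
          exit-sym     : ∀ {h k v} → exit h k ≡ just v → ∃ λ u → exit k h ≡ just u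
          exit-inj     : ∀ {h j k v} → exit h j ≡ just v → exit h k ≡ just v → j ≡ k
          links        : ∀ {h k u v} → h Fin.< k → exit h k ≡ just u → exit k h ≡ just v →
                         Link (λ x → colour x ≡ link h k) u v
          no-link      : ∀ {h k x} → exit h k ≡ nothing → colour x ≢ link h k
          link-ordered : ∀ {h k x} → colour x ≡ link h k → h Fin.< k
          size-obj     : ∀ h → # (Class colour (obj h)) ≤ 1 + l * weight h
          size-link    : ∀ h k → # (Class colour (link h k)) ≤ l
          dead-small   : 2 * g * # (∂ (Class colour free) ∅ (Class colour dead)) ≤ # (Class colour dead)

        Free Dead : DecSet n
        Free = Class colour free
        Dead = Class colour dead

        Objects : DecSet m
        Objects = ⟪ (λ h → T? (is-just (object h))) ⟫

        Used : Fin m → DecSet m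
        Used h = ⟪ (λ k → T? (is-just (exit h k))) ⟫

        Bounded : Set
        Bounded = # Dead ≤ 2 * g * s

        Complete : Set₁
        Complete = (∀ h → ∃ λ o → object h ≡ just o) × (∀ h k → h ~ᴴ k → ∃ λ v → exit h k ≡ just v)

      -- From a complete state to a topological minor.

      module Assembly (S : State) (complete : State.Complete S) where

        open State S

        objectOf : ∀ h → Object l (weight h)
        objectOf h = proj₁ (proj₁ complete h)

        object-≡ : ∀ h → object h ≡ just (objectOf h)
        object-≡ h = proj₂ (proj₁ complete h)

        σ : Fin m → V
        σ h = Object.root (objectOf h)

        body : Fin m → DecSet n
        body h = Object.body (objectOf h)

        σ-colour : ∀ h → colour (σ h) ≡ obj h
        σ-colour h = root-colour (object-≡ h)

        σ-injective : ∀ {h k} → σ h ≡ σ k → h ≡ k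
        σ-injective {h} {k} e = case trans (sym (σ-colour h)) (trans (cong colour e) (σ-colour k)) of λ { refl → refl }

        exitOf : ∀ {h k} → h ~ᴴ k → V
        exitOf {h} {k} a = proj₁ (proj₂ complete h k a)

        exit-≡ : ∀ {h k} (a : h ~ᴴ k) → exit h k ≡ just (exitOf a)
        exit-≡ {h} {k} a = proj₂ (proj₂ complete h k a)

        fan : ∀ h → Linkage (Exits exit h) (body h) (Neighbours (σ h))
        fan h = menger (# (body h)) (Exits exit h) (body h) (Neighbours (σ h)) ≤-refl
          (λ (k , e) → exits⊆ (object-≡ h) e) (exits-indep (object-≡ h))

        ~ᴴ-sym : ∀ {h k} → h ~ᴴ k → k ~ᴴ h
        ~ᴴ-sym {h} {k} = subst T (Graph.symmetric H h k)

        module _ {h k : Fin m} (a : h ~ᴴ k) where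
          exit∈ : exitOf a ∈ Exits exit h
          exit∈ = k , exit-≡ a

          spoke : List V
          spoke = Linkage.trail (fan h) (exitOf a)

          spoke-ray = ray (Linkage.back (fan h) exit∈)

          spoke-tail : List V
          spoke-tail = proj₁ spoke-ray

          spoke-body : ∀ {x} → x L.∈ spoke → x ∈ body h
          spoke-body = Linkage.inside (fan h) exit∈

          spoke-colour : ∀ {x} → x L.∈ spoke → colour x ≡ obj h
          spoke-colour m = body-colour (object-≡ h) (spoke-body m)

          σ∉spoke : ¬ σ h L.∈ spoke
          σ∉spoke m = Object.root∉ (objectOf h) (spoke-body m)

          spoke-unique : Unique (exitOf a ∷ spoke-tail)
          spoke-unique = subst Unique (proj₁ (proj₂ spoke-ray)) (Linkage.unique (fan h) exit∈)

          in-spoke : ∀ {x} → x L.∈ exitOf a ∷ spoke-tail → x L.∈ spoke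
          in-spoke = subst (_ L.∈_) (sym (proj₁ (proj₂ spoke-ray)))

        spokes-disjoint : ∀ {h j k} (a : h ~ᴴ j) (b : h ~ᴴ k) {x} → x L.∈ spoke a → x L.∈ spoke b → j ≡ k
        spokes-disjoint {h} a b m m′ = exit-inj (exit-≡ a)
          (trans (exit-≡ b) (cong just (sym (Linkage.disjoint (fan h) (exit∈ a) (exit∈ b) m m′))))

        module _ (e : Edge H) where
          open Edge e

          forth : source ~ᴴ target
          forth = adjacent

          back : target ~ᴴ source
          back = ~ᴴ-sym adjacent

          link-colour : Colour
          link-colour = link source target

          LinkPath : Set
          LinkPath = InnerPath (λ x → colour x ≡ link-colour) (exitOf forth) (exitOf back)

          linkOf : Link (λ x → colour x ≡ link-colour) (exitOf forth) (exitOf back)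
          linkOf = links ordered (exit-≡ forth) (exit-≡ back)

          overhead : ℕ
          overhead = 3 + (length (spoke-tail forth) + length (spoke-tail back))

          module _ (p : LinkPath) where
            module p = InnerPath p

            inner : List V
            inner = reverse (spoke-tail forth) ++ exitOf forth ∷ p.inner ++ exitOf back ∷ spoke-tail back

            data Position (x : V) : Set where
              near : x L.∈ spoke forth → Position x
              mid  : colour x ≡ link-colour → Position x
              far  : x L.∈ spoke back → Position x

            position : ∀ {x} → x L.∈ inner → Position x
            position m = case ++⁻ (reverse (spoke-tail forth)) m of λ
              { (inj₁ m₁) → near (in-spoke forth (there (reverse⁻ m₁)))
              ; (inj₂ (here eq)) → near (in-spoke forth (here eq))
              ; (inj₂ (there m₂)) → case ++⁻ p.inner m₂ of λ
                  { (inj₁ m₃) → mid (p.within m₃) ; (inj₂ m₄) → far (in-spoke back m₄) } }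

            source≢target : source ≢ target
            source≢target eq = <-irrefl (cong Fin.toℕ eq) ordered

            σ∉inner : ∀ {w} → w ≡ source ⊎ w ≡ target → ¬ σ w L.∈ inner
            σ∉inner {w} end m with position m
            ... | mid c = case trans (sym (σ-colour w)) c of λ ()
            ... | near m′ = case trans (sym (σ-colour w)) (spoke-colour forth m′) of λ { refl → σ∉spoke forth m′ }
            ... | far m′  = case trans (sym (σ-colour w)) (spoke-colour back m′) of λ { refl → σ∉spoke back m′ }

            inner-unique : Unique inner
            inner-unique = ++⁺ (Unique-reverse (Unique-tail (spoke-unique forth)))
              (Unique-∷ (λ m → case ++⁻ p.inner m of λ
                  { (inj₁ m₁) → case trans (sym (spoke-colour forth (in-spoke forth (here refl)))) (p.within m₁) of λ ()
                  ; (inj₂ m₂) → apart (in-spoke forth (here refl)) (in-spoke back m₂) })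
                (++⁺ p.unique (spoke-unique back)
                  (λ (m₁ , m₂) → case trans (sym (p.within m₁)) (spoke-colour back (in-spoke back m₂)) of λ ())))
              (λ { (m , here refl) → Unique-∉ (spoke-unique forth) (reverse⁻ m)
                 ; (m , there m′) → case ++⁻ p.inner m′ of λ
                     { (inj₁ m₁) → case trans (sym (spoke-colour forth (in-spoke forth (there (reverse⁻ m))))) (p.within m₁) of λ ()
                     ; (inj₂ m₂) → apart (in-spoke forth (there (reverse⁻ m))) (in-spoke back m₂) } })
              where
              apart : ∀ {x} → x L.∈ spoke forth → x L.∈ spoke back → ⊥
              apart m m′ = case trans (sym (spoke-colour forth m)) (spoke-colour back m′) of λ { refl → source≢target refl }

            edgePath : Path G (σ source) (σ target)
            edgePath = toPath
              (Chain-++ (Chain-sym (proj₂ (proj₂ (spoke-ray forth)))) (Chain-++ p.chain (proj₂ (proj₂ (spoke-ray back)))))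
              inner-unique (σ∉inner (inj₁ refl)) (σ∉inner (inj₂ refl)) (source≢target ∘ σ-injective)

            edgePath-length : Path.length edgePath ≡ overhead + length p.inner
            edgePath-length = trans (cong suc (trans (length-++ (reverse (spoke-tail forth)))
                (cong₂ (λ i j → i + suc j) (length-reverse (spoke-tail forth)) (length-++ p.inner))))
              (arith (length (spoke-tail forth)) (length p.inner) (length (spoke-tail back)))
              where
              arith : ∀ a i b → suc (a + suc (i + suc b)) ≡ 3 + (a + b) + i
              arith = solve-∀

            data Visit (x : V) : Set where
              root  : ∀ w → Edge.IsEnd e w → x ≡ σ w → Visit x
              arm   : ∀ {w y} (a : w ~ᴴ y) → (w ≡ source × y ≡ target) ⊎ (w ≡ target × y ≡ source) →
                      x L.∈ spoke a → Visit x
              inlet : colour x ≡ link-colour → Visit x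

            visit : ∀ {x} → Path.Visits edgePath x → Visit x
            visit (i , refl) = case vertexOf-visits chain i of λ
              { (inj₁ eq) → root source (inj₁ refl) eq
              ; (inj₂ (inj₂ eq)) → root target (inj₂ refl) eq
              ; (inj₂ (inj₁ m)) → case position m of λ
                  { (near m′) → arm forth (inj₁ (refl , refl)) m′
                  ; (mid c)   → inlet c
                  ; (far m′)  → arm back (inj₂ (refl , refl)) m′ } }
              where
              chain = Chain-++ (Chain-sym (proj₂ (proj₂ (spoke-ray forth)))) (Chain-++ p.chain (proj₂ (proj₂ (spoke-ray back))))

        module _ (linkPath : ∀ e → LinkPath e) where

          -- Colours separate links from objects, different links from each other, and pieces at
          -- different roots. A root shares its colour with its spokes but is not in the body. Two
          -- spokes at one root are disjoint by Menger's theorem unless they belong to the same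
          -- edge.
          visits-disjoint : ∀ {e f} → e ≢ f → ∀ {x} → Visit e (linkPath e) x → Visit f (linkPath f) x →
                            ∃ λ w → Edge.IsEnd e w × Edge.IsEnd f w × x ≡ σ w
          visits-disjoint e≢f (root w end eq) (root w′ end′ eq′) = case σ-injective (trans (sym eq) eq′) of λ
            { refl → w , end , end′ , eq }
          visits-disjoint e≢f (root w _ refl) (arm a _ m) = case trans (sym (σ-colour w)) (spoke-colour a m) of λ
            { refl → contradiction m (σ∉spoke a) }
          visits-disjoint e≢f (arm a _ m) (root w _ refl) = case trans (sym (σ-colour w)) (spoke-colour a m) of λ
            { refl → contradiction m (σ∉spoke a) }
          visits-disjoint e≢f (root w _ refl) (inlet c) = case trans (sym (σ-colour w)) c of λ ()
          visits-disjoint e≢f (inlet c) (root w _ refl) = case trans (sym (σ-colour w)) c of λ ()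
          visits-disjoint e≢f (arm a _ m) (inlet c) = case trans (sym (spoke-colour a m)) c of λ ()
          visits-disjoint e≢f (inlet c) (arm a _ m) = case trans (sym (spoke-colour a m)) c of λ ()
          visits-disjoint {e} {f} e≢f (inlet c) (inlet c′) = contradiction
            (case trans (sym c) c′ of λ eq → Edge-≡ (cong link-source eq) (cong link-target eq)) e≢f
            where
            -- Total projections turn an equation between link colours into equations between the
            -- ends; their values at other colours are arbitrary.
            link-source link-target : Colour → Fin m
            link-source (link h k) = h
            link-source _          = Edge.source e
            link-target (link h k) = k
            link-target _          = Edge.source e
          visits-disjoint {e} {f} e≢f (arm a ends m) (arm b ends′ m′) =
            contradiction (same ends ends′ (obj-injective (trans (sym (spoke-colour a m)) (spoke-colour b m′))) a b m m′) e≢f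
            where
            obj-injective : ∀ {h k} → obj h ≡ obj k → h ≡ k
            obj-injective refl = refl
            same : ∀ {w y w′ y′} →
              (w ≡ Edge.source e × y ≡ Edge.target e) ⊎ (w ≡ Edge.target e × y ≡ Edge.source e) →
              (w′ ≡ Edge.source f × y′ ≡ Edge.target f) ⊎ (w′ ≡ Edge.target f × y′ ≡ Edge.source f) →
              w ≡ w′ → (a : w ~ᴴ y) (b : w′ ~ᴴ y′) → ∀ {x} → x L.∈ spoke a → x L.∈ spoke b → e ≡ f
            same E F refl a b m m′ with spokes-disjoint a b m m′
            same (inj₁ (refl , refl)) (inj₁ (eq , eq′)) refl a b m m′ | refl = Edge-≡ eq eq′
            same (inj₂ (refl , refl)) (inj₂ (eq , eq′)) refl a b m m′ | refl = Edge-≡ eq′ eq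
            same (inj₁ (refl , refl)) (inj₂ (eq , eq′)) refl a b m m′ | refl = contradiction
              (subst₂ Fin._<_ eq eq′ (Edge.ordered e)) (<-asym (Edge.ordered f))
            same (inj₂ (refl , refl)) (inj₁ (eq , eq′)) refl a b m m′ | refl = contradiction
              (subst₂ Fin._<_ eq′ eq (Edge.ordered e)) (<-asym (Edge.ordered f))

          minor : TopologicalMinor H G
          minor = record
            { σ = σ ; injective = σ-injective ; path = λ e → edgePath e (linkPath e)
            ; disjoint = λ {e} {f} e≢f v v′ → visits-disjoint e≢f (visit e (linkPath e) v) (visit f (linkPath f) v′) }

        arbitrary : (∀ {P u v} → Link P u v → InnerPath P u v) → TopologicalMinor H G
        arbitrary path = minor (λ e → path (linkOf e))

        -- The spokes are fixed by now, so the parity of `overhead` is known; the link is asked for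
        -- the prescribed parity plus that of `overhead`, which then cancels.
        prescribed : (∀ {P u v} → Link P u v → ParityLink P u v) → ∀ (π : Edge H → Parity) →
          ∃ λ (M : TopologicalMinor H G) → ∀ e → parity (Path.length (TopologicalMinor.path M e)) ≡ π e
        prescribed path π = minor (λ e → proj₁ (chosen e)) , λ e →
            trans (cong parity (edgePath-length e (proj₁ (chosen e))))
              (trans (ℙ.+-homo-+ (overhead e) (length (InnerPath.inner (proj₁ (chosen e)))))
                (trans (cong (parity (overhead e) ℙ.+_) (proj₂ (chosen e))) (+-involutive (parity (overhead e)) (π e))))
          where
          chosen : ∀ e → Σ (LinkPath e) λ p → parity (length (InnerPath.inner p)) ≡ parity (overhead e) ℙ.+ π e
          chosen e = path (linkOf e) (parity (overhead e) ℙ.+ π e)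

      open State

      -- Transitions between states: burying a set, adding an object, adding a link.

      module _ (budget≤s : budget ≤ s) where

        used≤s : (S : State) → n ≤ # (Free S) + # (Dead S) + s
        used≤s S = begin
          n                                       ≡⟨ #full n ⟨
          # (full n)                              ≤⟨ #-union (full n) (Free S ∪ Dead S) (O ∪ L) (λ {v} _ → split v (colour S v) refl) ⟩
          # (Free S ∪ Dead S) + # (O ∪ L)         ≤⟨ #-union (Free S ∪ Dead S) (Free S) (Dead S) id ⊕ #-union (O ∪ L) O L id ⟩
          # (Free S) + # (Dead S) + (# O + # L)   ≤⟨ ≤-refl {# (Free S) + # (Dead S)} ⊕ ≤-trans
              (≤-trans (#-⋃ O (λ h → Class (colour S) (obj h)) id) (sum-mono (λ h → # (Class (colour S) (obj h))) _ (size-obj S))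
               ⊕ ≤-trans (#-⋃ L L₁ (λ { (h , k , e) → h , k , e }))
                   (sum-mono (λ h → # (L₁ h)) _ (λ h → ≤-trans (#-⋃ (L₁ h) (λ k → Class (colour S) (link h k)) id)
                     (sum-mono (λ k → # (Class (colour S) (link h k))) _ (size h)))))
              budget≤s ⟩
          # (Free S) + # (Dead S) + s             ∎
          where
          open ≤-Reasoning
          O L : DecSet n
          O = ⟪ (λ v → any? (λ h → colour S v ≟ᶜ obj h)) ⟫
          L = ⟪ (λ v → any? (λ h → any? (λ k → colour S v ≟ᶜ link h k))) ⟫
          L₁ : Fin m → DecSet n
          L₁ h = ⟪ (λ v → any? (λ k → colour S v ≟ᶜ link h k)) ⟫
          split : ∀ v c → colour S v ≡ c → v ∈ (Free S ∪ Dead S) ∪ (O ∪ L)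
          split v free       e = inj₁ (inj₁ e)
          split v dead       e = inj₁ (inj₂ e)
          split v (obj h)    e = inj₂ (inj₁ (h , e))
          split v (link h k) e = inj₂ (inj₂ (h , k , e))
          -- A vertex of this colour shows that `h < k` and that the two are adjacent in `H`, so
          -- only edges are charged.
          size : ∀ h k → # (Class (colour S) (link h k)) ≤ l * bit ((h Fin.<? k) ×-dec T? (adjᴴ h k))
          size h k with any? (λ x → colour S x ≟ᶜ link h k)
          ... | no ¬x = ≤-trans (≤-reflexive (#-empty (Class (colour S) (link h k)) (λ e → ¬x (_ , e)))) z≤n
          ... | yes (x , e) = ≤-trans (size-link S h k) (≤-trans (≤-reflexive (sym (*-identityʳ l)))
                  (l ⊛ bit-yes ((h Fin.<? k) ×-dec T? (adjᴴ h k)) (link-ordered S e , (case maybe-case (exit S h k) of λ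
                    { (inj₁ none) → contradiction e (no-link S none) ; (inj₂ (_ , some)) → exit-adj S some }))))

        module _ (expands : Expands g)
                 (large : 3 + 2 * (4 * g * s + 2 * l + 2 * s) + 2 * g * (4 * g * s + 2 * l + 2 * s) + 2 * g + 4 * g * s ≤ n) where

          -- Z dies; the objects of 𝒦 and all their links are released.
          module Bury (S : State) (bounded : Bounded S) (𝒦 : DecSet m) (Z : DecSet n)
            (Z⊆ : ∀ {v} → v ∈ Z → colour S v ≡ free ⊎ ∃ λ h → h ∈ 𝒦 × colour S v ≡ obj h) where

            Released : Colour → Set
            Released free       = ⊥
            Released dead       = ⊥
            Released (obj h)    = h ∈ 𝒦
            Released (link h k) = h ∈ 𝒦 ⊎ k ∈ 𝒦

            released? : ∀ c → Dec (Released c)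
            released? free       = no id
            released? dead       = no id
            released? (obj h)    = dec 𝒦 h
            released? (link h k) = dec 𝒦 h ⊎-dec dec 𝒦 k

            Freed : DecSet n
            Freed = ⟪ (λ v → released? (colour S v) ×-dec ¬? (dec Z v)) ⟫

            colour′ : V → Colour
            colour′ v with dec Z v | released? (colour S v)
            ... | yes _ | _     = dead
            ... | no _  | yes _ = free
            ... | no _  | no _  = colour S v

            keep : ∀ {v c} → v ∉ Z → ¬ Released c → colour S v ≡ c → colour′ v ≡ c
            keep {v} v∉ ¬r e with dec Z v | released? (colour S v)
            ... | yes z | _     = contradiction z v∉
            ... | no _  | yes r = contradiction (subst Released e r) ¬r
            ... | no _  | no _  = e

            kept : ∀ {v c} → c ≢ free → c ≢ dead → colour′ v ≡ c → colour S v ≡ c × v ∉ Z × ¬ Released c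
            kept {v} ≢free ≢dead e with dec Z v | released? (colour S v)
            ... | yes _ | _     = contradiction (sym e) ≢dead
            ... | no _  | yes _ = contradiction (sym e) ≢free
            ... | no ¬z | no ¬r = e , ¬z , subst (λ c → ¬ Released c) e ¬r

            free′ : ∀ {v} → colour′ v ≡ free → v ∉ Z × (colour S v ≡ free ⊎ v ∈ Freed)
            free′ {v} e with dec Z v | released? (colour S v)
            ... | no ¬z | yes r = ¬z , inj₂ (r , ¬z)
            ... | no ¬z | no _  = ¬z , inj₁ e

            dead′ : ∀ {v} → colour′ v ≡ dead → v ∈ Z ⊎ colour S v ≡ dead
            dead′ {v} e with dec Z v | released? (colour S v)
            ... | yes z | _    = inj₁ z
            ... | no _  | no _ = inj₂ e

            Z-dead : ∀ {v} → v ∈ Z → colour′ v ≡ dead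
            Z-dead {v} z with dec Z v | released? (colour S v)
            ... | yes _ | _     = refl
            ... | no ¬z | yes _ = contradiction z ¬z
            ... | no ¬z | no _  = contradiction z ¬z

            untouched : ∀ {v h} → h ∉ 𝒦 → colour S v ≡ obj h → v ∉ Z
            untouched h∉ e z = case Z⊆ z of λ
              { (inj₁ f) → case trans (sym e) f of λ () ; (inj₂ (k , k∈ , f)) → case trans (sym e) f of λ { refl → h∉ k∈ } }

            untouched-link : ∀ {v h k} → colour S v ≡ link h k → v ∉ Z
            untouched-link e z = case Z⊆ z of λ
              { (inj₁ f) → case trans (sym e) f of λ () ; (inj₂ (_ , _ , f)) → case trans (sym e) f of λ () }

            object′ : ∀ h → Maybe (Object l (weight h))
            object′ h with dec 𝒦 h
            ... | yes _ = nothing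
            ... | no _  = object S h

            object-inv : ∀ {h o} → object′ h ≡ just o → h ∉ 𝒦 × object S h ≡ just o
            object-inv {h} e with dec 𝒦 h
            ... | no h∉ = h∉ , e

            object-keep : ∀ {h} → h ∉ 𝒦 → object′ h ≡ object S h
            object-keep {h} h∉ with dec 𝒦 h
            ... | yes h∈ = contradiction h∈ h∉
            ... | no _   = refl

            exit′ : Fin m → Fin m → Maybe V
            exit′ h k with dec 𝒦 h | dec 𝒦 k
            ... | no _  | no _  = exit S h k
            ... | no _  | yes _ = nothing
            ... | yes _ | _     = nothing

            exit-inv : ∀ {h k v} → exit′ h k ≡ just v → h ∉ 𝒦 × k ∉ 𝒦 × exit S h k ≡ just v
            exit-inv {h} {k} e with dec 𝒦 h | dec 𝒦 k
            ... | no h∉ | no k∉ = h∉ , k∉ , e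

            exit-keep : ∀ {h k} → h ∉ 𝒦 → k ∉ 𝒦 → exit′ h k ≡ exit S h k
            exit-keep {h} {k} h∉ k∉ with dec 𝒦 h | dec 𝒦 k
            ... | no _   | no _   = refl
            ... | no _   | yes k∈ = contradiction k∈ k∉
            ... | yes h∈ | _      = contradiction h∈ h∉

            module _ (2Z≤ : 2 * # Z ≤ n + 2 * l + 2 * s) (∂≤ : 2 * g * (# (∂ (Free S) ∅ Z) + # Freed) ≤ # Z) where

              private
                Free′ = Class colour′ free
                Dead′ = Class colour′ dead

                dead-grows : # (Dead S) + # Z ≤ # Dead′
                dead-grows = #-disjoint (Dead S) Z Dead′ still Z-dead (λ e z → case Z⊆ z of λ
                  { (inj₁ f) → case trans (sym e) f of λ () ; (inj₂ (_ , _ , f)) → case trans (sym e) f of λ () })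
                  where
                  still : Dead S ⊆ Dead′
                  still {v} e = keep (λ z → case Z⊆ z of λ
                    { (inj₁ f) → case trans (sym e) f of λ () ; (inj₂ (_ , _ , f)) → case trans (sym e) f of λ () }) id e

                -- A free vertex next to the new dead set was next to the old one, or is next to
                -- `Z`, or has just been released. The released vertices are all charged as
                -- boundary, which is why they enter `∂≤`.
                small′ : 2 * g * # (∂ Free′ ∅ Dead′) ≤ # Dead′
                small′ = linear 0
                  (2 * g ⊛ #-union (∂ Free′ ∅ Dead′) (∂ (Free S) ∅ (Dead S)) (∂ (Free S) ∅ Z ∪ Freed) split
                    ⊕ 2 * g ⊛ #-union (∂ (Free S) ∅ Z ∪ Freed) (∂ (Free S) ∅ Z) Freed id
                    ⊕ dead-small S ⊕ ∂≤ ⊕ dead-grows)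
                  (arith g (# (∂ Free′ ∅ Dead′)) (# (∂ (Free S) ∅ (Dead S))) (# (∂ (Free S) ∅ Z ∪ Freed))
                    (# (∂ (Free S) ∅ Z)) (# Freed) (# (Dead S)) (# Z) (# Dead′))
                  where
                  split : ∂ Free′ ∅ Dead′ ⊆ ∂ (Free S) ∅ (Dead S) ∪ (∂ (Free S) ∅ Z ∪ Freed)
                  split (f , _ , inj₂ (u , u∈ , a)) with free′ f
                  ... | _  , inj₂ r = inj₂ (inj₂ r)
                  ... | ∉Z , inj₁ e = case dead′ u∈ of λ
                    { (inj₁ z) → inj₂ (inj₁ (e , ∉Z , inj₂ (u , z , a)))
                    ; (inj₂ d) → inj₁ (e , (λ e′ → case trans (sym e) e′ of λ ()) , inj₂ (u , d , a)) }
                  arith : ∀ g a b c d f p z q →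
                    2 * g * a + (2 * g * (b + c) + (2 * g * (d + f) + (p + (z + q)))) + 0
                    ≡ q + (2 * g * a + (2 * g * c + (2 * g * b + (2 * g * (d + f) + (p + z)))))
                  arith = solve-∀

                dead≤ : # Dead′ ≤ # (Dead S) + # Z
                dead≤ = #-union Dead′ (Dead S) Z (λ e → case dead′ e of λ { (inj₁ z) → inj₂ z ; (inj₂ d) → inj₁ d })

              after : State
              after = record
                { colour = colour′ ; object = object′ ; exit = exit′
                ; body-colour = λ e v∈ → let h∉ , e′ = object-inv e ; c = body-colour S e′ v∈ in
                    keep (untouched h∉ c) h∉ c
                ; root-colour = λ e → let h∉ , e′ = object-inv e ; c = root-colour S e′ in
                    keep (untouched h∉ c) h∉ c
                ; no-object = λ e c → let c′ , _ , h∉ = kept (λ ()) (λ ()) c in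
                    no-object S (trans (sym (object-keep h∉)) e) c′
                ; exits⊆ = λ e e₁ → exits⊆ S (proj₂ (object-inv e)) (proj₂ (proj₂ (exit-inv e₁)))
                ; exits-indep = λ {h} {o} e → Indep-⊆ 1 (Exits (exit S) h) (Exits exit′ h) (Object.body o) (Neighbours (Object.root o))
                    (λ (k , e₁) → k , proj₂ (proj₂ (exit-inv e₁))) (exits-indep S (proj₂ (object-inv e)))
                ; exit-object = λ e → let h∉ , _ , e₁ = exit-inv e ; o , e′ = exit-object S e₁ in
                    o , trans (object-keep h∉) e′
                ; exit-adj = λ e → exit-adj S (proj₂ (proj₂ (exit-inv e)))
                ; exit-sym = λ e → let h∉ , k∉ , e₁ = exit-inv e ; u , e₂ = exit-sym S e₁ in
                    u , trans (exit-keep k∉ h∉) e₂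
                ; exit-inj = λ e₁ e₂ → exit-inj S (proj₂ (proj₂ (exit-inv e₁))) (proj₂ (proj₂ (exit-inv e₂)))
                ; links = λ h<k e₁ e₂ → let h∉ , k∉ , e₁′ = exit-inv e₁ in
                    Link-mono (λ c → keep (untouched-link c) (λ { (inj₁ h∈) → h∉ h∈ ; (inj₂ k∈) → k∉ k∈ }) c)
                      (links S h<k e₁′ (proj₂ (proj₂ (exit-inv e₂))))
                ; no-link = λ e c → let c′ , _ , ¬r = kept (λ ()) (λ ()) c in
                    no-link S (trans (sym (exit-keep (¬r ∘ inj₁) (¬r ∘ inj₂))) e) c′
                ; link-ordered = λ c → link-ordered S (proj₁ (kept (λ ()) (λ ()) c))
                ; size-obj = λ h → ≤-trans (#-mono (Class colour′ (obj h)) (Class (colour S) (obj h))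
                    (λ c → proj₁ (kept (λ ()) (λ ()) c))) (size-obj S h)
                ; size-link = λ h k → ≤-trans (#-mono (Class colour′ (link h k)) (Class (colour S) (link h k))
                    (λ c → proj₁ (kept (λ ()) (λ ()) c))) (size-link S h k)
                ; dead-small = small′ }

              buried : Bounded after × # (Dead S) + # Z ≤ # (Dead after)
              -- The old dead set has at most `2 * g * s` vertices and `Z` at most about half of
              -- all, so their union exceeds half only by the given excess, and `small-or-half`
              -- brings it back below `2 * g * s`.
              buried = small-or-half g s (4 * g * s + 2 * l + 2 * s) expands Dead′ Free′
                  (λ d f → case trans (sym d) f of λ ()) (used≤s after) small′
                  (linear 0 (2 ⊛ dead≤ ⊕ 2 ⊛ bounded ⊕ 2Z≤) (arith g (# Dead′) (# (Dead S)) (# Z) s l n)) large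
                , dead-grows
                where
                arith : ∀ g d′ d z s l n → 2 * d′ + (2 * (d + z) + (2 * (2 * g * s) + (n + 2 * l + 2 * s))) + 0
                  ≡ n + (4 * g * s + 2 * l + 2 * s) + (2 * d′ + (2 * d + 2 * z))
                arith = solve-∀

              burial : Σ State λ S′ → Bounded S′ × # (Dead S) + # Z ≤ # (Dead S′)
              burial = after , buried

      module AddObject (S : State) (h : Fin m) (none : object S h ≡ nothing) (O : Object l (weight h))
        (root-free : colour S (Object.root O) ≡ free) (body-free : Object.body O ⊆ Free S) where

        open Object O using (root; body)

        new : DecSet n
        new = body ∪ ⁅ root ⁆

        new-free : ∀ {v} → v ∈ new → colour S v ≡ free
        new-free (inj₁ b)    = body-free b
        new-free (inj₂ refl) = root-free

        colour′ : V → Colour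
        colour′ v with dec new v
        ... | yes _ = obj h
        ... | no _  = colour S v

        keep : ∀ {v c} → c ≢ free → colour S v ≡ c → colour′ v ≡ c
        keep {v} ≢free e with dec new v
        ... | yes v∈ = contradiction (trans (sym e) (new-free v∈)) ≢free
        ... | no _   = e

        kept : ∀ {v c} → c ≢ obj h → colour′ v ≡ c → colour S v ≡ c
        kept {v} ≢h e with dec new v
        ... | yes _ = contradiction (sym e) ≢h
        ... | no _  = e

        coloured : ∀ {v} → v ∈ new → colour′ v ≡ obj h
        coloured {v} v∈ with dec new v
        ... | yes _ = refl
        ... | no v∉ = contradiction v∈ v∉

        only : Class colour′ (obj h) ⊆ new
        only {v} e with dec new v
        ... | yes v∈ = v∈
        ... | no _   = contradiction e (no-object S none)

        object′ : ∀ k → Maybe (Object l (weight k))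
        object′ k with k ≟ h
        ... | yes refl = just O
        ... | no _     = object S k

        no-exits : ∀ {k v} → exit S h k ≢ just v
        no-exits e = just≢nothing (proj₂ (exit-object S e)) none

        after : State
        after = record
          { colour = colour′ ; object = object′ ; exit = exit S
          ; body-colour = body-colour′ ; root-colour = root-colour′ ; no-object = no-object′
          ; exits⊆ = exits⊆′ ; exits-indep = exits-indep′ ; exit-object = exit-object′
          ; exit-adj = exit-adj S ; exit-sym = exit-sym S ; exit-inj = exit-inj S
          ; links = λ h<k e₁ e₂ → Link-mono (keep (λ ())) (links S h<k e₁ e₂)
          ; no-link = λ e c → no-link S e (kept (λ ()) c)
          ; link-ordered = λ c → link-ordered S (kept (λ ()) c)
          ; size-obj = size-obj′
          ; size-link = λ j k → ≤-trans (#-mono (Class colour′ (link j k)) (Class (colour S) (link j k)) (kept (λ ()))) (size-link S j k)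
          ; dead-small = ≤-trans (2 * g ⊛ #-mono (∂ (Class colour′ free) ∅ (Class colour′ dead)) (∂ (Free S) ∅ (Dead S))
                (λ { (f , _ , inj₂ (u , d , a)) → kept (λ ()) f , (λ e → case trans (sym e) (kept (λ ()) f) of λ ()) ,
                                                  inj₂ (u , kept (λ ()) d , a) }))
              (≤-trans (dead-small S) (#-mono (Dead S) (Class colour′ dead) (keep (λ ())))) }
          where
          body-colour′ : ∀ {k o v} → object′ k ≡ just o → v ∈ Object.body o → colour′ v ≡ obj k
          body-colour′ {k} e v∈ with k ≟ h
          body-colour′ refl v∈ | yes refl = coloured (inj₁ v∈)
          ... | no k≢h = keep (λ ()) (body-colour S e v∈)
          root-colour′ : ∀ {k o} → object′ k ≡ just o → colour′ (Object.root o) ≡ obj k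
          root-colour′ {k} e with k ≟ h
          root-colour′ refl | yes refl = coloured (inj₂ refl)
          ... | no k≢h = keep (λ ()) (root-colour S e)
          no-object′ : ∀ {k v} → object′ k ≡ nothing → colour′ v ≢ obj k
          no-object′ {k} e c with k ≟ h
          no-object′ () c | yes refl
          ... | no k≢h = no-object S e (kept (λ { refl → k≢h refl }) c)
          exits⊆′ : ∀ {j k v o} → object′ j ≡ just o → exit S j k ≡ just v → v ∈ Object.body o
          exits⊆′ {j} e e₁ with j ≟ h
          ... | yes refl = contradiction e₁ no-exits
          ... | no _     = exits⊆ S e e₁
          exits-indep′ : ∀ {j o} → object′ j ≡ just o → Indep 1 (Exits (exit S) j) (Object.body o) (Neighbours (Object.root o))
          exits-indep′ {j} e with j ≟ h
          ... | yes refl = λ Y _ → ≤-trans (≤-reflexive (#-empty (Exits (exit S) h ∖ Y) (λ ((_ , e₁) , _) → no-exits e₁))) z≤n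
          ... | no _     = exits-indep S e
          exit-object′ : ∀ {j k v} → exit S j k ≡ just v → ∃ λ o → object′ j ≡ just o
          exit-object′ {j} e with j ≟ h
          ... | yes refl = O , refl
          ... | no _     = exit-object S e
          size-obj′ : ∀ k → # (Class colour′ (obj k)) ≤ 1 + l * weight k
          size-obj′ k with k ≟ h
          ... | no k≢h = ≤-trans (#-mono (Class colour′ (obj k)) (Class (colour S) (obj k)) (kept (λ { refl → k≢h refl }))) (size-obj S k)
          ... | yes refl = ≤-trans (#-mono (Class colour′ (obj h)) new only) (≤-trans (#-union new body ⁅ root ⁆ id)
                  (≤-trans (≤-reflexive (Object.size O) ⊕ #⁅⁆≤1 root) (≤-reflexive (+-comm _ 1))))

        dead-same : # (Dead after) ≡ # (Dead S)
        dead-same = #-cong (Dead after) (Dead S) (kept (λ ())) (keep (λ ()))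

        objects-grow : # (Objects S) < # (Objects after)
        objects-grow = ≤-trans (≤-reflexive (sym (#-insert (Objects S) {h}
            (λ t → just≢nothing (proj₂ (is-just⇒ (object S h) t)) none))))
          (#-mono (Objects S ∪ ⁅ h ⁆) (Objects after) grown)
          where
          grown : Objects S ∪ ⁅ h ⁆ ⊆ Objects after
          grown {k} t with k ≟ h
          ... | yes refl = tt
          grown (inj₁ t)  | no _   = t
          grown (inj₂ eq) | no k≢h = contradiction eq k≢h

        larger : Σ State λ S′ → # (Dead S′) ≡ # (Dead S) × # (Objects S) < # (Objects S′)
        larger = after , dead-same , objects-grow

      module AddLink (S : State) {h k : Fin m} (h<k : h Fin.< k) (h~k : h ~ᴴ k) (none : exit S h k ≡ nothing)
        {o o′} (obj-h : object S h ≡ just o) (obj-k : object S k ≡ just o′) {q q′ : V}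
        (q∈ : q ∈ Object.body o) (q′∈ : q′ ∈ Object.body o′)
        (q∉ : q ∉ Exits (exit S) h) (q′∉ : q′ ∉ Exits (exit S) k)
        (indep  : Indep 1 (Exits (exit S) h ∪ ⁅ q ⁆) (Object.body o) (Neighbours (Object.root o)))
        (indep′ : Indep 1 (Exits (exit S) k ∪ ⁅ q′ ⁆) (Object.body o′) (Neighbours (Object.root o′)))
        (W : DecSet n) (W⊆ : W ⊆ Free S) (W≤ : # W ≤ l) (linkage : Link (_∈ W) q q′) where

        colour′ : V → Colour
        colour′ v with dec W v
        ... | yes _ = link h k
        ... | no _  = colour S v

        keep : ∀ {v c} → c ≢ free → colour S v ≡ c → colour′ v ≡ c
        keep {v} ≢free e with dec W v
        ... | yes v∈ = contradiction (trans (sym e) (W⊆ v∈)) ≢free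
        ... | no _   = e

        kept : ∀ {v c} → c ≢ link h k → colour′ v ≡ c → colour S v ≡ c
        kept {v} ne e with dec W v
        ... | yes _ = contradiction (sym e) ne
        ... | no _  = e

        coloured : ∀ {v} → v ∈ W → colour′ v ≡ link h k
        coloured {v} v∈ with dec W v
        ... | yes _ = refl
        ... | no v∉ = contradiction v∈ v∉

        only : Class colour′ (link h k) ⊆ W
        only {v} e with dec W v
        ... | yes v∈ = v∈
        ... | no _   = contradiction e (no-link S none)

        h≢k : h ≢ k
        h≢k refl = <-irrefl refl h<k

        exit′ : Fin m → Fin m → Maybe V
        exit′ a b with a ≟ h | b ≟ k | a ≟ k | b ≟ h
        ... | yes _ | yes _ | _     | _     = just q
        ... | _     | _     | yes _ | yes _ = just q′
        ... | _     | _     | _     | _     = exit S a b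

        data Exit (a b : Fin m) (v : V) : Set where
          forth : a ≡ h → b ≡ k → v ≡ q → Exit a b v
          back  : a ≡ k → b ≡ h → v ≡ q′ → Exit a b v
          old   : exit S a b ≡ just v → Exit a b v

        exit-inv : ∀ {a b v} → exit′ a b ≡ just v → Exit a b v
        exit-inv {a} {b} e with a ≟ h | b ≟ k | a ≟ k | b ≟ h
        exit-inv refl | yes x | yes y | _     | _     = forth x y refl
        exit-inv refl | yes _ | no _  | yes x | yes y = back x y refl
        exit-inv refl | no _  | _     | yes x | yes y = back x y refl
        ... | yes _ | no _  | no _  | _     = old e
        ... | yes _ | no _  | yes _ | no _  = old e
        ... | no _  | _     | no _  | _     = old e
        ... | no _  | _     | yes _ | no _  = old e

        exit-forth : exit′ h k ≡ just q
        exit-forth with h ≟ h | k ≟ k | h ≟ k | k ≟ h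
        ... | yes _ | yes _ | _ | _ = refl
        ... | no ne | _     | _ | _ = contradiction refl ne
        ... | yes _ | no ne | _ | _ = contradiction refl ne

        exit-back : exit′ k h ≡ just q′
        exit-back with k ≟ h | h ≟ k | k ≟ k | h ≟ h
        ... | yes e | _     | _     | _     = contradiction (sym e) h≢k
        ... | no _  | _     | yes _ | yes _ = refl
        ... | no _  | _     | no ne | _     = contradiction refl ne
        ... | no _  | _     | yes _ | no ne = contradiction refl ne

        exit-old : ∀ {a b v} → exit S a b ≡ just v → ∃ λ u → exit′ a b ≡ just u
        exit-old {a} {b} e with a ≟ h | b ≟ k | a ≟ k | b ≟ h
        ... | yes _ | yes _ | _     | _     = _ , refl
        ... | yes _ | no _  | yes _ | yes _ = _ , refl
        ... | no _  | _     | yes _ | yes _ = _ , refl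
        ... | yes _ | no _  | no _  | _     = _ , e
        ... | yes _ | no _  | yes _ | no _  = _ , e
        ... | no _  | _     | no _  | _     = _ , e
        ... | no _  | _     | yes _ | no _  = _ , e

        exit-nothing : ∀ {a b} → exit′ a b ≡ nothing → exit S a b ≡ nothing × link a b ≢ link h k
        exit-nothing {a} {b} e = (case maybe-case (exit S a b) of λ
            { (inj₁ n) → n ; (inj₂ (_ , j)) → ⊥-elim (just≢nothing (proj₂ (exit-old j)) e) })
          , λ { refl → just≢nothing exit-forth e }

        after : State
        after = record
          { colour = colour′ ; object = object S ; exit = exit′
          ; body-colour = λ e v∈ → keep (λ ()) (body-colour S e v∈)
          ; root-colour = λ e → keep (λ ()) (root-colour S e)
          ; no-object = λ e c → no-object S e (kept (λ ()) c)
          ; exits⊆ = λ {a} {b} → exits⊆′ {a} {b} ; exits-indep = exits-indep′ ; exit-object = λ {a} {b} → exit-object′ {a} {b}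
          ; exit-adj = λ {a} {b} e → case exit-inv {a} {b} e of λ
              { (forth refl refl _) → h~k ; (back refl refl _) → subst T (Graph.symmetric H h k) h~k ; (old e) → exit-adj S e }
          ; exit-sym = λ {a} {b} e → case exit-inv {a} {b} e of λ
              { (forth refl refl _) → q′ , exit-back ; (back refl refl _) → q , exit-forth
              ; (old e) → exit-old (proj₂ (exit-sym S e)) }
          ; exit-inj = λ {a} e₁ e₂ → exit-inj′ {a} e₁ e₂ ; links = λ {a} {b} → links′ {a} {b}
          ; no-link = λ e c → let e′ , ne = exit-nothing e in no-link S e′ (kept ne c)
          ; link-ordered = link-ordered′
          ; size-obj = λ j → ≤-trans (#-mono (Class colour′ (obj j)) (Class (colour S) (obj j)) (kept (λ ()))) (size-obj S j)
          ; size-link = size-link′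
          ; dead-small = ≤-trans (2 * g ⊛ #-mono (∂ (Class colour′ free) ∅ (Class colour′ dead)) (∂ (Free S) ∅ (Dead S))
                (λ { (f , _ , inj₂ (u , d , a)) → kept (λ ()) f , (λ e → case trans (sym e) (kept (λ ()) f) of λ ()) ,
                                                  inj₂ (u , kept (λ ()) d , a) }))
              (≤-trans (dead-small S) (#-mono (Dead S) (Class colour′ dead) (keep (λ ())))) }
          where
          exits⊆′ : ∀ {a b v o} → object S a ≡ just o → exit′ a b ≡ just v → v ∈ Object.body o
          exits⊆′ {a} {b} e e₁ with exit-inv {a} {b} e₁
          ... | old e₂ = exits⊆ S e e₂
          ... | forth refl refl refl = subst (λ o → q ∈ Object.body o) (just-injective (trans (sym obj-h) e)) q∈
          ... | back refl refl refl  = subst (λ o → q′ ∈ Object.body o) (just-injective (trans (sym obj-k) e)) q′∈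
          exits-indep′ : ∀ {a o} → object S a ≡ just o → Indep 1 (Exits exit′ a) (Object.body o) (Neighbours (Object.root o))
          exits-indep′ {a} {o₁} e = by-cases (a ≟ h) (a ≟ k)
            where
            by-cases : Dec (a ≡ h) → Dec (a ≡ k) → Indep 1 (Exits exit′ a) (Object.body o₁) (Neighbours (Object.root o₁))
            by-cases (yes refl) (yes eq) = contradiction eq h≢k
            by-cases (yes refl) (no _) = subst (λ o → Indep 1 (Exits exit′ h) (Object.body o) (Neighbours (Object.root o)))
                  (just-injective (trans (sym obj-h) e))
                  (Indep-⊆ 1 (Exits (exit S) h ∪ ⁅ q ⁆) (Exits exit′ h) (Object.body o) (Neighbours (Object.root o))
                    (λ (b , e₁) → case exit-inv {a} {b} e₁ of λ
                    { (forth _ _ v≡q) → inj₂ v≡q ; (back eq _ _) → contradiction eq h≢k ; (old e₂) → inj₁ (b , e₂) }) indep)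
            by-cases (no _) (yes refl) = subst (λ o → Indep 1 (Exits exit′ k) (Object.body o) (Neighbours (Object.root o)))
                  (just-injective (trans (sym obj-k) e))
                  (Indep-⊆ 1 (Exits (exit S) k ∪ ⁅ q′ ⁆) (Exits exit′ k) (Object.body o′) (Neighbours (Object.root o′))
                    (λ (b , e₁) → case exit-inv {a} {b} e₁ of λ
                    { (forth eq _ _) → contradiction (sym eq) h≢k ; (back _ _ v≡q) → inj₂ v≡q ; (old e₂) → inj₁ (b , e₂) }) indep′)
            by-cases (no a≢h) (no a≢k) = Indep-⊆ 1 (Exits (exit S) a) (Exits exit′ a) (Object.body o₁) (Neighbours (Object.root o₁))
              (λ (b , e₁) → case exit-inv {a} {b} e₁ of λ
                    { (forth eq _ _) → contradiction eq a≢h ; (back eq _ _) → contradiction eq a≢k ; (old e₂) → b , e₂ }) (exits-indep S e)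
          exit-object′ : ∀ {a b v} → exit′ a b ≡ just v → ∃ λ o → object S a ≡ just o
          exit-object′ {a} {b} e with exit-inv {a} {b} e
          ... | old e₁ = exit-object S e₁
          ... | forth refl _ _ = _ , obj-h
          ... | back refl _ _  = _ , obj-k
          exit-inj′ : ∀ {a b c v} → exit′ a b ≡ just v → exit′ a c ≡ just v → b ≡ c
          exit-inj′ {a} {b} {c} e₁ e₂ with exit-inv {a} {b} e₁ | exit-inv {a} {c} e₂
          ... | forth _ refl _       | forth _ refl _       = refl
          ... | back _ refl _        | back _ refl _        = refl
          ... | old e₃               | old e₄               = exit-inj S e₃ e₄
          ... | forth refl _ _       | back eq _ _          = contradiction eq h≢k
          ... | back refl _ _        | forth eq _ _         = contradiction (sym eq) h≢k
          ... | forth refl refl refl | old e                = contradiction (_ , e) q∉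
          ... | old e                | forth refl refl refl = contradiction (_ , e) q∉
          ... | back refl refl refl  | old e                = contradiction (_ , e) q′∉
          ... | old e                | back refl refl refl  = contradiction (_ , e) q′∉
          links′ : ∀ {a b u v} → a Fin.< b → exit′ a b ≡ just u → exit′ b a ≡ just v → Link (λ x → colour′ x ≡ link a b) u v
          links′ {a} {b} a<b e₁ e₂ with exit-inv {a} {b} e₁ | exit-inv {b} {a} e₂
          ... | forth refl refl refl | back _ _ refl        = Link-mono coloured linkage
          ... | forth refl refl _    | forth eq _ _         = contradiction (sym eq) h≢k
          ... | forth refl refl _    | old e                = ⊥-elim (just≢nothing (proj₂ (exit-sym S e)) none)
          ... | back refl refl _     | _                    = contradiction a<b (<-asym h<k)
          ... | old e                | forth refl refl _    = contradiction a<b (<-asym h<k)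
          ... | old e                | back refl refl _     = ⊥-elim (just≢nothing e none)
          ... | old e₃               | old e₄               = Link-mono (keep (λ ())) (links S a<b e₃ e₄)
          link-ordered′ : ∀ {a b x} → colour′ x ≡ link a b → a Fin.< b
          link-ordered′ {x = x} c with dec W x
          link-ordered′ refl | yes _ = h<k
          ... | no _ = link-ordered S c
          size-link′ : ∀ a b → # (Class colour′ (link a b)) ≤ l
          size-link′ a b with link a b ≟ᶜ link h k
          ... | yes refl = ≤-trans (#-mono (Class colour′ (link h k)) W only) W≤
          ... | no ne    = ≤-trans (#-mono (Class colour′ (link a b)) (Class (colour S) (link a b)) (kept ne)) (size-link S a b)

        dead-same : # (Dead after) ≡ # (Dead S)
        dead-same = #-cong (Dead after) (Dead S) (kept (λ ())) (keep (λ ()))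

        exits-grow : sum (λ a → # (Used S a)) < sum (λ a → # (Used after a))
        exits-grow = sum-mono-< (λ a → # (Used S a)) (λ a → # (Used after a))
          (λ a → #-mono (Used S a) (Used after a) (still a)) h
          (≤-trans (≤-reflexive (sym (#-insert (Used S h) {k} (λ t → just≢nothing (proj₂ (is-just⇒ (exit S h k) t)) none))))
            (#-mono (Used S h ∪ ⁅ k ⁆) (Used after h) (λ { (inj₁ t) → still h t ; (inj₂ refl) → ⇒is-just exit-forth })))
          where
          still : ∀ a → Used S a ⊆ Used after a
          still a {b} t = ⇒is-just (proj₂ (exit-old (proj₂ (is-just⇒ (exit S a b) t))))

        larger : Σ State λ S′ → # (Dead S′) ≡ # (Dead S) × # (Objects S′) ≡ # (Objects S) ×
                                sum (λ a → # (Used S a)) < sum (λ a → # (Used S′ a))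
        larger = after , dead-same , refl , exits-grow

      -- The process and its termination.

      module Process (budget≤s : budget ≤ s) (expands : Expands g)
        (large : 3 + 2 * (4 * g * s + 2 * l + 2 * s) + 2 * g * (4 * g * s + 2 * l + 2 * s) + 2 * g + 4 * g * s ≤ n)
        (star : ∀ R → n ≤ # R + (2 * g * s + s) → ∃ λ x → x ∈ R × ∀ h → weight h * (1 + 4 * g) ≤ # (∂ R ∅ ⁅ x ⁆))
        (connection : ∀ R Q₁ Q₂ → n ≤ # R + (2 * g * s + s) → 1 ≤ # Q₁ → 1 ≤ # Q₂ →
          (∀ {v} → v ∈ Q₁ → v ∉ R) → (∀ {v} → v ∈ Q₂ → v ∉ R) → (∀ {v} → v ∈ Q₁ → v ∉ Q₂) →
          Connection g l Link R Q₁ Q₂) where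

        data Progress (S : State) : Set₁ where
          died    : ∀ S′ → Bounded S′ → # (Dead S) < # (Dead S′) → Progress S
          created : ∀ S′ → Bounded S′ → # (Dead S′) ≡ # (Dead S) → # (Objects S) < # (Objects S′) → Progress S
          joined  : ∀ S′ → Bounded S′ → # (Dead S′) ≡ # (Dead S) → # (Objects S′) ≡ # (Objects S) →
                    sum (λ a → # (Used S a)) < sum (λ a → # (Used S′ a)) → Progress S

        weight≤s : ∀ h → l * weight h ≤ s
        weight≤s h = ≤-trans (n≤1+n _) (≤-trans (term≤sum (λ h → 1 + l * weight h) h) (≤-trans (m≤m+n _ _) budget≤s))

        module _ (S : State) (bounded : Bounded S) where

          robust : n ≤ # (Free S) + (2 * g * s + s)
          robust = ≤-trans (used≤s budget≤s S) (≤-trans (≤-reflexive (+-assoc (# (Free S)) _ s))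
            (≤-refl {# (Free S)} ⊕ bounded ⊕ ≤-refl {s}))

          advanced : ∀ {z} → 1 ≤ z → (Σ State λ S′ → Bounded S′ × # (Dead S) + z ≤ # (Dead S′)) → Progress S
          advanced 1≤z (S′ , bounded′ , more) =
            died S′ bounded′ (≤-trans (≤-reflexive (+-comm 1 _)) (≤-trans (≤-refl {# (Dead S)} ⊕ 1≤z) more))

          -- No object is released here. The allowance `2 * l` serves the outcome `bury` of a
          -- connection, and `2 * s` serves a set no larger than a body.
          swallow : ∀ X → X ⊆ Free S → 1 ≤ # X → 2 * # X ≤ n + 2 * l + 2 * s → 2 * g * # (∂ (Free S) ∅ X) ≤ # X → Progress S
          swallow X X⊆ 1≤X X≤ ∂≤ = advanced 1≤X (Bury.burial budget≤s expands large S bounded ∅ X (inj₁ ∘ X⊆) X≤ total)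
            where
            Freed = Bury.Freed budget≤s expands large S bounded ∅ X (inj₁ ∘ X⊆)
            unreleased : ∀ c → ¬ Bury.Released budget≤s expands large S bounded ∅ X (inj₁ ∘ X⊆) c
            unreleased (link _ _) (inj₁ ())
            unreleased (link _ _) (inj₂ ())
            total : 2 * g * (# (∂ (Free S) ∅ X) + # Freed) ≤ # X
            total = ≤-trans (≤-reflexive (cong (2 * g *_) (trans (cong (# (∂ (Free S) ∅ X) +_)
              (#-empty Freed (λ {v} (r , _) → unreleased (colour S v) r))) (+-identityʳ _)))) ∂≤

          module _ {h k : Fin m} (h~k : h ~ᴴ k) (none : exit S h k ≡ nothing) {o} (obj-h : object S h ≡ just o) where
            private
              E = Exits (exit S) h
              u = # (Used S h)
              d = deg h

              E≤u : # E ≤ u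
              E≤u = ≤-trans (#-⋃ E (λ j → ⟪ (λ v → is? (exit S h j) v) ⟫) (λ (j , e) → j , e))
                (sum-mono (λ j → # ⟪ is? (exit S h j) ⟫) _ (λ j → each (exit S h j)))
                where
                is? : ∀ (x : Maybe V) v → Dec (x ≡ just v)
                is? nothing  v = no λ ()
                is? (just w) v with w ≟ v
                ... | yes refl = yes refl
                ... | no w≢v   = no λ { refl → w≢v refl }
                each : ∀ x → # ⟪ is? x ⟫ ≤ bit (T? (is-just x))
                each nothing  = ≤-reflexive (#-empty ⟪ is? nothing ⟫ λ ())
                each (just w) = #-subsingleton ⟪ is? (just w) ⟫ λ { refl refl → refl }

              u<d : suc u ≤ d
              u<d = ≤-trans (≤-reflexive (sym (#-insert (Used S h) {k} (λ t → just≢nothing (proj₂ (is-just⇒ (exit S h k) t)) none))))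
                (#-mono (Used S h ∪ ⁅ k ⁆) ⟪ (λ j → T? (adjᴴ h j)) ⟫ λ
                  { {j} (inj₁ t) → exit-adj S (proj₂ (is-just⇒ (exit S h j) t)) ; (inj₂ refl) → h~k })

            record Spare : Set₁ where
              field
                Q       : DecSet n
                Q⊆      : Q ⊆ Object.body o
                Q≥      : l * weight h ≤ # Q + l * # E
                extends : ∀ {w} → w ∈ Q → w ∉ E × Indep 1 (E ∪ ⁅ w ⁆) (Object.body o) (Neighbours (Object.root o))

              coloured : ∀ {v} → v ∈ Q → colour S v ≡ obj h
              coloured q = body-colour S obj-h (Q⊆ q)

              -- The edge under consideration has no exit at `h` yet, so fewer than `d` exits are in
              -- use and they spoil less than `l * d` of the `l * ((1 + 8 * g) * d)` vertices of the
              -- body.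
              Q-large : 8 * g * (l * d) ≤ # Q
              Q-large = linear l (Q≥ ⊕ l ⊛ E≤u ⊕ l ⊛ u<d) (arith g l d (l * # E) u (# Q))
                where
                arith : ∀ g l d e u q → 8 * g * (l * d) + (q + e + (l * u + l * d)) + l
                                      ≡ q + (l * ((1 + 8 * g) * d) + (e + l * suc u))
                arith = solve-∀

              1≤Q : 1 ≤ # Q
              1≤Q = ≤-trans (*-mono-≤ {1} {8 * g} (≤-trans 1≤g (m≤m+n g _)) (*-mono-≤ {1} {l} 1≤l (≤-trans (s≤s z≤n) u<d))) Q-large

            spare : Spare
            spare = record
              { Q = proj₁ found ; Q⊆ = proj₁ (proj₂ found)
              ; Q≥ = subst (_≤ # (proj₁ found) + l * # E) (Object.size o) (proj₁ (proj₂ (proj₂ found)))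
              ; extends = proj₂ (proj₂ (proj₂ found)) }
              where
              found = available l {E} {Object.body o} {Neighbours (Object.root o)} (Object.good o) (λ (j , e) → exits⊆ S obj-h e) (exits-indep S obj-h)

            open Spare spare

            -- The vertices released together with h number at most 2·l·deg h, a 1/(4g) fraction of #Q.
            kill : ∀ X → X ⊆ Free S → 2 * # X ≤ # (Free S) →
                   4 * g * # (∂ (Free S) ∅ (Q ∪ X)) ≤ # (Q ∪ X) + 4 * g * l → Progress S
            kill X X⊆ X≤ ∂≤ = advanced (≤-trans 1≤Q q≤z) (Bury.burial budget≤s expands large S bounded ⁅ h ⁆ Z Z-colour Z≤ total)
              where
              Z = Q ∪ X
              Z-colour : ∀ {v} → v ∈ Z → colour S v ≡ free ⊎ ∃ λ j → j ∈ ⁅ h ⁆ × colour S v ≡ obj j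
              Z-colour (inj₁ q) = inj₂ (h , refl , coloured q)
              Z-colour (inj₂ x) = inj₁ (X⊆ x)
              Freed = Bury.Freed budget≤s expands large S bounded ⁅ h ⁆ Z Z-colour
              q≤z : # Q ≤ # Z
              q≤z = #-mono Q Z inj₁
              O = Class (colour S) (obj h)
              Lⱼ : Fin m → DecSet n
              Lⱼ j = Class (colour S) (link h j) ∪ Class (colour S) (link j h)
              L : DecSet n
              L = ⟪ (λ v → any? (λ j → dec (Lⱼ j) v)) ⟫
              Z≤ : 2 * # Z ≤ n + 2 * l + 2 * s
              Z≤ = linear (2 * l) (2 ⊛ #-union Z Q X id ⊕ X≤ ⊕ #≤n (Free S) ⊕ 2 ⊛ #-mono Q (Object.body o) Q⊆
                     ⊕ 2 ⊛ ≤-trans (≤-reflexive (Object.size o)) (weight≤s h))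
                   (arith (# Z) (# Q) (# X) (# (Free S)) (# (Object.body o)) s l n)
                where
                arith : ∀ z q x f b s l n → 2 * z + (2 * (q + x) + (f + (n + (2 * b + 2 * s)))) + 2 * l
                  ≡ n + 2 * l + 2 * s + (2 * z + (2 * x + (f + (2 * q + 2 * b))))
                arith = solve-∀
              freed : Freed ⊆ (O ∖ Q) ∪ L
              freed {v} (r , v∉) = by-colour (colour S v) refl r
                where
                by-colour : ∀ c → colour S v ≡ c → Bury.Released budget≤s expands large S bounded ⁅ h ⁆ Z Z-colour c → v ∈ (O ∖ Q) ∪ L
                by-colour (obj j)    e refl        = inj₁ (e , v∉ ∘ inj₁)
                by-colour (link i j) e (inj₁ refl) = inj₂ (j , inj₁ e)
                by-colour (link i j) e (inj₂ refl) = inj₂ (i , inj₂ e)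
              size-Lⱼ : ∀ j → # (Lⱼ j) ≤ l
              size-Lⱼ j = by-order (h Fin.<? j)
                where
                by-order : Dec (h Fin.< j) → # (Lⱼ j) ≤ l
                by-order (yes h<j) = ≤-trans (#-mono (Lⱼ j) (Class (colour S) (link h j)) (λ
                  { (inj₁ e) → e ; (inj₂ e) → contradiction h<j (<-asym (link-ordered S e)) })) (size-link S h j)
                by-order (no h≮j) = ≤-trans (#-mono (Lⱼ j) (Class (colour S) (link j h)) (λ
                  { (inj₁ e) → contradiction (link-ordered S e) h≮j ; (inj₂ e) → e })) (size-link S j h)
              used : ∀ {j v} → v ∈ Lⱼ j → T (is-just (exit S h j))
              used {j} (inj₁ e) = case maybe-case (exit S h j) of λ
                { (inj₁ n) → contradiction e (no-link S n) ; (inj₂ (_ , y)) → ⇒is-just y }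
              used {j} (inj₂ e) = case maybe-case (exit S j h) of λ
                { (inj₁ n) → contradiction e (no-link S n) ; (inj₂ (_ , y)) → ⇒is-just (proj₂ (exit-sym S y)) }
              share : Fin m → ℕ
              share j = l * bit (T? (is-just (exit S h j)))
              each : ∀ j → # (Lⱼ j) ≤ share j
              each j = by-cases (any? (dec (Lⱼ j)))
                where
                by-cases : Dec (∃ λ v → v ∈ Lⱼ j) → # (Lⱼ j) ≤ share j
                by-cases (no ¬v) = ≤-trans (≤-reflexive (#-empty (Lⱼ j) (λ e → ¬v (_ , e)))) z≤n
                by-cases (yes (v , e)) = ≤-trans (size-Lⱼ j) (≤-trans (≤-reflexive (sym (*-identityʳ l)))
                  (*-monoʳ-≤ l (bit-yes (T? (is-just (exit S h j))) (used e))))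
              L≤ : # L ≤ l * u
              L≤ = ≤-trans (#-⋃ L Lⱼ id) (≤-trans (sum-mono (λ j → # (Lⱼ j)) share each)
                     (≤-reflexive (sym (*-distribˡ-sum l (λ j → bit (T? (is-just (exit S h j))))))))
              -- Outside `Q`, the root and the body have at most `1 + l * u` vertices, and the links
              -- at `h` at most `l * u`. As `u < d`, a full `l` is left over; multiplied by `4 * g`
              -- it cancels the slack `4 * g * l` in `∂≤`.
              few : # Freed + l ≤ 2 * (l * d)
              few = linear 0
                (#-union Freed (O ∖ Q) L freed
                  ⊕ ≤-trans (#-disjoint (O ∖ Q) Q O proj₁ coloured (λ (_ , ∉) q → ∉ q)) (size-obj S h)
                  ⊕ Q≥ ⊕ l ⊛ E≤u ⊕ L≤ ⊕ 1≤l ⊕ 2 ⊛ l ⊛ u<d)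
                (arith (# Freed) l (# (O ∖ Q)) (# L) (# Q) (l * weight h) (l * # E) (l * u) (l * d) (l * suc u) (*-suc l u))
                where
                arith : ∀ f l p L q w e u d u′ → u′ ≡ l + u →
                  f + l + ((p + L) + ((1 + w) + ((q + e) + (u + (u + (l + 2 * d)))))) + 0
                  ≡ 2 * d + (f + ((p + q) + (w + (e + (L + (1 + 2 * u′))))))
                arith f l p L q w e u d _ refl = lemma f l p L q w e u d
                  where
                  lemma : ∀ f l p L q w e u d →
                    f + l + ((p + L) + ((1 + w) + ((q + e) + (u + (u + (l + 2 * d)))))) + 0
                    ≡ 2 * d + (f + ((p + q) + (w + (e + (L + (1 + 2 * (l + u)))))))
                  lemma = solve-∀
              total : 2 * g * (# (∂ (Free S) ∅ Z) + # Freed) ≤ # Z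
              total = *-cancelˡ-≤ 2 (linear 0 (∂≤ ⊕ 4 * g ⊛ few ⊕ Q-large ⊕ q≤z)
                (arith g (l * d) (# Freed) l (# (∂ (Free S) ∅ Z)) (# Z) (# Q)))
                where
                arith : ∀ g x f l b z q →
                  2 * (2 * g * (b + f)) + ((z + 4 * g * l) + (4 * g * (2 * x) + (q + z))) + 0
                  ≡ 2 * z + (4 * g * b + (4 * g * (f + l) + (8 * g * x + q)))
                arith = solve-∀

          create : ∀ {h} → object S h ≡ nothing → Progress S
          create {h} none = let x , x∈ , degree = star (Free S) robust in
            by-growth x∈ (grow (4 * g) l (weight h) 1≤l {Free S} {x} x∈ (degree h))
            where
            by-growth : ∀ {x} → x ∈ Free S → (Σ (Object l (weight h)) λ O → Object.root O ≡ x × Object.body O ⊆ Free S) ⊎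
              (Σ (DecSet n) λ Y → Y ⊆ Free S × # Y ≤ l * weight h × 1 ≤ # Y × 4 * g * # (∂ (Free S) ∅ Y) ≤ # Y) → Progress S
            by-growth x∈ (inj₁ (O , refl , body⊆)) =
              let S′ , same , more = AddObject.larger S h none O x∈ body⊆ in
              created S′ (subst (_≤ 2 * g * s) (sym same) bounded) same more
            by-growth x∈ (inj₂ (Y , Y⊆ , Y≤ , 1≤Y , ∂≤)) = swallow Y Y⊆ 1≤Y
              (≤-trans (2 ⊛ ≤-trans Y≤ (weight≤s h)) (m≤n+m (2 * s) (n + 2 * l)))
              (≤-trans (*-monoˡ-≤ (# (∂ (Free S) ∅ Y)) (*-monoˡ-≤ g (m≤m+n 2 2))) ∂≤)

          join : ∀ {h k} → h Fin.< k → h ~ᴴ k → exit S h k ≡ nothing →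
                 (∃ λ o → object S h ≡ just o) → (∃ λ o → object S k ≡ just o) → Progress S
          join {h} {k} h<k h~k none (o , obj-h) (o′ , obj-k) =
            by-outcome (connection (Free S) P.Q P′.Q robust P.1≤Q P′.1≤Q
              (λ q f → case trans (sym (P.coloured q)) f of λ ()) (λ q f → case trans (sym (P′.coloured q)) f of λ ())
              (λ q q′ → case trans (sym (P.coloured q)) (P′.coloured q′) of λ { refl → <-irrefl refl h<k }))
            where
            k~h = subst T (Graph.symmetric H h k) h~k
            none′ : exit S k h ≡ nothing
            none′ = case maybe-case (exit S k h) of λ
              { (inj₁ n) → n ; (inj₂ (_ , y)) → ⊥-elim (just≢nothing (proj₂ (exit-sym S y)) none) }
            module P = Spare (spare h~k none obj-h)
            module P′ = Spare (spare k~h none′ obj-k)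
            by-outcome : Connection g l Link (Free S) P.Q P′.Q → Progress S
            by-outcome (bury X X⊆ 1≤X X≤ ∂≤) =
              swallow X X⊆ 1≤X (≤-trans X≤ (≤-trans (#≤n (Free S) ⊕ ≤-refl {2 * l}) (m≤m+n (n + 2 * l) (2 * s)))) ∂≤
            by-outcome (bury₁ X X⊆ X≤ ∂≤) = kill h~k none obj-h X X⊆ X≤ ∂≤
            by-outcome (bury₂ X X⊆ X≤ ∂≤) = kill k~h none′ obj-k X X⊆ X≤ ∂≤
            by-outcome (linked q∈ q′∈ W W⊆ W≤ linkage) =
              let S′ , same , same′ , more = AddLink.larger S h<k h~k none obj-h obj-k (P.Q⊆ q∈) (P′.Q⊆ q′∈)
                    (proj₁ (P.extends q∈)) (proj₁ (P′.extends q′∈)) (proj₂ (P.extends q∈)) (proj₂ (P′.extends q′∈)) W W⊆ W≤ linkage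
              in joined S′ (subst (_≤ 2 * g * s) (sym same) bounded) same same′ more

          advance : Complete S ⊎ Progress S
          advance = by-object (any? (λ h → ¬? (T? (is-just (object S h)))))
            where
            Missing : Fin m → Fin m → Set
            Missing h k = h Fin.< k × h ~ᴴ k × ¬ T (is-just (exit S h k))
            by-exit : (∀ h → ∃ λ o → object S h ≡ just o) → Dec (∃ λ h → ∃ λ k → Missing h k) → Complete S ⊎ Progress S
            by-exit objects (yes (h , k , h<k , h~k , ¬j)) = inj₂ (case maybe-case (exit S h k) of λ
              { (inj₁ none) → join h<k h~k none (objects h) (objects k) ; (inj₂ (_ , e)) → contradiction (⇒is-just e) ¬j })
            by-exit objects (no done) = inj₁ (objects , exits)
              where
              ordered : ∀ {h k} → h Fin.< k → h ~ᴴ k → ∃ λ v → exit S h k ≡ just v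
              ordered {h} {k} h<k h~k = case maybe-case (exit S h k) of λ
                { (inj₁ none) → contradiction (h , k , h<k , h~k , λ t → just≢nothing (proj₂ (is-just⇒ (exit S h k) t)) none) done
                ; (inj₂ e) → e }
              exits : ∀ h k → h ~ᴴ k → ∃ λ v → exit S h k ≡ just v
              exits h k h~k = case Fin.<-cmp h k of λ
                { (tri< h<k _ _) → ordered h<k h~k
                ; (tri> _ _ k<h) → exit-sym S (proj₂ (ordered k<h (subst T (Graph.symmetric H h k) h~k)))
                ; (tri≈ _ refl _) → ⊥-elim (subst T (Graph.loopless H h) h~k) }
            by-object : Dec (∃ λ h → ¬ T (is-just (object S h))) → Complete S ⊎ Progress S
            by-object (yes (h , ¬j)) = inj₂ (case maybe-case (object S h) of λ
              { (inj₁ none) → create none ; (inj₂ (_ , e)) → contradiction (⇒is-just e) ¬j })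
            by-object (no all) = by-exit objects (any? (λ h → any? (λ k → (h Fin.<? k) ×-dec T? (adjᴴ h k) ×-dec ¬? (T? (is-just (exit S h k))))))
              where
              objects : ∀ h → ∃ λ o → object S h ≡ just o
              objects h = case maybe-case (object S h) of λ
                { (inj₁ none) → contradiction (h , λ t → just≢nothing (proj₂ (is-just⇒ (object S h) t)) none) all ; (inj₂ e) → e }

        -- The fuels bound the room left in the three coordinates of the lexicographic order;
        -- progress in one coordinate refills the later ones to `m` and `m * m`.
        run : ∀ fd fo fe S → Bounded S → n ≤ # (Dead S) + fd → m ≤ # (Objects S) + fo →
              m * m ≤ sum (λ a → # (Used S a)) + fe → Complete S ⊎ Progress S → Σ State Complete
        run fd fo fe S bounded d≤ o≤ e≤ (inj₁ complete) = S , complete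
        run (suc fd) fo fe S bounded d≤ o≤ e≤ (inj₂ (died S′ b′ d<)) =
          run fd m (m * m) S′ b′ (≤-trans d≤ (≤-trans (≤-reflexive (+-suc (# (Dead S)) fd)) (+-monoˡ-≤ fd d<)))
            (m≤n+m m (# (Objects S′))) (m≤n+m (m * m) (sum (λ a → # (Used S′ a)))) (advance S′ b′)
        run zero fo fe S bounded d≤ o≤ e≤ (inj₂ (died S′ b′ d<)) =
          contradiction (≤-trans (#≤n (Dead S′)) (≤-trans d≤ (≤-reflexive (+-identityʳ (# (Dead S)))))) (<⇒≱ d<)
        run fd (suc fo) fe S bounded d≤ o≤ e≤ (inj₂ (created S′ b′ d≡ o<)) =
          run fd fo (m * m) S′ b′ (subst (λ d → n ≤ d + fd) (sym d≡) d≤)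
            (≤-trans o≤ (≤-trans (≤-reflexive (+-suc (# (Objects S)) fo)) (+-monoˡ-≤ fo o<)))
            (m≤n+m (m * m) (sum (λ a → # (Used S′ a)))) (advance S′ b′)
        run fd zero fe S bounded d≤ o≤ e≤ (inj₂ (created S′ b′ d≡ o<)) =
          contradiction (≤-trans (#≤n (Objects S′)) (≤-trans o≤ (≤-reflexive (+-identityʳ (# (Objects S)))))) (<⇒≱ o<)
        run fd fo (suc fe) S bounded d≤ o≤ e≤ (inj₂ (joined S′ b′ d≡ o≡ e<)) =
          run fd fo fe S′ b′ (subst (λ d → n ≤ d + fd) (sym d≡) d≤) (subst (λ o → m ≤ o + fo) (sym o≡) o≤)
            (≤-trans e≤ (≤-trans (≤-reflexive (+-suc (sum (λ a → # (Used S a))) fe)) (+-monoˡ-≤ fe e<))) (advance S′ b′)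
        run fd fo zero S bounded d≤ o≤ e≤ (inj₂ (joined S′ b′ d≡ o≡ e<)) =
          contradiction (≤-trans (≤-trans (sum-mono (λ a → # (Used S′ a)) (λ _ → m) (λ a → #≤n (Used S′ a))) (≤-reflexive (sum-const m m)))
            (≤-trans e≤ (≤-reflexive (+-identityʳ (sum (λ a → # (Used S a))))))) (<⇒≱ e<)

        initial : State
        initial = record
          { colour = λ _ → free ; object = λ _ → nothing ; exit = λ _ _ → nothing
          ; body-colour = λ () ; root-colour = λ () ; no-object = λ _ () ; exits⊆ = λ () ; exits-indep = λ ()
          ; exit-object = λ () ; exit-adj = λ () ; exit-sym = λ () ; exit-inj = λ () ; links = λ _ ()
          ; no-link = λ _ () ; link-ordered = λ ()
          ; size-obj = λ h → ≤-trans (≤-reflexive (#-empty (Class (λ _ → free) (obj h)) λ ())) z≤n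
          ; size-link = λ h k → ≤-trans (≤-reflexive (#-empty (Class (λ _ → free) (link h k)) λ ())) z≤n
          ; dead-small = ≤-trans (≤-reflexive (trans (cong (2 * g *_) (#-empty (∂ (Class (λ _ → free) free) ∅ (Class (λ _ → free) dead))
              λ { (_ , _ , inj₂ (_ , () , _)) })) (*-zeroʳ (2 * g)))) z≤n }

        completion : Σ State Complete
        completion = run n m (m * m) initial bounded
          (m≤n+m n (# (Dead initial))) (m≤n+m m (# (Objects initial))) (m≤n+m (m * m) (sum (λ a → # (Used initial a))))
          (advance initial bounded)
          where
          bounded : Bounded initial
          bounded = ≤-trans (≤-reflexive (#-empty (Dead initial) λ ())) z≤n

-- Subsets, induced subgraphs and edge lists in terms of decidable sets.

module Representation where
  open ℕ-Arithmetic
  open Combinatorics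

  card-tabulate : ∀ {n} (X : DecSet n) → card (Vec.tabulate (λ v → does (dec X v))) ≡ # X
  card-tabulate {zero}  X = refl
  card-tabulate {suc n} X with dec X zero
  ... | yes _ = cong suc (card-tabulate ⟪ (λ v → dec X (suc v)) ⟫)
  ... | no _  = card-tabulate ⟪ (λ v → dec X (suc v)) ⟫

  card-fromSubset : ∀ {n} (U : Subset n) → card U ≡ # (fromSubset U)
  card-fromSubset []            = refl
  card-fromSubset (true  ∷ U) = cong suc (card-fromSubset U)
  card-fromSubset (false ∷ U) = card-fromSubset U

  ∈ˢ⇒∈ : ∀ {n} (U : Subset n) {v} → v ∈ˢ U → v ∈ fromSubset U
  ∈ˢ⇒∈ U v∈ = subst T (sym (Vec.[]=⇒lookup v∈)) tt

  ∈⇒∈ˢ : ∀ {n} (U : Subset n) {v} → v ∈ fromSubset U → v ∈ˢ U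
  ∈⇒∈ˢ U {v} t = Vec.lookup⇒[]= v U (true! (Vec.lookup U v) t)
    where
    true! : ∀ b → T b → b ≡ true
    true! true _ = refl

  #-element : ∀ {n} (U : Subset n) (X : DecSet n) → # ⟪ dec X ∘ element U ⟫ ≡ # (fromSubset U ∩ X)
  #-element []            X = refl
  #-element (true  ∷ U) X with dec X zero
  ... | yes _ = cong suc (#-element U ⟪ dec X ∘ suc ⟫)
  ... | no _  = #-element U ⟪ dec X ∘ suc ⟫
  #-element (false ∷ U) X = #-element U ⟪ dec X ∘ suc ⟫

  element∈ : ∀ {n} (U : Subset n) i → element U i ∈ fromSubset U
  element∈ (true  ∷ U) zero    = tt
  element∈ (true  ∷ U) (suc i) = element∈ U i
  element∈ (false ∷ U) i       = element∈ U i

  element-injective : ∀ {n} (U : Subset n) {i j} → element U i ≡ element U j → i ≡ j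
  element-injective (true  ∷ U) {zero}  {zero}  _ = refl
  element-injective (true  ∷ U) {suc i} {suc j} e = cong suc (element-injective U (Fin.suc-injective e))
  element-injective (false ∷ U)                 e = element-injective U (Fin.suc-injective e)

  element-surjective : ∀ {n} (U : Subset n) {v} → v ∈ fromSubset U → ∃ λ i → element U i ≡ v
  element-surjective (true  ∷ U) {zero}  _ = zero , refl
  element-surjective (true  ∷ U) {suc v} t = let i , e = element-surjective U t in suc i , cong suc e
  element-surjective (false ∷ U) {suc v} t = let i , e = element-surjective U t in i , cong suc e

  module _ {n} (G : Graph n) where
    open Graph G using (adj; _~_)

    card-boundary : ∀ (U : Subset n) → card (Graph.boundary G U) ≡ # (∂ G (full n) ∅ (fromSubset U))
    card-boundary U = trans (card-tabulate B) (#-cong B (∂ G (full n) ∅ (fromSubset U))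
      (λ (∉ , u , u∈ , a) → tt , ∉ ∘ ∈⇒∈ˢ U , inj₂ (u , ∈ˢ⇒∈ U u∈ , ~-sym G a))
      (λ { (_ , ∉ , inj₂ (u , u∈ , a)) → ∉ ∘ ∈ˢ⇒∈ U , u , ∈⇒∈ˢ U u∈ , ~-sym G a }))
      where
      B : DecSet n
      B = ⟪ (λ v → ¬? (v ∈? U) ×-dec any? (λ u → (u ∈? U) ×-dec T? (adj v u))) ⟫

    T-does : ∀ b → does (T? b) ≡ b
    T-does true  = refl
    T-does false = refl

    degree-# : ∀ v → Graph.degree G v ≡ # (Neighbours G v)
    degree-# v = trans (cong card (Vec.tabulate-cong (λ u → sym (T-does (adj v u))))) (card-tabulate (Neighbours G v))

    degree≤Δ : ∀ v → # (Neighbours G v) ≤ Δ G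
    degree≤Δ v = subst (_≤ Δ G) (degree-# v)
      (All.lookup (xs≤max 0 (map (Graph.degree G) (allFin n))) (L.∈-map⁺ (Graph.degree G) (L.∈-allFin v)))

    Δ-attained : Δ G ≡ 0 ⊎ (∃ λ v → Δ G ≡ # (Neighbours G v))
    Δ-attained with argmax-sel id 0 (map (Graph.degree G) (allFin n))
    ... | inj₁ e = inj₁ e
    ... | inj₂ m with L.∈-map⁻ (Graph.degree G) m
    ...   | v , _ , e = inj₂ (v , trans e (degree-# v))

  module _ {n} (G : Graph n) (U : Subset n) where
    open Graph G using (adj; _~_; loopless)

    private
      R = fromSubset U

    largeDegree : 1 ≤ card U → ∃ λ x → x ∈ R × Δ (G [ U ]) ≤ # (∂ G R ∅ ⁅ x ⁆)
    largeDegree 1≤U with Δ-attained (G [ U ])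
    ... | inj₁ e = let x , x∈ = nonempty R (subst (1 ≤_) (card-fromSubset U) 1≤U) in
                   x , x∈ , ≤-trans (≤-reflexive e) z≤n
    ... | inj₂ (i , e) = x , element∈ U i , (begin
      Δ (G [ U ])                      ≡⟨ e ⟩
      # (Neighbours (G [ U ]) i)       ≡⟨ #-element U (Neighbours G x) ⟩
      # (R ∩ Neighbours G x)           ≤⟨ #-mono (R ∩ Neighbours G x) (∂ G R ∅ ⁅ x ⁆) (λ (v∈ , a) →
                                           v∈ , (λ { refl → subst T (loopless x) a }) , inj₂ (x , refl , a)) ⟩
      # (∂ G R ∅ ⁅ x ⁆)                ∎)
      where
      open ≤-Reasoning
      x = element U i

    lift : Subset (card U) → DecSet n
    lift W = ⟪ (λ v → any? (λ i → (element U i ≟ v) ×-dec dec (fromSubset W) i)) ⟫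

    lift⊆ : ∀ W → lift W ⊆ R
    lift⊆ W (i , refl , _) = element∈ U i

    #-induced : ∀ (A : DecSet (card U)) (B : DecSet n) → B ⊆ R → (∀ {i} → i ∈ A → element U i ∈ B) →
                (∀ {i} → element U i ∈ B → i ∈ A) → # A ≡ # B
    #-induced A B B⊆ f h = trans (#-cong A ⟪ dec B ∘ element U ⟫ f h)
      (trans (#-element U B) (#-cong (R ∩ B) B proj₂ (λ b → B⊆ b , b)))

    lift∈ : ∀ W {i} → element U i ∈ lift W → i ∈ fromSubset W
    lift∈ W (j , e , j∈) = subst (_∈ fromSubset W) (element-injective U e) j∈

    #-lift : ∀ W → card W ≡ # (lift W)
    #-lift W = trans (card-fromSubset W)
      (#-induced (fromSubset W) (lift W) (lift⊆ W) (λ {i} i∈ → i , refl , i∈) (λ {i} → lift∈ W {i}))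

    induced-boundary : ∀ W → card (Graph.boundary (G [ U ]) W) ≡ # (∂ G R ∅ (lift W))
    induced-boundary W = trans (card-boundary (G [ U ]) W)
      (#-induced (∂ (G [ U ]) (full (card U)) ∅ (fromSubset W)) (∂ G R ∅ (lift W)) proj₁
        (λ { {i} (_ , i∉ , inj₂ (j , j∈ , a)) → element∈ U i , (λ l → i∉ (lift∈ W l)) , inj₂ (element U j , (j , refl , j∈) , a) })
        (λ { {i} (_ , i∉ , inj₂ (_ , (j , refl , j∈) , a)) → tt , (λ i∈ → i∉ (i , refl , i∈)) , inj₂ (j , j∈ , a) }))

    Chain-tabulate : ∀ {k z} (f : Fin (suc k) → Fin n) → (∀ i → f (Fin.inject₁ i) ~ f (suc i)) → f (Fin.fromℕ k) ~ z →
                     Chain G (f zero) (tabulate (f ∘ suc)) z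
    Chain-tabulate {zero}  f adjacent closing = edge closing
    Chain-tabulate {suc k} f adjacent closing = adjacent zero ∷ Chain-tabulate (f ∘ suc) (adjacent ∘ suc) closing

    toOddCycle : (C : Cycle (G [ U ])) → parity (Cycle.length C) ≡ 1ℙ →
      Σ (OddCycle G (_∈ R)) λ D → length (OddCycle.vertices D) ≡ Cycle.length C
    toOddCycle C odd = record
      { head = f zero ; rest = tabulate (f ∘ suc)
      ; chain = Chain-tabulate f adjacent (subst₂ (λ u v → element U u ~ element U v) (sym end) (sym start) closing)
      ; inside = λ m → case L.∈-tabulate⁻ {f = f} m of λ { (i , refl) → element∈ U (vertex i) }
      ; unique = Unique.tabulate⁺ {f = f} (λ e → injective (element-injective U e))
      ; odd = trans (cong parity size) odd } , size
      where
      open Cycle C using (closing)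
      open Path (Cycle.path C) renaming (length to len)
      f : Fin (suc len) → Fin n
      f = element U ∘ vertex
      size : length (f zero ∷ tabulate (f ∘ suc)) ≡ Cycle.length C
      size = cong suc (length-tabulate (f ∘ suc))

  length-filter-tabulate : ∀ {k} {A : Set} {P : A → Set} (P? : ∀ x → Dec (P x)) (f : Fin k → A) →
    length (filter P? (tabulate f)) ≡ sum (λ i → bit (P? (f i)))
  length-filter-tabulate {zero}  P? f = refl
  length-filter-tabulate {suc k} P? f with P? (f zero)
  ... | yes _ = cong suc (length-filter-tabulate P? (f ∘ suc))
  ... | no _  = length-filter-tabulate P? (f ∘ suc)

  length-filter-product : ∀ {j k} {A B : Set} {P : A × B → Set} (P? : ∀ x → Dec (P x)) (f : Fin j → A) (h : Fin k → B) →
    length (filter P? (cartesianProduct (tabulate f) (tabulate h))) ≡ sum (λ a → sum (λ b → bit (P? (f a , h b))))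
  length-filter-product {zero}  P? f h = refl
  length-filter-product {suc j} P? f h = begin
    length (filter P? (map (f zero ,_) (tabulate h) ++ rest))                  ≡⟨ cong length (filter-++ P? (map (f zero ,_) (tabulate h)) rest) ⟩
    length (filter P? (map (f zero ,_) (tabulate h)) ++ filter P? rest)        ≡⟨ length-++ (filter P? (map (f zero ,_) (tabulate h))) ⟩
    length (filter P? (map (f zero ,_) (tabulate h))) + length (filter P? rest)
      ≡⟨ cong₂ _+_ (trans (cong (length ∘ filter P?) (map-tabulate h (f zero ,_))) (length-filter-tabulate P? (λ b → f zero , h b)))
                   (length-filter-product P? (f ∘ suc) h) ⟩
    sum (λ b → bit (P? (f zero , h b))) + sum (λ a → sum (λ b → bit (P? (f (suc a) , h b)))) ∎
    where
    open ≡-Reasoning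
    rest = cartesianProduct (tabulate (f ∘ suc)) (tabulate h)

  module _ {m} (H : Graph m) where
    open Graph H using (adj; _~_; symmetric; loopless)

    private
      edge? : ∀ h k → Dec (h Fin.< k × h ~ k)
      edge? h k = (h Fin.<? k) ×-dec T? (adj h k)

    #edges : length (edges H) ≡ sum (λ h → sum (λ k → bit (edge? h k)))
    #edges = length-filter-product (λ (h , k) → edge? h k) id id

    -- An adjacent pair is listed as an edge in one of its two orders, so the adjacency indicator is
    -- at most the edge indicator plus its transpose.
    handshake : sum (λ h → # (Neighbours H h)) ≤ 2 * length (edges H)
    handshake = begin
      sum (λ h → sum (λ k → bit (T? (adj h k))))
        ≤⟨ sum-mono (λ h → sum (λ k → bit (T? (adj h k)))) _ (λ h → sum-mono (λ k → bit (T? (adj h k))) _ (λ k → split h k)) ⟩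
      sum (λ h → sum (λ k → bit (edge? h k) + bit (edge? k h)))
        ≡⟨ sum-cong-≗ (λ h → ∑-distrib-+ (λ k → bit (edge? h k)) (λ k → bit (edge? k h))) ⟩
      sum (λ h → sum (λ k → bit (edge? h k)) + sum (λ k → bit (edge? k h)))
        ≡⟨ ∑-distrib-+ (λ h → sum (λ k → bit (edge? h k))) (λ h → sum (λ k → bit (edge? k h))) ⟩
      sum (λ h → sum (λ k → bit (edge? h k))) + sum (λ h → sum (λ k → bit (edge? k h)))
        ≡⟨ cong (sum (λ h → sum (λ k → bit (edge? h k))) +_) (∑-comm (λ h k → bit (edge? k h))) ⟩
      sum (λ h → sum (λ k → bit (edge? h k))) + sum (λ k → sum (λ h → bit (edge? k h)))
        ≡⟨ cong₂ _+_ (sym #edges) (trans (sym #edges) (sym (+-identityʳ _))) ⟩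
      2 * length (edges H) ∎
      where
      open ≤-Reasoning
      split : ∀ h k → bit (T? (adj h k)) ≤ bit (edge? h k) + bit (edge? k h)
      split h k = by-cases (T? (adj h k))
        where
        by-cases : (d : Dec (h ~ k)) → bit d ≤ bit (edge? h k) + bit (edge? k h)
        by-cases (no _)  = z≤n
        by-cases (yes a) = case Fin.<-cmp h k of λ
          { (tri< h<k _ _) → ≤-trans (bit-yes (edge? h k) (h<k , a)) (m≤m+n _ _)
          ; (tri> _ _ k<h) → ≤-trans (bit-yes (edge? k h) (k<h , subst T (symmetric h k) a)) (m≤n+m _ _)
          ; (tri≈ _ refl _) → contradiction (subst T (loopless h) a) λ () }

-- The embedding theorem over the natural numbers.

module IntegerCore {n m} (G : Graph n) (H : Graph m) where
  open ℕ-Arithmetic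
  open Combinatorics hiding (module Pattern)
  open Representation
  open Combinatorics.Pattern hiding (deg)

  module Core (g Λ c : ℕ) (1≤g : 1 ≤ g) (n<2^Λ : n < 2 ^ Λ) where

    -- The length bound for links, and the number of vertices used by all objects and links.
    l s : ℕ
    l = c + 4 * (4 * g * Λ) + 2
    s = (m + length (edges H)) * (l * (3 + 16 * g))

    1≤l : 1 ≤ l
    1≤l = ≤-trans (s≤s z≤n) (m≤n+m 2 (c + 4 * (4 * g * Λ)))

    private
      deg weight : Fin m → ℕ
      deg = Combinatorics.Pattern.deg G H
      weight = Weights.weight G H g l

      budget≤s : Weights.budget G H g l ≤ s
      budget≤s = begin
        Weights.budget G H g l
          -- By `handshake` each edge pays `l * (1 + 8 * g)` twice for the bodies at its ends, and
          -- `l` for its link: together `l * (3 + 16 * g)`.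
          ≤⟨ ≤-trans (≤-reflexive objects) (+-monoʳ-≤ m (l ⊛ (1 + 8 * g) ⊛ handshake H)) ⊕ ≤-reflexive links ⟩
        m + l * ((1 + 8 * g) * (2 * length (edges H))) + l * length (edges H)
          ≤⟨ linear (m * l * (2 + 16 * g)) (m ⊛ 1≤l) (arith m l g (length (edges H))) ⟩
        s ∎
        where
        open ≤-Reasoning
        arith : ∀ m l g e → m + l * ((1 + 8 * g) * (2 * e)) + l * e + m * l + m * l * (2 + 16 * g)
                          ≡ (m + e) * (l * (3 + 16 * g)) + m * 1
        arith = solve-∀
        objects : sum (λ h → 1 + l * weight h) ≡ m + l * ((1 + 8 * g) * sum deg)
        objects = trans (∑-distrib-+ (λ _ → 1) (λ h → l * weight h)) (cong₂ _+_
          (trans (sum-const m 1) (*-identityʳ m))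
          (sym (trans (cong (l *_) (*-distribˡ-sum (1 + 8 * g) deg)) (*-distribˡ-sum l weight))))
        links : sum (λ h → sum (λ k → l * bit ((h Fin.<? k) ×-dec T? (Graph.adj H h k)))) ≡ l * length (edges H)
        links = sym (trans (cong (l *_) (#edges H)) (trans
          (*-distribˡ-sum l (λ h → sum (λ k → bit ((h Fin.<? k) ×-dec T? (Graph.adj H h k)))))
          (sum-cong-≗ (λ h → *-distribˡ-sum l (λ k → bit ((h Fin.<? k) ×-dec T? (Graph.adj H h k)))))))

    module _ (expands : Expands G g)
      (large : 3 + 2 * (4 * g * s + 2 * l + 2 * s) + 2 * g * (4 * g * s + 2 * l + 2 * s) + 2 * g + 4 * g * s ≤ n)
      (star : ∀ R → n ≤ # R + (2 * g * s + s) → ∃ λ x → x ∈ R × 61 * (g * g * Δ H) ≤ # (∂ G R ∅ ⁅ x ⁆)) where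

      private
        star′ : ∀ R → n ≤ # R + (2 * g * s + s) →
                ∃ λ x → x ∈ R × ∀ h → (1 + 8 * g) * deg h * (1 + 4 * g) ≤ # (∂ G R ∅ ⁅ x ⁆)
        star′ R n≤ = let x , x∈ , d = star R n≤ in x , x∈ , λ h → ≤-trans (enough h) d
          where
          -- The product `(1 + 8 * g) * (1 + 4 * g)` is at most `45 * (g * g)`. The larger `61` is
          -- what robustness provides, as `9 * 61 ≤ 550`.
          enough : ∀ h → (1 + 8 * g) * deg h * (1 + 4 * g) ≤ 61 * (g * g * Δ H)
          enough h = ≤-trans (linear (16 * (g * g * deg h))
            (deg h ⊛ *-mono-≤ 1≤g 1≤g ⊕ 12 * deg h ⊛ g ⊛ 1≤g) (arith g (deg h)))
            (61 ⊛ g * g ⊛ degree≤Δ H h)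
            where
            arith : ∀ g d → (1 + 8 * g) * d * (1 + 4 * g) + (d * (g * g) + 12 * d * (g * g)) + 16 * (g * g * d)
                          ≡ 61 * (g * g * d) + (d * (1 * 1) + 12 * d * (g * 1))
            arith = solve-∀

      plainMinor : TopologicalMinor H G
      plainMinor = Engine.Assembly.arbitrary G H g l s 1≤g 1≤l (InnerPath G) (InnerPath-mono G) (proj₁ final) (proj₂ final) id
        where
        arith : ∀ c x → 2 * x + 0 + (c + 2 * x + 2) ≡ c + 4 * x + 2 + 0
        arith = solve-∀
        final = Engine.Process.completion G H g l s 1≤g 1≤l (InnerPath G) (InnerPath-mono G) budget≤s expands large star′
          (λ R Q₁ Q₂ _ 1≤Q₁ 1≤Q₂ _ _ _ → connect G g l Λ 1≤g n<2^Λ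
            (linear (c + 2 * (4 * g * Λ) + 2) z≤n (arith c (4 * g * Λ))) R Q₁ Q₂ 1≤Q₁ 1≤Q₂)

      parityMinor : (∀ R → n ≤ # R + (2 * g * s + s) →
          (∀ W → W ⊆ R → 2 * # W ≤ # R → # W ≤ 3 * g * # (∂ G R ∅ W)) →
          Σ (OddCycle G (_∈ R)) λ cyc → 1 + 6 * g ≤ length (OddCycle.vertices cyc) × length (OddCycle.vertices cyc) ≤ c) →
        ∀ (π : Edge H → Parity) → ∃ λ (M : TopologicalMinor H G) →
          ∀ e → parity (Path.length (TopologicalMinor.path M e)) ≡ π e
      parityMinor oddCycle =
        Engine.Assembly.prescribed G H g l s 1≤g 1≤l (ParityLink G) (ParityLink-mono G) (proj₁ final) (proj₂ final) id
        where
        final = Engine.Process.completion G H g l s 1≤g 1≤l (ParityLink G) (ParityLink-mono G) budget≤s expands large star′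
          (λ R Q₁ Q₂ n≤ 1≤Q₁ 1≤Q₂ d₁ d₂ d₃ →
            connectOdd G g l Λ c 1≤g n<2^Λ ≤-refl R Q₁ Q₂ 1≤Q₁ 1≤Q₂ d₁ d₂ d₃ (oddCycle R n≤))

-- Numerical estimates behind the choice of `ε`.

module Constants where
  open ℕ-Arithmetic

  binaryLog : ∀ n → 1 ≤ n → ∃ λ q → 2 ^ q ≤ n × n < 2 ^ suc q
  binaryLog (suc zero)    _ = 0 , s≤s z≤n , s≤s (s≤s z≤n)
  binaryLog (suc (suc n)) _ with binaryLog (suc n) (s≤s z≤n)
  ... | q , lo , hi with suc (suc n) <? 2 ^ suc q
  ...   | yes p = q , m≤n⇒m≤1+n lo , p
  ...   | no ¬p = suc q , ≮⇒≥ ¬p , ≤-<-trans hi (subst (2 ^ suc q <_) (cong (2 ^ suc q +_) (sym (+-identityʳ (2 ^ suc q))))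
                    (m<m+n (2 ^ suc q) (m^n>0 2 (suc q))))

  -- The constant 1/ε for expansion 1/G; x stands for log n.
  constant : ℕ → ℕ
  constant G = 2 * (41 * (G * G) * (270 * G * (19 * G)))

  module Numbers {g G x q K : ℕ} (K≥ : constant G ≤ K) (1≤g : 1 ≤ g) (g≤G : g ≤ G) (1≤x : 1 ≤ x) (1≤q : 1 ≤ q) where

    private
      Λ c l s : ℕ
      Λ = suc x
      c = 3 * (2 * (18 * G) + 3) * Λ
      l = c + 4 * (4 * g * Λ) + 2
      s = q * (l * (3 + 16 * g))

      1≤G : 1 ≤ G
      1≤G = ≤-trans 1≤g g≤G

      -- Since `suc x ≤ 2 * x`, the summands of `l` are at most `234 * G * x`, `32 * G * x` and
      -- `2 * G * x`.
      l≤ : l ≤ 270 * G * x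
      l≤ = linear (2 * (G * x))
        (9 ⊛ *-mono-≤ 1≤G (≤-refl {suc x}) ⊕ 16 ⊛ *-mono-≤ g≤G (≤-refl {suc x}) ⊕ 2 ⊛ *-mono-≤ 1≤G 1≤x ⊕ 133 * G ⊛ 1≤x)
        (arith g G x)
        where
        arith : ∀ g G x → 3 * (2 * (18 * G) + 3) * suc x + 4 * (4 * g * suc x) + 2
          + (9 * (G * suc x) + (16 * (G * suc x) + (2 * (G * x) + 133 * G * x))) + 2 * (G * x)
          ≡ 270 * G * x + (9 * (1 * suc x) + (16 * (g * suc x) + (2 * (1 * 1) + 133 * G * 1)))
        arith = solve-∀

      s≤ : s ≤ q * (270 * G * x * (19 * G))
      s≤ = *-monoʳ-≤ q (*-mono-≤ l≤ (linear 0 (16 ⊛ g≤G ⊕ 3 ⊛ 1≤G) (arith g G)))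
        where
        arith : ∀ g G → 3 + 16 * g + (16 * G + 3 * G) + 0 ≡ 19 * G + (16 * g + 3 * 1)
        arith = solve-∀

      l≤s : l ≤ s
      l≤s = linear (l * (2 + 16 * g)) (*-monoˡ-≤ (l * (3 + 16 * g)) 1≤q) (arith l g q)
        where
        arith : ∀ l g q → l + q * (l * (3 + 16 * g)) + l * (2 + 16 * g) ≡ q * (l * (3 + 16 * g)) + 1 * (l * (3 + 16 * g))
        arith = solve-∀

      1≤s : 1 ≤ s
      1≤s = ≤-trans (≤-trans (s≤s z≤n) (m≤n+m 2 (c + 4 * (4 * g * Λ)))) l≤s

    total : ℕ
    total = 3 + 2 * (4 * g * s + 2 * l + 2 * s) + 2 * g * (4 * g * s + 2 * l + 2 * s) + 2 * g + 4 * g * s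

    -- Vertices and edges of `H` are bounded separately by the same quantity, so their sum `q` costs
    -- a factor `2`.
    total≤ : 2 * total ≤ q * (suc K * x)
    total≤ = begin
      2 * total                                                    ≤⟨ 2 ⊛ collect ⟩
      2 * (41 * (g * g) * s)                                       ≤⟨ 2 ⊛ *-mono-≤ (41 ⊛ *-mono-≤ g≤G g≤G) s≤ ⟩
      2 * (41 * (G * G) * (q * (270 * G * x * (19 * G))))          ≡⟨ regroup 41 270 19 G q x ⟩
      q * (constant G * x)                                         ≤⟨ *-monoʳ-≤ q (*-monoˡ-≤ x (m≤n⇒m≤1+n K≥)) ⟩
      q * (suc K * x)                                              ∎
      where
      open ≤-Reasoning
      regroup : ∀ a b c G q x → 2 * (a * (G * G) * (q * (b * G * x * (c * G)))) ≡ q * (2 * (a * (G * G) * (b * G * (c * G))) * x)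
      regroup = solve-∀
      -- After `l ≤ s`, the coefficients of `s`, `g * s`, `g * g * s`, `1` and `g` are `8`, `20`,
      -- `8`, `3` and `2`, with sum `41`.
      collect : total ≤ 41 * (g * g) * s
      collect = linear 0 ((4 + 4 * g) ⊛ l≤s ⊕ 20 ⊛ g * s ⊛ 1≤g ⊕ 8 ⊛ s ⊛ *-mono-≤ 1≤g 1≤g
          ⊕ 3 ⊛ *-mono-≤ (*-mono-≤ 1≤g 1≤g) 1≤s ⊕ 2 ⊛ g ⊛ *-mono-≤ 1≤g 1≤s) (arith g l s)
        where
        arith : ∀ g l s → 3 + 2 * (4 * g * s + 2 * l + 2 * s) + 2 * g * (4 * g * s + 2 * l + 2 * s) + 2 * g + 4 * g * s
          + ((4 + 4 * g) * s + (20 * (g * s * g) + (8 * (s * (g * g)) + (3 * (g * g * s) + 2 * (g * (g * s)))))) + 0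
          ≡ 41 * (g * g) * s + ((4 + 4 * g) * l + (20 * (g * s * 1) + (8 * (s * (1 * 1)) + (3 * (1 * 1 * 1) + 2 * (g * (1 * 1))))))
        arith = solve-∀

    used<total : suc (2 * g * s + s) ≤ total
    used<total = ≤-trans (m≤m+n _ (2 + 4 * l + 3 * s + 2 * g * (4 * g * s + 2 * l + 2 * s) + 2 * g + 10 * g * s))
      (≤-reflexive (arith g l s))
      where
      arith : ∀ g l s → suc (2 * g * s + s) + (2 + 4 * l + 3 * s + 2 * g * (4 * g * s + 2 * l + 2 * s) + 2 * g + 10 * g * s)
        ≡ 3 + 2 * (4 * g * s + 2 * l + 2 * s) + 2 * g * (4 * g * s + 2 * l + 2 * s) + 2 * g + 4 * g * s
      arith = solve-∀

-- Bounds on natural numbers from the real hypotheses.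

module Reals where
  open import Defs using (ℝ≥0; fromℕ; log; _∋_; module ℚ-lemmas; 2ℚ)
    renaming (_≤_ to _≤ᴿ_; _+_ to _+ᴿ_; _∸_ to _∸ᴿ_; _*_ to _*ᴿ_; _÷_ to _÷ᴿ_; _⁻¹ to _⁻¹ᴿ; _² to _²ᴿ; D to Dᴿ)
  open ℚ-lemmas
  open import Algebra.Bundles using (CommutativeRing)
  import Algebra.Properties.Semiring.Exp as Exp
  open import Data.Integer.Base as ℤ using (+_; -[1+_])
  import Data.Integer.Properties as ℤ
  open import Data.Rational.Base
  open import Data.Rational.Properties
  open import Data.Rational.Solver using (module +-*-Solver)
  import Data.Rational.Unnormalised.Base as ℚᵘ
  import Data.Rational.Unnormalised.Properties as ℚᵘ
  open Exp (CommutativeRing.semiring +-*-commutativeRing) using (_^_; ^-assocʳ)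
  open +-*-Solver

  ι : ℕ → ℚ
  ι k = + k / 1

  ι-ᵘ : ∀ k → toℚᵘ (ι k) ℚᵘ.≃ ℚᵘ.mkℚᵘ (+ k) 0
  ι-ᵘ k = toℚᵘ-fromℚᵘ (ℚᵘ.mkℚᵘ (+ k) 0)

  0≤ι : ∀ k → 0ℚ ≤ ι k
  0≤ι k = 0≤/ k 0

  ι-mono : ∀ {j k} → j ℕ.≤ k → ι j ≤ ι k
  ι-mono {j} {k} j≤k = /-mono-≤ (+ j) 0 (+ k) 0
    (subst₂ ℤ._≤_ (sym (ℤ.*-identityʳ (+ j))) (sym (ℤ.*-identityʳ (+ k))) (ℤ.+≤+ j≤k))

  ι-cancel : ∀ {j k} → ι j ≤ ι k → j ℕ.≤ k
  ι-cancel {j} {k} p with ℚᵘ.≤-respˡ-≃ (ι-ᵘ j) (ℚᵘ.≤-respʳ-≃ (ι-ᵘ k) (toℚᵘ-mono-≤ p))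
  ... | ℚᵘ.*≤* q with subst₂ ℤ._≤_ (ℤ.*-identityʳ (+ j)) (ℤ.*-identityʳ (+ k)) q
  ...   | ℤ.+≤+ r = r

  ι-+ : ∀ j k → ι (j ℕ.+ k) ≡ ι j + ι k
  ι-+ j k = toℚᵘ-injective (ℚᵘ.≃-trans (ι-ᵘ (j ℕ.+ k)) (ℚᵘ.≃-sym (ℚᵘ.≃-trans (toℚᵘ-homo-+ (ι j) (ι k))
    (ℚᵘ.≃-trans (ℚᵘ.+-cong (ι-ᵘ j) (ι-ᵘ k)) (ℚᵘ.*≡* (cong (ℤ._* + 1)
      (cong₂ ℤ._+_ (ℤ.*-identityʳ (+ j)) (ℤ.*-identityʳ (+ k)))))))))

  ι-* : ∀ j k → ι (j ℕ.* k) ≡ ι j * ι k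
  ι-* j k = toℚᵘ-injective (ℚᵘ.≃-trans (ι-ᵘ (j ℕ.* k)) (ℚᵘ.≃-sym (ℚᵘ.≃-trans (toℚᵘ-homo-* (ι j) (ι k))
    (ℚᵘ.≃-trans (ℚᵘ.*-cong (ι-ᵘ j) (ι-ᵘ k)) (ℚᵘ.*≡* (cong (ℤ._* + 1) (sym (ℤ.pos-* j k))))))))

  /-ι : ∀ a b → + a / suc b * ι (suc b) ≡ ι a
  /-ι a b = toℚᵘ-injective (ℚᵘ.≃-trans (toℚᵘ-homo-* (+ a / suc b) (ι (suc b)))
    (ℚᵘ.≃-trans (ℚᵘ.*-cong (toℚᵘ-fromℚᵘ (ℚᵘ.mkℚᵘ (+ a) b)) (ι-ᵘ (suc b)))
      (ℚᵘ.≃-trans (ℚᵘ.*≡* (ℤ.*-assoc (+ a) (+ suc b) (+ 1)))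
        (ℚᵘ.≃-sym (ι-ᵘ a)))))

  *-monoˡ : ∀ {a b c} → 0ℚ ≤ a → b ≤ c → a * b ≤ a * c
  *-monoˡ {a} 0≤a = *-monoˡ-≤-nonNeg a {{nonNegative 0≤a}}

  *-monoʳ : ∀ {a b c} → 0ℚ ≤ a → b ≤ c → b * a ≤ c * a
  *-monoʳ {a} 0≤a = *-monoʳ-≤-nonNeg a {{nonNegative 0≤a}}

  ι-cancelʳ : ∀ k {a b} → a * ι (suc k) ≤ b * ι (suc k) → a ≤ b
  ι-cancelʳ k = *-cancelʳ-≤-pos (ι (suc k)) {{normalize-pos (suc k) 1}}

  -- The denominator of `t` serves as the factor, the numerator being at least `1`.
  0<⇒ι : ∀ {t} → 0ℚ < t → ∃ λ k → 1ℚ ≤ ι (suc k) * t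
  0<⇒ι {mkℚ (+ zero)  d c} (*<* (ℤ.+<+ ()))
  0<⇒ι {mkℚ -[1+ _ ] d c} (*<* ())
  0<⇒ι {t@(mkℚ (+ suc p) d c)} _ = d , (begin
    1ℚ                         ≤⟨ ι-mono {1} {suc p} (ℕ.s≤s ℕ.z≤n) ⟩
    ι (suc p)                  ≡⟨ /-ι (suc p) d ⟨
    + suc p / suc d * ι (suc d) ≡⟨ cong (_* ι (suc d)) (↥p/↧p≡p t) ⟩
    t * ι (suc d)              ≡⟨ *-comm t (ι (suc d)) ⟩
    ι (suc d) * t              ∎)
    where open ≤-Reasoning

  ≤ᴿ-fromℕ : ∀ {x k} → x ≤ᴿ fromℕ k → ∀ {s} → x ∋ s → s ≤ ι k
  ≤ᴿ-fromℕ {k = k} x≤ = x≤ (ι k) (λ { refl → ≤-refl })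

  ⇒≤ᴿ-fromℕ : ∀ {x k} → (∀ {s} → x ∋ s → s ≤ ι k) → x ≤ᴿ fromℕ k
  ⇒≤ᴿ-fromℕ h b k≤b x∋ = ≤-trans (h x∋) (k≤b refl)

  2^-ι : ∀ k → 2ℚ ^ k ≡ ι (2 ℕ.^ k)
  2^-ι zero    = refl
  2^-ι (suc k) = trans (cong (2ℚ *_) (2^-ι k)) (sym (ι-* 2 (2 ℕ.^ k)))

  log∋ : ∀ {n k} → 2 ℕ.^ k ℕ.≤ n → log (fromℕ n) ∋ ι k
  log∋ {n} {k} p = k , 0 , ι n , refl , (begin
    2ℚ ^ k           ≡⟨ 2^-ι k ⟩
    ι (2 ℕ.^ k)      ≤⟨ ι-mono p ⟩
    ι n              ≤⟨ p≤q⊔p 1ℚ (ι n) ⟩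
    1ℚ ⊔ ι n         ≡⟨ *-identityʳ _ ⟨
    (1ℚ ⊔ ι n) ^ 1   ∎) , refl
    where open ≤-Reasoning

  log≤ : ∀ {n k} → n ℕ.≤ 2 ℕ.^ k → ∀ {u} → log (fromℕ n) ∋ u → u ≤ ι k
  log≤ {n} {k} n≤ (p , q , _ , refl , h , refl) = /-≤-ℕ p q k (^-cancel-≤ p (k ℕ.* suc q) (begin
    2ℚ ^ p                ≤⟨ h ⟩
    (1ℚ ⊔ ι n) ^ suc q    ≤⟨ ^-monoˡ-≤ (≤-trans 0≤1 (p≤p⊔q 1ℚ (ι n)))
                               (⊔-lub (1≤^ 1≤2 k) (≤-trans (ι-mono n≤) (≤-reflexive (sym (2^-ι k))))) (suc q) ⟩
    (2ℚ ^ k) ^ suc q      ≡⟨ ^-assocʳ 2ℚ k (suc q) ⟩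
    2ℚ ^ (k ℕ.* suc q)    ∎))
    where open ≤-Reasoning

  p≤p+q : ∀ p {q} → 0ℚ ≤ q → p ≤ p + q
  p≤p+q p {q} 0≤q = subst (_≤ p + q) (+-identityʳ p) (+-monoʳ-≤ p 0≤q)

  bernoulli : ∀ {x} → 0ℚ ≤ x → ∀ k → 1ℚ + ι k * x ≤ (1ℚ + x) ^ k
  bernoulli {x} 0≤x zero    = ≤-reflexive (trans (cong (λ y → 1ℚ + y) (*-zeroˡ x)) (+-identityʳ 1ℚ))
  bernoulli {x} 0≤x (suc k) = begin
    1ℚ + ι (suc k) * x                       ≡⟨ cong (λ y → 1ℚ + y * x) (ι-+ 1 k) ⟩
    1ℚ + (1ℚ + ι k) * x                      ≤⟨ p≤p+q _ (0≤* 0≤x (0≤* (0≤ι k) 0≤x)) ⟩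
    1ℚ + (1ℚ + ι k) * x + x * (ι k * x)      ≡⟨ solve 2 (λ k x → con 1ℚ :+ (con 1ℚ :+ k) :* x :+ x :* (k :* x)
                                                  := (con 1ℚ :+ x) :* (con 1ℚ :+ k :* x)) refl (ι k) x ⟩
    (1ℚ + x) * (1ℚ + ι k * x)                ≤⟨ *-monoˡ (≤-trans 0≤1 (p≤p+q 1ℚ 0≤x)) (bernoulli 0≤x k) ⟩
    (1ℚ + x) * (1ℚ + x) ^ k                  ∎
    where open ≤-Reasoning

  ι-pos : ∀ k → 0ℚ < ι (suc k)
  ι-pos k = positive⁻¹ (ι (suc k)) {{normalize-pos (suc k) 1}}

  0<* : ∀ {a b} → 0ℚ < a → 0ℚ < b → 0ℚ < a * b
  0<* {a} {b} 0<a 0<b = positive⁻¹ (a * b) {{pos*pos⇒pos a {{positive 0<a}} b {{positive 0<b}}}}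

  module Bounds (α : ℝ≥0) (g g₀ : ℕ) {t : ℚ} (t∈α : α ∋ t) (0<t : 0ℚ < t) (1≤g₀t : 1ℚ ≤ ι (suc g₀) * t)
    (g-bound : ∀ {s} → α ∋ s → s * ι g ≤ 1ℚ + s) (2-bound : ∀ {s} → α ∋ s → s ≤ ι 2) where
    open ≤-Reasoning

    private
      0≤s : ∀ {s} → α ∋ s → 0ℚ ≤ s
      0≤s = ℝ≥0.nonneg α

      three : ∀ {s} → α ∋ s → 1ℚ + s ≤ ι 3
      three s∈ = +-monoʳ-≤ 1ℚ (2-bound s∈)

    -- From `α * g ≤ 1 + α ≤ 3` follows `(α * g)² ≤ 9`.
    α²⁻¹∋ : ((α ²ᴿ) ⁻¹ᴿ) ∋ (+ (g ℕ.* g) / 9)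
    α²⁻¹∋ = inj₂ (0≤/ (g ℕ.* g) 8 , (t * t , (t , t , t∈α , t∈α , refl) , 0<* 0<t 0<t) , λ
      { (s , s′ , s∈ , s′∈ , refl) → ι-cancelʳ 8 (begin
          + (g ℕ.* g) / 9 * (s * s′) * ι 9   ≡⟨ solve 4 (λ a b c d → a :* (b :* c) :* d := a :* d :* (b :* c)) refl (+ (g ℕ.* g) / 9) s s′ (ι 9) ⟩
          + (g ℕ.* g) / 9 * ι 9 * (s * s′)   ≡⟨ cong (_* (s * s′)) (trans (/-ι (g ℕ.* g) 8) (ι-* g g)) ⟩
          ι g * ι g * (s * s′)               ≡⟨ solve 3 (λ a b c → a :* a :* (b :* c) := b :* a :* (c :* a)) refl (ι g) s s′ ⟩
          s * ι g * (s′ * ι g)               ≤⟨ *-mono-≤ (0≤* (0≤s s′∈) (0≤ι g)) (0≤ι 3)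
                                                  (≤-trans (g-bound s∈) (three s∈)) (≤-trans (g-bound s′∈) (three s′∈)) ⟩
          ι 3 * ι 3                          ≡⟨ *-identityˡ (ι 9) ⟨
          1ℚ * ι 9                           ∎) })

    degree-bound : ∀ {Δ d} → (fromℕ (550 ℕ.* Δ) ÷ᴿ (α ²ᴿ)) ≤ᴿ fromℕ d → 61 ℕ.* (g ℕ.* g ℕ.* Δ) ℕ.≤ d
    degree-bound {Δ} {d} h = ℕ.*-cancelˡ-≤ 9 (ℕ.≤-trans (ℕ.≤-trans
        (ℕ.≤-reflexive (sym (ℕ.*-assoc 9 61 (g ℕ.* g ℕ.* Δ)))) (ℕ.*-monoˡ-≤ (g ℕ.* g ℕ.* Δ) (ℕ.n≤1+n 549))) (ι-cancel (begin
      ι (550 ℕ.* (g ℕ.* g ℕ.* Δ))                      ≡⟨ trans (ι-* 550 (g ℕ.* g ℕ.* Δ)) (cong (ι 550 *_) (ι-* (g ℕ.* g) Δ)) ⟩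
      ι 550 * (ι (g ℕ.* g) * ι Δ)                      ≡⟨ cong (λ x → ι 550 * (x * ι Δ)) (/-ι (g ℕ.* g) 8) ⟨
      ι 550 * (+ (g ℕ.* g) / 9 * ι 9 * ι Δ)
          ≡⟨ solve 4 (λ a b c d → a :* (b :* c :* d) := a :* d :* b :* c) refl (ι 550) (+ (g ℕ.* g) / 9) (ι 9) (ι Δ) ⟩
      ι 550 * ι Δ * (+ (g ℕ.* g) / 9) * ι 9            ≡⟨ cong (λ x → x * (+ (g ℕ.* g) / 9) * ι 9) (ι-* 550 Δ) ⟨
      ι (550 ℕ.* Δ) * (+ (g ℕ.* g) / 9) * ι 9
          ≤⟨ *-monoʳ (0≤ι 9) (≤ᴿ-fromℕ {fromℕ (550 ℕ.* Δ) ÷ᴿ (α ²ᴿ)} {d} h (ι (550 ℕ.* Δ) , + (g ℕ.* g) / 9 , refl , α²⁻¹∋ , refl)) ⟩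
      ι d * ι 9                                        ≡⟨ trans (*-comm (ι d) (ι 9)) (sym (ι-* 9 d)) ⟩
      ι (9 ℕ.* d)                                      ∎)))

    β : ℝ≥0
    β = α ÷ᴿ (fromℕ 3 *ᴿ (fromℕ 1 +ᴿ α))

    -- The form of `β` turns `α * g ≤ 1 + α` into exactly this inequality, so expansion by
    -- `1 / (3 * g)` implies expansion by `β`.
    β-bound : ∀ {x} → β ∋ x → x * ι (3 ℕ.* g) ≤ 1ℚ
    β-bound (s , _ , s∈ , inj₁ refl , refl) = begin
      s * 0ℚ * ι (3 ℕ.* g)  ≡⟨ solve 2 (λ s a → s :* con 0ℚ :* a := con 0ℚ) refl s (ι (3 ℕ.* g)) ⟩
      0ℚ                    ≤⟨ 0≤1 ⟩
      1ℚ                    ∎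
    β-bound (s , r , s∈ , inj₂ (0≤r , _ , h) , refl) = begin
      s * r * ι (3 ℕ.* g)           ≡⟨ cong (s * r *_) (ι-* 3 g) ⟩
      s * r * (ι 3 * ι g)           ≡⟨ solve 4 (λ s r a b → s :* r :* (a :* b) := r :* (a :* (s :* b))) refl s r (ι 3) (ι g) ⟩
      r * (ι 3 * (s * ι g))         ≤⟨ *-monoˡ 0≤r (*-monoˡ (0≤ι 3) (g-bound s∈)) ⟩
      r * (ι 3 * (1ℚ + s))          ≤⟨ h (ι 3 , 1ℚ + s , refl , (1ℚ , s , refl , s∈ , refl) , refl) ⟩
      1ℚ                            ∎

    1/9∋ : ((fromℕ 3 *ᴿ (fromℕ 1 +ᴿ α)) ⁻¹ᴿ) ∋ (+ 1 / 9)
    1/9∋ = inj₂ (0≤/ 1 8 ,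
      (ι 3 * (1ℚ + t) , (ι 3 , 1ℚ + t , refl , (1ℚ , t , refl , t∈α , refl) , refl) ,
        0<* (ι-pos 2) (<-≤-trans (ι-pos 0) (p≤p+q 1ℚ (0≤s t∈α)))) , λ
      { (_ , _ , refl , (_ , s , refl , s∈ , refl) , refl) → begin
          + 1 / 9 * (ι 3 * (1ℚ + s))    ≤⟨ *-monoˡ (0≤/ 1 8) (*-monoˡ (0≤ι 3) (three s∈)) ⟩
          + 1 / 9 * (ι 3 * ι 3)         ≡⟨⟩
          1ℚ                            ∎ })

    t/9∈β : β ∋ (t * (+ 1 / 9))
    t/9∈β = t , + 1 / 9 , t∈α , 1/9∋ , refl

    0<t/9 : 0ℚ < t * (+ 1 / 9)
    0<t/9 = 0<* 0<t (positive⁻¹ (+ 1 / 9))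

    cycle-lower : ∀ {c} → (fromℕ 1 +ᴿ fromℕ 2 ÷ᴿ β) ≤ᴿ fromℕ c → 1 ℕ.+ 6 ℕ.* g ℕ.≤ c
    cycle-lower {c} h = ι-cancel (begin
      ι (1 ℕ.+ 6 ℕ.* g)            ≡⟨ ι-+ 1 (6 ℕ.* g) ⟩
      1ℚ + ι (6 ℕ.* g)             ≡⟨ cong (λ k → 1ℚ + ι k) (ℕ.*-assoc 2 3 g) ⟩
      1ℚ + ι (2 ℕ.* (3 ℕ.* g))     ≡⟨ cong (λ x → 1ℚ + x) (ι-* 2 (3 ℕ.* g)) ⟩
      1ℚ + ι 2 * ι (3 ℕ.* g)       ≤⟨ ≤ᴿ-fromℕ {fromℕ 1 +ᴿ fromℕ 2 ÷ᴿ β} {c} h (1ℚ , ι 2 * ι (3 ℕ.* g) , refl , (ι 2 , ι (3 ℕ.* g) , refl ,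
                                        inj₂ (0≤ι (3 ℕ.* g) , (t * (+ 1 / 9) , t/9∈β , 0<t/9) ,
                                          (λ {x} x∈ → ≤-trans (≤-reflexive (*-comm (ι (3 ℕ.* g)) x)) (β-bound x∈))) , refl) , refl) ⟩
      ι c                          ∎)

    -- 2 ≤ (1 + x) ^ N for x = t / 18 and N = 18 (g₀ + 1), hence 1 / N lies below the logarithm.
    log∋1/N : log (fromℕ 1 +ᴿ β ÷ᴿ fromℕ 2) ∋ (+ 1 / (18 ℕ.* suc g₀))
    log∋1/N = 1 , g₀ ℕ.+ 17 ℕ.* suc g₀ , 1ℚ + x , (1ℚ , x , refl , (t * (+ 1 / 9) , + 1 / 2 , t/9∈β ,
        inj₂ (0≤/ 1 1 , (ι 2 , refl , ι-pos 1) , λ { refl → ≤-refl }) , refl) , refl) , (begin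
      2ℚ ^ 1                          ≡⟨⟩
      1ℚ + 1ℚ                         ≤⟨ +-monoʳ-≤ 1ℚ one ⟩
      1ℚ + ι (18 ℕ.* suc g₀) * x      ≤⟨ bernoulli 0≤x (18 ℕ.* suc g₀) ⟩
      (1ℚ + x) ^ (18 ℕ.* suc g₀)      ≤⟨ ^-monoˡ-≤ (≤-trans 0≤1 (p≤p+q 1ℚ 0≤x)) (p≤q⊔p 1ℚ (1ℚ + x)) (18 ℕ.* suc g₀) ⟩
      (1ℚ ⊔ (1ℚ + x)) ^ (18 ℕ.* suc g₀) ∎) , refl
      where
      x = t * (+ 1 / 9) * (+ 1 / 2)
      0≤x : 0ℚ ≤ x
      0≤x = 0≤* (0≤* (0≤s t∈α) (0≤/ 1 8)) (0≤/ 1 1)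
      one : 1ℚ ≤ ι (18 ℕ.* suc g₀) * x
      one = begin
        1ℚ                                              ≤⟨ 1≤g₀t ⟩
        ι (suc g₀) * t
            ≡⟨ solve 2 (λ g t → g :* t := con (ι 18) :* g :* (t :* con (+ 1 / 9) :* con (+ 1 / 2))) refl (ι (suc g₀)) t ⟩
        ι 18 * ι (suc g₀) * x                           ≡⟨ cong (_* x) (ι-* 18 (suc g₀)) ⟨
        ι (18 ℕ.* suc g₀) * x                           ∎

    -- The element `1 / N` of the logarithm bounds its inverse by `N`, so that `D` is at most
    -- `2 * N + 3`. As `N` is built from `g₀`, the bound depends on `α` but not on the graph.
    cycle-upper : ∀ {c n Λ} → n ℕ.≤ 2 ℕ.^ Λ → fromℕ c ≤ᴿ (fromℕ 3 *ᴿ Dᴿ (β ÷ᴿ fromℕ 2) *ᴿ log (fromℕ n)) →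
                  c ℕ.≤ 3 ℕ.* (2 ℕ.* (18 ℕ.* suc g₀) ℕ.+ 3) ℕ.* Λ
    cycle-upper {c} {n} {Λ} n≤ h = ι-cancel (h (ι (3 ℕ.* (2 ℕ.* N ℕ.+ 3) ℕ.* Λ)) (λ
      { (_ , u , (_ , _ , refl , (_ , _ , (_ , r , refl , r∈ , refl) , refl , refl) , refl) , u∈ , refl) → begin
          ι 3 * (ι 2 * r + ι 3) * u
              ≤⟨ *-mono-≤ (ℝ≥0.nonneg (log (fromℕ n)) u∈) (0≤* (0≤ι 3) (≤-trans (0≤ι 3) (≤-trans (p≤p+q (ι 3) (0≤* (0≤ι 2) (0≤ι N))) (≤-reflexive (+-comm (ι 3) (ι 2 * ι N))))))
                                                       (*-monoˡ (0≤ι 3) (+-monoˡ-≤ (ι 3) (*-monoˡ (0≤ι 2) (r≤N r∈)))) (log≤ {n} {Λ} n≤ u∈) ⟩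
          ι 3 * (ι 2 * ι N + ι 3) * ι Λ           ≡⟨ cong (λ x → ι 3 * (x + ι 3) * ι Λ) (ι-* 2 N) ⟨
          ι 3 * (ι (2 ℕ.* N) + ι 3) * ι Λ         ≡⟨ cong (λ x → ι 3 * x * ι Λ) (ι-+ (2 ℕ.* N) 3) ⟨
          ι 3 * ι (2 ℕ.* N ℕ.+ 3) * ι Λ           ≡⟨ cong (_* ι Λ) (ι-* 3 (2 ℕ.* N ℕ.+ 3)) ⟨
          ι (3 ℕ.* (2 ℕ.* N ℕ.+ 3)) * ι Λ         ≡⟨ ι-* (3 ℕ.* (2 ℕ.* N ℕ.+ 3)) Λ ⟨
          ι (3 ℕ.* (2 ℕ.* N ℕ.+ 3) ℕ.* Λ)         ∎ }) refl)
      where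
      N = 18 ℕ.* suc g₀
      r≤N : ∀ {r} → (log (fromℕ 1 +ᴿ β ÷ᴿ fromℕ 2) ⁻¹ᴿ) ∋ r → r ≤ ι N
      r≤N (inj₁ refl) = 0≤ι N
      r≤N {r} (inj₂ (0≤r , _ , h)) = begin
        r                          ≡⟨ *-identityʳ r ⟨
        r * 1ℚ                     ≡⟨ cong (r *_) (/-ι 1 (g₀ ℕ.+ 17 ℕ.* suc g₀)) ⟨
        r * (+ 1 / N * ι N)        ≡⟨ *-assoc r (+ 1 / N) (ι N) ⟨
        r * (+ 1 / N) * ι N        ≤⟨ *-monoʳ (0≤ι N) (h log∋1/N) ⟩
        1ℚ * ι N                   ≡⟨ *-identityˡ (ι N) ⟩
        ι N                        ∎

  0<-factor : ∀ {a b} → 0ℚ ≤ a → 0ℚ < a * b → 0ℚ < a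
  0<-factor {a} {b} 0≤a 0<ab with 0ℚ <? a
  ... | yes 0<a = 0<a
  ... | no ¬0<a = contradiction (subst (0ℚ <_) (trans (cong (_* b) (≤-antisym (≮⇒≥ ¬0<a) 0≤a)) (*-zeroˡ b)) 0<ab) (<-irrefl refl)

  -- k enters only through upper bounds on k ⁻¹.
  module Sizes (n p M : ℕ) (2^p≤n : 2 ℕ.^ suc p ℕ.≤ n) (k : ℝ≥0) where
    open ≤-Reasoning

    ε : ℝ≥0
    ε = fromℕ 1 ÷ᴿ fromℕ (suc M)

    scale : ℕ
    scale = suc M ℕ.* suc p

    Small : ℕ → Set
    Small a = fromℕ a ≤ᴿ (ε *ᴿ fromℕ n ÷ᴿ (k *ᴿ log (fromℕ n)))

    ε-bound : ∀ {e} → ε ∋ e → 0ℚ ≤ e × e * ι (suc M) ≤ 1ℚ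
    ε-bound (_ , _ , refl , inj₁ refl , refl) = ≤-refl , ≤-trans (≤-reflexive (*-zeroˡ (ι (suc M)))) 0≤1
    ε-bound (_ , r , refl , inj₂ (0≤r , _ , h) , refl) =
      ≤-trans 0≤r (≤-reflexive (sym (*-identityˡ r))) , ≤-trans (≤-reflexive (cong (_* ι (suc M)) (*-identityˡ r))) (h refl)

    -- Since `suc p` lies below `log n`, a lower bound for `1 / (k * log n)` times `suc p` is one
    -- for `1 / k`.
    k⁻¹∋ : ∀ {r} → ((k *ᴿ log (fromℕ n)) ⁻¹ᴿ) ∋ r → (k ⁻¹ᴿ) ∋ (r * ι (suc p))
    k⁻¹∋ (inj₁ refl) = inj₁ (*-zeroˡ (ι (suc p)))
    k⁻¹∋ {r} (inj₂ (0≤r , (_ , (s , u , s∈ , u∈ , refl) , 0<su) , h)) = inj₂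
      (0≤* 0≤r (0≤ι (suc p)) , (s , s∈ , 0<-factor (ℝ≥0.nonneg k s∈) 0<su) ,
        λ {x} x∈ → ≤-trans (≤-reflexive (solve 3 (λ r u x → r :* u :* x := r :* (x :* u)) refl r (ι (suc p)) x))
          (h (x , ι (suc p) , x∈ , log∋ {n} {suc p} 2^p≤n , refl)))

    size : ∀ a {ρ} → 0ℚ ≤ ρ → (∀ {r} → (k ⁻¹ᴿ) ∋ r → r ≤ ρ) → Small a → ι (a ℕ.* scale) ≤ ι n * ρ
    size a {ρ} 0≤ρ k⁻¹≤ρ small = begin
      ι (a ℕ.* scale)     ≡⟨ ι-* a scale ⟩
      ι a * ι scale       ≤⟨ *-monoʳ (0≤ι scale) (small b below refl) ⟩
      b * ι scale         ≡⟨ b-scale ⟩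
      ι n * ρ             ∎
      where
      b = ι n * ρ * (+ 1 / scale)
      b-scale : b * ι scale ≡ ι n * ρ
      b-scale = trans (*-assoc (ι n * ρ) (+ 1 / scale) (ι scale))
        (trans (cong (ι n * ρ *_) (/-ι 1 (p ℕ.+ M ℕ.* suc p))) (*-identityʳ (ι n * ρ)))
      below : ∀ {y} → (ε *ᴿ fromℕ n ÷ᴿ (k *ᴿ log (fromℕ n))) ∋ y → y ≤ b
      below (_ , r , (e , _ , e∈ , refl , refl) , r∈ , refl) = ι-cancelʳ (p ℕ.+ M ℕ.* suc p) (begin
        e * ι n * r * ι scale                        ≡⟨ cong (e * ι n * r *_) (ι-* (suc M) (suc p)) ⟩
        e * ι n * r * (ι (suc M) * ι (suc p))        ≡⟨ solve 5 (λ e n r m p → e :* n :* r :* (m :* p) := e :* m :* (n :* (r :* p))) refl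
                                                         e (ι n) r (ι (suc M)) (ι (suc p)) ⟩
        e * ι (suc M) * (ι n * (r * ι (suc p)))      ≤⟨ *-mono-≤ (0≤* (0≤ι n) (ℝ≥0.nonneg (k ⁻¹ᴿ) (k⁻¹∋ r∈))) 0≤1
                                                         (proj₂ (ε-bound e∈)) (*-monoˡ (0≤ι n) (k⁻¹≤ρ (k⁻¹∋ r∈))) ⟩
        1ℚ * (ι n * ρ)                               ≡⟨ *-identityˡ (ι n * ρ) ⟩
        ι n * ρ                                      ≡⟨ b-scale ⟨
        b * ι scale                                  ∎)

    module _ {a e : ℕ} (small-a : Small a) (small-e : Small e) where

      total : ∀ w {ρ} → 2 ℕ.* w ℕ.≤ (a ℕ.+ e) ℕ.* scale → 0ℚ ≤ ρ → (∀ {r} → (k ⁻¹ᴿ) ∋ r → r ≤ ρ) → ι w ≤ ι n * ρ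
      total w {ρ} w≤ 0≤ρ k⁻¹≤ρ = ι-cancelʳ 1 (begin
        ι w * ι 2                                ≡⟨ trans (*-comm (ι w) (ι 2)) (sym (ι-* 2 w)) ⟩
        ι (2 ℕ.* w)                              ≤⟨ ι-mono w≤ ⟩
        ι ((a ℕ.+ e) ℕ.* scale)                  ≡⟨ trans (cong ι (ℕ.*-distribʳ-+ scale a e)) (ι-+ (a ℕ.* scale) (e ℕ.* scale)) ⟩
        ι (a ℕ.* scale) + ι (e ℕ.* scale)        ≤⟨ +-mono-≤ (size a 0≤ρ k⁻¹≤ρ small-a) (size e 0≤ρ k⁻¹≤ρ small-e) ⟩
        ι n * ρ + ι n * ρ                        ≡⟨ solve 1 (λ x → x :+ x := x :* con (ι 2)) refl (ι n * ρ) ⟩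
        ι n * ρ * ι 2                            ∎)

      absolute : ∀ {w} → 2 ℕ.* w ℕ.≤ (a ℕ.+ e) ℕ.* scale → fromℕ 6 ≤ᴿ k → w ℕ.≤ n
      absolute {w} w≤ 6≤k = ι-cancel (≤-trans (total w w≤ 0≤1 k⁻¹≤1) (≤-reflexive (*-identityʳ (ι n))))
        where
        k⁻¹≤1 : ∀ {r} → (k ⁻¹ᴿ) ∋ r → r ≤ 1ℚ
        k⁻¹≤1 (inj₁ refl) = 0≤1
        -- If an element of `1 / k` exceeded `1`, every element of `k` would be at most `1`, against
        -- `6 ≤ k`.
        k⁻¹≤1 {r} (inj₂ (0≤r , _ , h)) = ≮⇒≥ λ 1<r → contradiction (ι-cancel {6} {1} (6≤k 1ℚ (λ {s} s∈ → begin
                s        ≡⟨ *-identityˡ s ⟨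
                1ℚ * s   ≤⟨ *-monoʳ (ℝ≥0.nonneg k s∈) (<⇒≤ 1<r) ⟩
                r * s    ≤⟨ h s∈ ⟩
                1ℚ       ∎) refl)) λ { (ℕ.s≤s ()) }

      -- For an element `r` of the cut of `1 - suc c / k`, the number `1 - r` is an upper bound of
      -- `1 / k`. With it as `ρ`, at most `(1 - r) * n` vertices are missing, so at least `r * n`
      -- remain.
      relative : ∀ c {w u} → 2 ℕ.* w ℕ.≤ (a ℕ.+ e) ℕ.* scale → n ℕ.≤ u ℕ.+ w →
                 ((fromℕ 1 ∸ᴿ fromℕ (suc c) ÷ᴿ k) *ᴿ fromℕ n) ≤ᴿ fromℕ u
      relative c {w} {u} w≤ n≤ = ⇒≤ᴿ-fromℕ {(fromℕ 1 ∸ᴿ fromℕ (suc c) ÷ᴿ k) *ᴿ fromℕ n} {u} λ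
        { (_ , _ , inj₁ refl , refl , refl) → ≤-trans (≤-reflexive (*-zeroˡ (ι n))) (0≤ι u)
        ; (r , _ , inj₂ (0≤r , _ , refl , h) , refl , refl) →
            let below : ∀ {x} → (k ⁻¹ᴿ) ∋ x → x ≤ 1ℚ - r
                below {x} x∈ = begin
                  x                        ≡⟨ *-identityˡ x ⟨
                  1ℚ * x                   ≤⟨ *-monoʳ (ℝ≥0.nonneg (k ⁻¹ᴿ) x∈) (ι-mono {1} {suc c} (ℕ.s≤s ℕ.z≤n)) ⟩
                  ι (suc c) * x            ≡⟨ solve 2 (λ y r → y := r :+ y :- r) refl (ι (suc c) * x) r ⟩
                  r + ι (suc c) * x - r    ≤⟨ +-monoˡ-≤ (- r) (h (ι (suc c) , x , refl , x∈ , refl)) ⟩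
                  1ℚ - r                   ∎
                bound : ι w ≤ ι n * (1ℚ - r)
                bound = total w w≤ (below (inj₁ refl)) below
            in begin
              r * ι n                            ≡⟨ solve 3 (λ r n w → r :* n := n :+ (w :- n :* (con 1ℚ :- r)) :- w) refl r (ι n) (ι w) ⟩
              ι n + (ι w - ι n * (1ℚ - r)) - ι w
                  ≤⟨ +-monoˡ-≤ (- ι w) (+-monoʳ-≤ (ι n) (≤-trans (+-monoˡ-≤ (- (ι n * (1ℚ - r))) bound) (≤-reflexive (+-inverseʳ (ι n * (1ℚ - r)))))) ⟩
              ι n + 0ℚ - ι w
                  ≤⟨ +-monoˡ-≤ (- ι w) (≤-trans (≤-reflexive (+-identityʳ (ι n))) (≤-trans (ι-mono n≤) (≤-reflexive (ι-+ u w)))) ⟩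
              ι u + ι w - ι w                    ≡⟨ solve 2 (λ u w → u :+ w :- w := u) refl (ι u) (ι w) ⟩
              ι u                                ∎ }

-- Deduction of the theorem.

open import Defs
import Data.Integer.Base as ℤ
open import Data.Rational.Base as ℚ using (ℚ; 0ℚ; 1ℚ)
import Data.Rational.Properties as ℚ

open FiniteSets using () renaming (_∈_ to _∈ᵈ_; _⊆_ to _⊆ᵈ_)
open Combinatorics using (∂; ∂-mono; OddCycle; module OddCycle)
open Representation
open IntegerCore
open Constants
open Reals

#-toSubset : ∀ {n} (R : DecSet n) → card (toSubset R) ≡ # R
#-toSubset R = card-tabulate R

module _ {n} (G : Graph n) where
  #∂-cong : ∀ W W′ Y Y′ → W ⊆ᵈ W′ → W′ ⊆ᵈ W → Y ⊆ᵈ Y′ → Y′ ⊆ᵈ Y → # (∂ G W ∅ Y) ≡ # (∂ G W′ ∅ Y′)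
  #∂-cong W W′ Y Y′ f f′ h h′ = #-cong (∂ G W ∅ Y) (∂ G W′ ∅ Y′)
    (∂-mono G W W′ ∅ Y Y′ f h (λ _ q → q ∘ h′)) (∂-mono G W′ W ∅ Y′ Y f′ h′ (λ _ q → q ∘ h))

  ExpandsBy : ℕ → Set₁
  ExpandsBy g = ∀ U → 2 ℕ.* # U ℕ.≤ n → # U ℕ.≤ g ℕ.* # (∂ G (full n) ∅ U)

  Violates : ℕ → DecSet n → Set
  Violates g U = 2 ℕ.* # U ℕ.≤ n × g ℕ.* # (∂ G (full n) ∅ U) ℕ.< # U

  -- Whether the factor can be lowered is decided by searching all vertex sets. The descent ends at
  -- the factor `1` or with a violating set, which is kept because it bounds `α` from above.
  leastExpansion : ∀ j → ExpandsBy (suc j) →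
    ∃ λ i → i ℕ.≤ j × ExpandsBy (suc i) × (i ≡ 0 ⊎ Σ (DecSet n) (Violates i))
  leastExpansion zero    e = 0 , z≤n , e , inj₁ refl
  leastExpansion (suc j) e with search {P = Violates (suc j)}
      (λ U → (2 ℕ.* # U ℕ.≤? n) ×-dec (suc j ℕ.* # (∂ G (full n) ∅ U) ℕ.<? # U)) ext
    where
    ext : Extensional (Violates (suc j))
    ext X Y f h (X≤ , v) = subst (λ x → 2 ℕ.* x ℕ.≤ n) (#-cong X Y f h) X≤ ,
      subst₂ (λ b x → suc j ℕ.* b ℕ.< x) (#∂-cong (full n) (full n) X Y id id f h) (#-cong X Y f h) v
  ... | inj₁ U   = suc j , ℕ.≤-refl , e , inj₂ U
  ... | inj₂ none =
    let i , i≤j , e′ , r = leastExpansion j (λ U U≤ → ℕ.≮⇒≥ (λ v → none U (U≤ , v))) in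
    i , ℕ.m≤n⇒m≤1+n i≤j , e′ , r

  module _ {α : ℝ≥0} (expander : Expander α G) where

    expansion : ∀ {s} → α ∋ s → ∀ U → 2 ℕ.* # U ℕ.≤ n → s ℚ.* ι (# U) ℚ.≤ ι (# (∂ G (full n) ∅ U))
    expansion {s} s∈ U U≤ = subst₂ (λ a b → s ℚ.* ι a ℚ.≤ ι b) (#-toSubset U)
      (trans (card-boundary G (toSubset U)) (#∂-cong (full n) (full n) (fromSubset (toSubset U)) U id id (∈to U) (to∈ U)))
      (≤ᴿ-fromℕ {α * fromℕ (card (toSubset U))} {card (Graph.boundary G (toSubset U))}
        (expander (toSubset U) (subst (λ x → 2 ℕ.* x ℕ.≤ n) (sym (#-toSubset U)) U≤))
        (s , ι (card (toSubset U)) , s∈ , refl , refl))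

    expandsBy : ∀ {t} g → α ∋ t → 1ℚ ℚ.≤ ι g ℚ.* t → ExpandsBy g
    expandsBy {t} g t∈ 1≤gt U U≤ = ι-cancel (begin
      ι (# U)                                ≡⟨ ℚ.*-identityˡ (ι (# U)) ⟨
      1ℚ ℚ.* ι (# U)                         ≤⟨ *-monoʳ (0≤ι (# U)) 1≤gt ⟩
      ι g ℚ.* t ℚ.* ι (# U)                  ≡⟨ ℚ.*-assoc (ι g) t (ι (# U)) ⟩
      ι g ℚ.* (t ℚ.* ι (# U))                ≤⟨ *-monoˡ (0≤ι g) (expansion t∈ U U≤) ⟩
      ι g ℚ.* ι (# (∂ G (full n) ∅ U))         ≡⟨ ι-* g (# (∂ G (full n) ∅ U)) ⟨
      ι (g ℕ.* # (∂ G (full n) ∅ U))           ∎)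
      where open ℚ.≤-Reasoning

    private
      cancel : ∀ {a b} k → 1 ℕ.≤ k → a ℚ.* ι k ℚ.≤ b ℚ.* ι k → a ℚ.≤ b
      cancel (suc k) _ = ι-cancelʳ k

    -- For a violating set `U`, the bounds `s * # U ≤ # ∂U` and `i * # ∂U < # U` give `s * i ≤ 1`;
    -- adding `s` passes to `suc i`.
    violated : ∀ {s} → α ∋ s → ∀ {i} → (i ≡ 0 ⊎ Σ (DecSet n) (Violates i)) → s ℚ.* ι (suc i) ℚ.≤ 1ℚ ℚ.+ s
    violated {s} s∈ {i} r = begin
      s ℚ.* ι (suc i)            ≡⟨ cong (s ℚ.*_) (ι-+ 1 i) ⟩
      s ℚ.* (1ℚ ℚ.+ ι i)         ≡⟨ ℚ.*-distribˡ-+ s 1ℚ (ι i) ⟩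
      s ℚ.* 1ℚ ℚ.+ s ℚ.* ι i     ≡⟨ trans (ℚ.+-comm (s ℚ.* 1ℚ) (s ℚ.* ι i)) (cong (λ x → s ℚ.* ι i ℚ.+ x) (ℚ.*-identityʳ s)) ⟩
      s ℚ.* ι i ℚ.+ s            ≤⟨ ℚ.+-monoˡ-≤ s (bound r) ⟩
      1ℚ ℚ.+ s                   ∎
      where
      open ℚ.≤-Reasoning
      bound : (i ≡ 0 ⊎ Σ (DecSet n) (Violates i)) → s ℚ.* ι i ℚ.≤ 1ℚ
      bound (inj₁ refl) = ℚ.≤-trans (ℚ.≤-reflexive (ℚ.*-zeroʳ s)) (0≤ι 1)
      bound (inj₂ (U , U≤ , v)) = cancel (# U) (ℕ.≤-trans (s≤s z≤n) v) (begin
        s ℚ.* ι i ℚ.* ι (# U)               ≡⟨ trans (cong (ℚ._* ι (# U)) (ℚ.*-comm s (ι i))) (ℚ.*-assoc (ι i) s (ι (# U))) ⟩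
        ι i ℚ.* (s ℚ.* ι (# U))             ≤⟨ *-monoˡ (0≤ι i) (expansion s∈ U U≤) ⟩
        ι i ℚ.* ι (# (∂ G (full n) ∅ U))      ≡⟨ ι-* i (# (∂ G (full n) ∅ U)) ⟨
        ι (i ℕ.* # (∂ G (full n) ∅ U))        ≤⟨ ι-mono (ℕ.<⇒≤ v) ⟩
        ι (# U)                             ≡⟨ ℚ.*-identityˡ (ι (# U)) ⟨
        1ℚ ℚ.* ι (# U)                      ∎)

    -- Half of the vertices cannot have many more neighbours than the other half has vertices.
    atMostTwo : 2 ℕ.≤ n → ∀ {s} → α ∋ s → s ℚ.≤ ι 2
    atMostTwo 2≤n {s} s∈ = by-half (half n)
      where
      open ℚ.≤-Reasoning
      bound : ∀ {e U} → 1 ℕ.≤ e → 2 ℕ.* e ℕ.≤ n → n ℕ.≤ 2 ℕ.* e ℕ.+ 1 → # U ≡ e → s ℚ.≤ ι 2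
      bound {e} {U} 1≤e 2e≤ n≤ #U = cancel e 1≤e (begin
        s ℚ.* ι e                      ≡⟨ cong (λ k → s ℚ.* ι k) #U ⟨
        s ℚ.* ι (# U)                  ≤⟨ expansion s∈ U (subst (λ k → 2 ℕ.* k ℕ.≤ n) (sym #U) 2e≤) ⟩
        ι (# (∂ G (full n) ∅ U))       ≤⟨ ι-mono (ℕ.+-cancelʳ-≤ e (# (∂ G (full n) ∅ U)) (2 ℕ.* e) few) ⟩
        ι (2 ℕ.* e)                    ≡⟨ ι-* 2 e ⟩
        ι 2 ℚ.* ι e                    ∎)
        where
        few : # (∂ G (full n) ∅ U) ℕ.+ e ℕ.≤ 2 ℕ.* e ℕ.+ e
        few = ℕ.≤-trans (subst (λ k → # (∂ G (full n) ∅ U) ℕ.+ k ℕ.≤ # (full n)) #U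
                (#-disjoint (∂ G (full n) ∅ U) U (full n) (λ _ → tt) (λ _ → tt) (λ (_ , ∉ , _) u → ∉ u)))
              (ℕ.≤-trans (ℕ.≤-reflexive (#full n)) (ℕ.≤-trans n≤ (ℕ.+-monoʳ-≤ (2 ℕ.* e) 1≤e)))
      by-half : (∃ λ e → 2 ℕ.* e ℕ.≤ n × n ℕ.≤ 2 ℕ.* e ℕ.+ 1) → s ℚ.≤ ι 2
      by-half (zero  , _   , n≤) = contradiction (ℕ.≤-trans 2≤n n≤) λ { (s≤s ()) }
      by-half (suc e , 2e≤ , n≤) =
        let U , _ , #U = subsetOfSize (n ℕ.∸ suc e) (full n) (suc e)
              (trans (#full n) (sym (ℕ.m∸n+n≡m (ℕ.≤-trans (ℕ.m≤m+n (suc e) (suc e ℕ.+ 0)) 2e≤))))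
        in bound {suc e} {U} (s≤s z≤n) 2e≤ n≤ #U

module _ {n} (G : Graph n) (R : DecSet n) where
  private
    U = toSubset R
    R′ = fromSubset U

  starIn : 1 ℕ.≤ # R → ∃ λ x → x ∈ᵈ R × Δ (G [ U ]) ℕ.≤ # (∂ G R ∅ ⁅ x ⁆)
  starIn 1≤R = let x , x∈ , d = largeDegree G U (ℕ.≤-trans 1≤R (ℕ.≤-reflexive (sym (#-toSubset R)))) in
    x , ∈to R x∈ , ℕ.≤-trans d (ℕ.≤-reflexive (#∂-cong G R′ R ⁅ x ⁆ ⁅ x ⁆ (∈to R) (to∈ R) id id))

  inducedExpander : ∀ β g → (∀ {x} → β ∋ x → x ℚ.* ι g ℚ.≤ 1ℚ) →
    (∀ W → W ⊆ᵈ R → 2 ℕ.* # W ℕ.≤ # R → # W ℕ.≤ g ℕ.* # (∂ G R ∅ W)) → Expander β (G [ U ])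
  inducedExpander β g β-bound expands W W≤ =
    ⇒≤ᴿ-fromℕ {β * fromℕ (card W)} {card (Graph.boundary (G [ U ]) W)} λ { (x , _ , x∈ , refl , refl) → begin
      x ℚ.* ι (card W)                          ≤⟨ *-monoˡ (ℝ≥0.nonneg β x∈) (ι-mono W-expands) ⟩
      x ℚ.* ι (g ℕ.* b)                         ≡⟨ trans (cong (x ℚ.*_) (ι-* g b)) (sym (ℚ.*-assoc x (ι g) (ι b))) ⟩
      x ℚ.* ι g ℚ.* ι b                         ≤⟨ *-monoʳ (0≤ι b) (β-bound x∈) ⟩
      1ℚ ℚ.* ι b                                ≡⟨ ℚ.*-identityˡ (ι b) ⟩
      ι b                                       ∎ }
    where
    open ℚ.≤-Reasoning
    b = card (Graph.boundary (G [ U ]) W)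
    L = lift G U W
    W-expands : card W ℕ.≤ g ℕ.* b
    W-expands = subst₂ (λ a b → a ℕ.≤ g ℕ.* b) (sym (#-lift G U W))
      (trans (#∂-cong G R R′ L L (to∈ R) (∈to R) id id) (sym (induced-boundary G U W)))
      (expands L (λ {v} v∈ → ∈to R (lift⊆ G U W v∈)) (subst₂ (λ a b → 2 ℕ.* a ℕ.≤ b) (#-lift G U W) (#-toSubset R) W≤))

  oddCycleIn : ∀ (C : Cycle (G [ U ])) → parity (Cycle.length C) ≡ 1ℙ →
    Σ (OddCycle G (_∈ᵈ R)) λ D → length (OddCycle.vertices D) ≡ Cycle.length C
  oddCycleIn C odd = let D , e = toOddCycle G U C odd in record
    { head = OddCycle.head D ; rest = OddCycle.rest D ; chain = OddCycle.chain D
    ; inside = λ m → ∈to R (OddCycle.inside D m) ; unique = OddCycle.unique D ; odd = OddCycle.odd D } , e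

-- This case is separate because the estimates need a vertex in `H`: otherwise `s` is zero and
-- absorbs no additive constants.
noVertices : ∀ {n} (H : Graph 0) (G : Graph n) → TopologicalMinor H G
noVertices H G = record
  { σ = λ () ; injective = λ { {()} } ; path = λ e → contradiction₀ (Edge.source e)
  ; disjoint = λ {e} → contradiction₀ (Edge.source e) }
  where
  contradiction₀ : ∀ {A : Set} → Fin 0 → A
  contradiction₀ ()

module Main (α : ℝ≥0) {t : ℚ} (t∈α : α ∋ t) (0<t : 0ℚ ℚ.< t) (g₀ : ℕ) (1≤g₀t : 1ℚ ℚ.≤ ι (suc g₀) ℚ.* t)
  (K : ℕ) (K≥ : constant (suc g₀) ℕ.≤ K) where

  ε : ℝ≥0
  ε = fromℕ 1 ÷ fromℕ (suc K)

  0<ε : fromℕ 0 < ε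
  0<ε = 1ℚ ℚ.* (ℤ.+ 1 ℚ./ suc K) , (1ℚ , _ , refl ,
      inj₂ (ℚ-lemmas.0≤/ 1 K , (ι (suc K) , refl , ι-pos K) , λ { refl → ℚ.≤-reflexive (/-ι 1 K) }) , refl) ,
    0ℚ , 0<* (ι-pos 0) (ℚ.positive⁻¹ (ℤ.+ 1 ℚ./ suc K) {{ℚ.normalize-pos 1 (suc K)}}) , λ { refl → ℚ.≤-refl }

  β : ℝ≥0
  β = α ÷ (fromℕ 3 * (fromℕ 1 + α))

  Conclusion : ∀ {n m} → Graph n → ℝ≥0 → Graph m → Set
  Conclusion G k H = TopologicalMinor H G ×
    (OddCycleRobust (fromℕ 1 ∸ fromℕ 2 ÷ k) β (fromℕ 1 + fromℕ 2 ÷ β) G →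
     ∀ (π : Edge H → Parity) →
     ∃ λ (M : TopologicalMinor H G) →
       ∀ e → parity (Path.length (TopologicalMinor.path M e)) ≡ π e)

  module _ {n} (G : Graph n) (1<n : 1 ℕ.< n) (expander : Expander α G) (k : ℝ≥0) (6≤k : fromℕ 6 ≤ k)
    {m : ℕ} (1≤m : 1 ℕ.≤ m) (H : Graph m)
    (small-m : fromℕ m ≤ ε * fromℕ n ÷ (k * log (fromℕ n)))
    (small-e : fromℕ (length (edges H)) ≤ ε * fromℕ n ÷ (k * log (fromℕ n)))
    (robust : MaxDegreeRobust (fromℕ 1 ∸ fromℕ 4 ÷ k) (fromℕ (550 ℕ.* Δ H) ÷ α ²) G) where

    module _ {p : ℕ} (2^p≤n : 2 ℕ.^ suc p ℕ.≤ n) (n<2^Λ : n ℕ.< 2 ℕ.^ suc (suc p))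
      {i : ℕ} (i≤g₀ : i ℕ.≤ g₀) (expands : ExpandsBy G (suc i)) (violation : i ≡ 0 ⊎ Σ (DecSet n) (Violates G i)) where

      private
        Λ c : ℕ
        Λ = suc (suc p)
        c = 3 ℕ.* (2 ℕ.* (18 ℕ.* suc g₀) ℕ.+ 3) ℕ.* Λ

      open Bounds α (suc i) g₀ t∈α 0<t 1≤g₀t (λ s∈ → violated G {α} expander s∈ violation) (atMostTwo G {α} expander 1<n)
        using (degree-bound; β-bound; cycle-lower; cycle-upper)
      open Numbers {suc i} {suc g₀} {suc p} {m ℕ.+ length (edges H)} {K} K≥ (s≤s z≤n) (s≤s i≤g₀) (s≤s z≤n)
        (ℕ.≤-trans 1≤m (ℕ.m≤m+n m (length (edges H))))
      open Sizes n p K 2^p≤n k using (absolute; relative)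

      private
        s w : ℕ
        s = Core.s G H (suc i) Λ c (s≤s z≤n) n<2^Λ
        w = 2 ℕ.* suc i ℕ.* s ℕ.+ s

        large : total ℕ.≤ n
        large = absolute {m} {length (edges H)} small-m small-e {total} total≤ 6≤k

        -- Here `c` is `3` for the degree hypothesis and `1` for the cycle hypothesis, giving the
        -- fractions `4 / k` and `2 / k`.
        big : ∀ c (R : DecSet n) → n ℕ.≤ # R ℕ.+ w → (fromℕ 1 ∸ fromℕ (suc c) ÷ k) * fromℕ n ≤ fromℕ (card (toSubset R))
        big c R n≤ = relative {m} {length (edges H)} small-m small-e c {w} {card (toSubset R)}
          (ℕ.≤-trans (ℕ.*-monoʳ-≤ 2 (ℕ.<⇒≤ used<total)) total≤)
          (ℕ.≤-trans n≤ (ℕ.≤-reflexive (cong (ℕ._+ w) (sym (#-toSubset R)))))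

        star : ∀ R → n ℕ.≤ # R ℕ.+ w → ∃ λ x → x ∈ᵈ R × 61 ℕ.* (suc i ℕ.* suc i ℕ.* Δ H) ℕ.≤ # (∂ G R ∅ ⁅ x ⁆)
        star R n≤ =
          let x , x∈ , d = starIn G R (ℕ.+-cancelʳ-≤ w 1 (# R) (ℕ.≤-trans used<total (ℕ.≤-trans large n≤))) in
          x , x∈ , ℕ.≤-trans (degree-bound {Δ H} {Δ (G [ toSubset R ])} (robust (toSubset R) (big 3 R n≤))) d

      minors : Conclusion G k H
      minors = Core.plainMinor G H (suc i) Λ c (s≤s z≤n) n<2^Λ expands large star ,
        λ oddRobust →
        Core.parityMinor G H (suc i) Λ c (s≤s z≤n) n<2^Λ expands large star λ R n≤ R-expands →
        let C , odd , lower , upper = oddRobust (toSubset R) (big 1 R n≤) (inducedExpander G R β (3 ℕ.* suc i) β-bound R-expands)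
            D , e = oddCycleIn G R C odd
        in D , subst (1 ℕ.+ 6 ℕ.* suc i ℕ.≤_) (sym e) (cycle-lower {Cycle.length C} lower) ,
           subst (ℕ._≤ c) (sym e) (cycle-upper {Cycle.length C} {n} {Λ} (ℕ.<⇒≤ n<2^Λ) upper)

    conclusion : Conclusion G k H
    conclusion = by-cases (binaryLog n (ℕ.<⇒≤ 1<n)) (leastExpansion G g₀ (expandsBy G {α} expander (suc g₀) t∈α 1≤g₀t))
      where
      by-cases : (∃ λ q → 2 ℕ.^ q ℕ.≤ n × n ℕ.< 2 ℕ.^ suc q) →
        (∃ λ i → i ℕ.≤ g₀ × ExpandsBy G (suc i) × (i ≡ 0 ⊎ Σ (DecSet n) (Violates G i))) → Conclusion G k H
      by-cases (zero  , _ , n<2) _ = contradiction 1<n (ℕ.<⇒≱ n<2)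
      by-cases (suc p , 2^p≤n , n<2^Λ) (i , i≤g₀ , expands , violation) = minors {p} 2^p≤n n<2^Λ {i} i≤g₀ expands violation

theorem3p3 : ∀ (α : ℝ≥0) → fromℕ 0 < α →
    ∃ λ (ε : ℝ≥0) → ∃ λ (n₀ : ℕ) → fromℕ 0 < ε × n₀ ℕ.> 0 ×
    (∀ {n} (G : Graph n) → n ℕ.> n₀ → Expander α G →
    ∀ (k : ℝ≥0) → fromℕ 6 ≤ k →
    ∀ {m} (H : Graph m) →
    fromℕ m ≤ ε * fromℕ n ÷ (k * log (fromℕ n)) →
    fromℕ (length (edges H)) ≤ ε * fromℕ n ÷ (k * log (fromℕ n)) →
    MaxDegreeRobust (fromℕ 1 ∸ fromℕ 4 ÷ k) (fromℕ (550 ℕ.* Δ H) ÷ α ²) G →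
    TopologicalMinor H G ×
    (let β = α ÷ (fromℕ 3 * (fromℕ 1 + α)) in
    OddCycleRobust (fromℕ 1 ∸ fromℕ 2 ÷ k) β (fromℕ 1 + fromℕ 2 ÷ β) G →
    ∀ (π : Edge H → Parity) →
    ∃ λ (M : TopologicalMinor H G) →
    ∀ e → parity (Path.length (TopologicalMinor.path M e)) ≡ π e))
theorem3p3 α (t , t∈α , b , b<t , 0≤b) =
  -- The threshold `1` suffices: if `H` has a vertex, the bound on `m` itself forces `n` to be large
  -- compared with `log n`, by a factor governed by `ε`.
  ε , 1 , 0<ε , s≤s z≤n , λ
    { G _ _ _ _ {zero} H _ _ _ → noVertices H G , λ _ _ → noVertices H G , λ e → case Edge.source e of λ ()
    ; G 1<n expander k 6≤k {suc _} H small-m small-e robust → conclusion G 1<n expander k 6≤k (s≤s z≤n) H small-m small-e robust }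
  where
  0<t : 0ℚ ℚ.< t
  0<t = ℚ.≤-<-trans (0≤b refl) b<t
  g₀ = proj₁ (0<⇒ι 0<t)
  open Main α t∈α 0<t g₀ (proj₂ (0<⇒ι 0<t)) (constant (suc g₀)) ℕ.≤-refl using (ε; 0<ε; conclusion)
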